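{- Assume (a) for every $r\ge2$ and $N>0$ the map $\mathbf W_{N,r}\to\{v\in\mathsf{Vect}_{N,r}: vE_{N,r}=0\}$, $P\mapsto\pi(P)F_{N,r}$, is injective, and (b) for all $r\ge3$ and $N>0$, $$\operatorname{Im}\Big(\phi^{(r-1)}\circ\phi^{(r-2)}|_{\mathbf W_{N,r}}\circ\cdots\circ\phi^{(2)}|_{\mathbf W_{N,r}}\Big)=\ker\phi^{(r)}\cap\operatorname{Im}\big(\phi^{(r-1)}\circ\cdots\circ\phi^{(2)}\big).$$ Then for all $r\geq3$, $$T_r(x)=\mathbb O(x)T_{r-1}(x)-\mathbb S(x)T_{r-2}(x)+\mathbb O(x)^{r-2}\mathbb S(x).$$
   Context: All vector spaces over $\mathbb Q$. $S_{N,r}=\{(n_1,\dots,n_r)\in\mathbb Z^r: \sum n_i=N,\ n_i\geq 3\text{ odd}\}$, lexicographically decreasingly ordered. $\mathsf{Vect}_{N,r}=\mathbb Q^{S_{N,r}}$ (row vectors); $\mathbf V_{N,r}$ is the span of $x_1^{n_1-1}\cdots x_r^{n_r-1}$, $(n_i)\in S_{N,r}$; $\pi$ maps a polynomial to its coefficient vector. $\mathbf W_{N,r}=\{P\in\mathbf V_{N,r}: P(x_1,\dots,x_r)=P(x_2-x_1,x_2,x_3,\dots,x_r)-P(x_2-x_1,x_1,x_3,\dots,x_r)\}$. The restricted totally even part of a polynomial is the sum of its monomials in which every exponent is even and at least $2$. For $1\le j\le r$, $\phi^{(j)}:\mathbf V_{N,r}\to\mathbf V_{N,r}$ maps $Q$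 to the restricted totally even part of $Q(x_1,\dots,x_r)+\sum_{i=r-j+1}^{r-1}\big(Q(x_1,\dots,x_{r-j},x_{i+1}-x_i,x_{r-j+1},\dots,\widehat{x_{i+1}},\dots,x_r)-Q(x_1,\dots,x_{r-j},x_{i+1}-x_i,x_{r-j+1},\dots,\widehat{x_i},\dots,x_r)\big)$ (hats denote omission); for $2\le j\le r-2$, $\phi^{(j)}$ maps $\mathbf W_{N,r}$ into itself, and in (b) the left-hand map has domain $\mathbf W_{N,r}$. For $f$ in one variable and $g$ in $r-1$ variables, $(f\circ g)(x_1,\dots,x_r)=f(x_1)g(x_2,\dots,x_r)+\sum_{i=1}^{r-1}\big(f(x_{i+1}-x_i)g(x_1,\dots,\widehat{x_{i+1}},\dots,x_r)-(-1)^{\deg f}f(x_i-x_{i+1})g(x_1,\dots,\widehat{x_i},\dots,x_r)\big)$; $e\binom{m_1,\dots,m_r}{n_1,\dots,n_r}$ is the coefficient of $x_1^{n_1-1}\cdots x_r^{n_r-1}$ in $x_1^{m_1-1}\circ(x_1^{m_2-1}\cdots x_{r-1}^{m_r-1})$. $E_{N,r}$ has $(m,n)$ entry $e\binom{m_1,\dots,m_r}{n_1,\dots,n_r}$; for $2\le j\le r$, $E^{(j)}_{N,r}$ has $(m,n)$ entry $\delta_{(m_1,\dots,m_{r-j}),(n_1,\dots,n_{r-j})}\,e\binom{m_{r-j+1},\dots,m_r}{n_{r-j+1},\dots,n_r}$ (Kronecker delta). $C_{N,r}=E^{(2)}_{N,r}\cdots E^{(r-1)}_{N,r}E_{N,r}$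 ($C_{N,2}=E_{N,2}$). $F_{N,r}=E_{N,r}-\mathrm{id}$ (it is known that $\pi(P)F_{N,r}E_{N,r}=0$ for $P\in\mathbf W_{N,r}$). $T_r(x)=\sum_{N>0}\dim_{\mathbb Q}\ker C_{N,r}\,x^N$ for $r\ge2$ ($\ker$ = right annihilators), and $T_0(x)=T_1(x)=0$. $\mathbb O(x)=\frac{x^3}{1-x^2}$, $\mathbb S(x)=\frac{x^{12}}{(1-x^4)(1-x^6)}$. -}

module Defs where

open import Data.Nat as N using (ℕ; zero; suc; _∸_; _≡ᵇ_; _≤_; _<_)
open import Data.Bool using (Bool; true; false; if_then_else_; _∧_)
open import Data.Fin using (Fin; toℕ)
open import Data.List as L using (List; []; _∷_; _++_; map; concatMap; filter; upTo; allFin; length; foldr; foldl)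
import Data.List.Properties as LP
open import Data.Vec as V using (Vec; []; _∷_)
open import Data.Rational as Q using (ℚ; 0ℚ; 1ℚ)
import Data.Rational.Properties as QP
open import Data.Integer as Z using (ℤ)
open import Data.Product using (Σ; _×_; _,_)
open import Relation.Nullary using (yes; no; ¬_)
open import Relation.Nullary.Decidable using (⌊_⌋)
open import Relation.Binary.PropositionalEquality using (_≡_)
open import Function using (_⇔_)

sumℚ : List ℚ → ℚ
sumℚ = foldr Q._+_ 0ℚ

-- [a, a+1, ..., b]  (empty if b < a); 1-based index ranges of the paper
between : ℕ → ℕ → List ℕ
between a b = map (a N.+_) (upTo (suc b ∸ a))

-- Polynomials in r variables over ℚ, as finite lists of terms
-- (coefficient, exponent vector).  Two polynomials are equal iff all
-- their coefficients agree (see `coeff`).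

Poly : ℕ → Set
Poly r = List (ℚ × Vec ℕ r)

zeroP : ∀ {r} → Poly r
zeroP = []

oneP : ∀ {r} → Poly r
oneP {r} = (1ℚ , V.replicate r 0) ∷ []

_+P_ : ∀ {r} → Poly r → Poly r → Poly r
p +P q = p ++ q

scaleP : ∀ {r} → ℚ → Poly r → Poly r
scaleP c = map (λ { (d , e) → (c Q.* d , e) })

negP : ∀ {r} → Poly r → Poly r
negP = scaleP (Q.- 1ℚ)

_-P_ : ∀ {r} → Poly r → Poly r → Poly r
p -P q = p +P negP q

_*P_ : ∀ {r} → Poly r → Poly r → Poly r
p *P q = concatMap (λ { (c , e) → map (λ { (d , f) → (c Q.* d , V.zipWith N._+_ e f) }) q }) p

powP : ∀ {r} → Poly r → ℕ → Poly r
powP p zero    = oneP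
powP p (suc k) = p *P powP p k

sumP : ∀ {r} → List (Poly r) → Poly r
sumP = foldr _+P_ zeroP

monoP : ∀ {r} → Vec ℕ r → Poly r
monoP e = (1ℚ , e) ∷ []

-- the variable x_k (1-based index k) in r variables
var : (r : ℕ) → ℕ → Poly r
var r k = monoP (V.tabulate (λ i → if suc (toℕ i) ≡ᵇ k then 1 else 0))

vars : (r : ℕ) → ℕ → ℕ → List (Poly r)
vars r a b = map (var r) (between a b)

varsOmit : (r : ℕ) → ℕ → ℕ → ℕ → List (Poly r)
varsOmit r a b k = map (var r) (filter (λ i → ¬? (i N.≟ k)) (between a b))
  where open import Relation.Nullary.Decidable using (¬?)

substMono : ∀ {r s} → Vec ℕ r → List (Poly s) → Poly s
substMono []       _        = oneP
substMono (k ∷ e)  []       = powP zeroP k *P substMono e []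
substMono (k ∷ e)  (q ∷ qs) = powP q k *P substMono e qs

subst : ∀ {r s} → Poly r → List (Poly s) → Poly s
subst p σ = sumP (map (λ { (c , e) → scaleP c (substMono e σ) }) p)

coeff : ∀ {r} → Poly r → Vec ℕ r → ℚ
coeff p e = sumℚ (map (λ { (c , e') → if ⌊ V.≡-dec N._≟_ e' e ⌋ then c else 0ℚ }) p)
  where import Data.Vec.Properties as V

coeffL : ∀ {r} → Poly r → List ℕ → ℚ
coeffL p e = sumℚ (map (λ { (c , e') → if ⌊ LP.≡-dec N._≟_ (V.toList e') e ⌋ then c else 0ℚ }) p)

-- S_{N,r}: tuples (n_1..n_r) with n_i ≥ 3 odd and Σ n_i = N,
-- listed in lexicographically decreasing order.

oddsDown : ℕ → List ℕ
oddsDown N = filter (λ n → (3 N.≤? n) Relation.Nullary.Decidable.×-dec ((n N.% 2) N.≟ 1))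
                    (L.reverse (upTo (suc N)))
  where import Relation.Nullary.Decidable

S : ℕ → (r : ℕ) → List (Vec ℕ r)
S N zero    = if N ≡ᵇ 0 then [] ∷ [] else []
S N (suc r) = concatMap (λ n → map (n ∷_) (S (N ∸ n) r)) (oddsDown N)

size : ℕ → ℕ → ℕ
size N r = length (S N r)

tup : (N r : ℕ) → Fin (size N r) → Vec ℕ r
tup N r i = L.lookup (S N r) i

Vect : ℕ → ℕ → Set
Vect N r = Fin (size N r) → ℚ

Mat : ℕ → ℕ → Set
Mat N r = Fin (size N r) → Fin (size N r) → ℚ

Eq : (N r : ℕ) → Vect N r → Vect N r → Set
Eq N r v w = ∀ i → v i ≡ w i

zeroV : (N r : ℕ) → Vect N r
zeroV N r _ = 0ℚ

vecMat : (N r : ℕ) → Vect N r → Mat N r → Vect N r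
vecMat N r v A n = sumℚ (map (λ m → v m Q.* A m n) (allFin (size N r)))

matVec : (N r : ℕ) → Mat N r → Vect N r → Vect N r
matVec N r A w m = sumℚ (map (λ n → A m n Q.* w n) (allFin (size N r)))

matMul : (N r : ℕ) → Mat N r → Mat N r → Mat N r
matMul N r A B m n = sumℚ (map (λ l → A m l Q.* B l n) (allFin (size N r)))

idM : (N r : ℕ) → Mat N r
idM N r m n = if ⌊ m Data.Fin.≟ n ⌋ then 1ℚ else 0ℚ
  where import Data.Fin

matSub : (N r : ℕ) → Mat N r → Mat N r → Mat N r
matSub N r A B m n = A m n Q.- B m n

-- The polynomial P ∈ V_{N,r} with coefficient vector v (so π(P) = v),
-- the monomial for (n_i) being x_1^{n_1-1} ⋯ x_r^{n_r-1}.

exps : ∀ {r} → Vec ℕ r → Vec ℕ r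
exps = V.map (λ n → n ∸ 1)

toPoly : (N r : ℕ) → Vect N r → Poly r
toPoly N r v = map (λ i → (v i , exps (tup N r i))) (allFin (size N r))

InW : (N r : ℕ) → Vect N r → Set
InW N r v =
  ∀ e → coeff P e ≡ coeff (subst P ((var r 2 -P var r 1) ∷ var r 2 ∷ vars r 3 r)
                            -P subst P ((var r 2 -P var r 1) ∷ var r 1 ∷ vars r 3 r)) e
  where P = toPoly N r v

-- φ^{(j)} on V_{N,r} (in π-coordinates).  The restricted totally even
-- part lives in V_{N,r}; its coefficient at the monomial of (n_i) ∈ S_{N,r}
-- is the coefficient of x^{n-1} (all exponents even ≥ 2).
φ : (N r j : ℕ) → Vect N r → Vect N r
φ N r j v n = coeff expr (exps (tup N r n))
  where
  Qp = toPoly N r v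
  k = r ∸ j
  term : ℕ → Poly r
  term i = subst Qp (vars r 1 k ++ ((var r (suc i) -P var r i) ∷ varsOmit r (suc k) r (suc i)))
        -P subst Qp (vars r 1 k ++ ((var r (suc i) -P var r i) ∷ varsOmit r (suc k) r i))
  expr = Qp +P sumP (map term (between (suc k) (r ∸ 1)))

Φ : (N r : ℕ) → Vect N r → Vect N r
Φ N r v = foldl (λ w j → φ N r j w) v (between 2 (r ∸ 1))

-- The operation f ∘ g: f a polynomial in one variable of degree d,
-- g a polynomial in r-1 variables, result in r variables.

compose : ∀ {r'} → Poly 1 → ℕ → Poly r' → Poly (suc r')
compose {r'} f d g =
  (subst f (var r 1 ∷ []) *P subst g (vars r 2 r))
  +P sumP (map term (between 1 r'))
  where
  r = suc r'
  sign : ℚ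
  sign = if ⌊ (d N.% 2) N.≟ 0 ⌋ then 1ℚ else Q.- 1ℚ
  term : ℕ → Poly r
  term i = (subst f ((var r (suc i) -P var r i) ∷ []) *P subst g (varsOmit r 1 r (suc i)))
        -P scaleP sign (subst f ((var r i -P var r (suc i)) ∷ []) *P subst g (varsOmit r 1 r i))

e : List ℕ → List ℕ → ℚ
e []        ns = 0ℚ
e (m ∷ ms)  ns =
  coeffL (compose (monoP ((m ∸ 1) ∷ [])) (m ∸ 1) (monoP (exps (V.fromList ms))))
         (map (λ n → n ∸ 1) ns)

E : (N r : ℕ) → Mat N r
E N r m n = e (V.toList (tup N r m)) (V.toList (tup N r n))

Ej : (N r j : ℕ) → Mat N r
Ej N r j m n =
  if ⌊ LP.≡-dec N._≟_ (L.take k ms) (L.take k ns) ⌋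
  then e (L.drop k ms) (L.drop k ns) else 0ℚ
  where
  k = r ∸ j
  ms = V.toList (tup N r m)
  ns = V.toList (tup N r n)

C : (N r : ℕ) → Mat N r
C N r = foldr (λ j A → matMul N r (Ej N r j) A) (E N r) (between 2 (r ∸ 1))

F : (N r : ℕ) → Mat N r
F N r = matSub N r (E N r) (idM N r)

InKer : (N r : ℕ) → Mat N r → Vect N r → Set
InKer N r A w = Eq N r (matVec N r A w) (zeroV N r)

lincomb : (N r d : ℕ) → (Fin d → ℚ) → (Fin d → Vect N r) → Vect N r
lincomb N r d c b i = sumℚ (map (λ j → c j Q.* b j i) (allFin d))

KerDim : (N r : ℕ) → Mat N r → ℕ → Set
KerDim N r A d =
  Σ (Fin d → Vect N r) λ b →
    (∀ j → InKer N r A (b j))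
  × (∀ (c : Fin d → ℚ) → Eq N r (lincomb N r d c b) (zeroV N r) → ∀ j → c j ≡ 0ℚ)
  × (∀ w → InKer N r A w → Σ (Fin d → ℚ) λ c → Eq N r w (lincomb N r d c b))

Series : Set
Series = ℕ → ℤ

_⋆_ : Series → Series → Series
(f ⋆ g) n = foldr Z._+_ (Z.+ 0) (map (λ a → f a Z.* g (n ∸ a)) (upTo (suc n)))

_⊕_ : Series → Series → Series
(f ⊕ g) n = f n Z.+ g n

_⊖_ : Series → Series → Series
(f ⊖ g) n = f n Z.- g n

powS : Series → ℕ → Series
powS f zero    n = if n ≡ᵇ 0 then Z.+ 1 else Z.+ 0
powS f (suc k)   = f ⋆ powS f k

xpow : ℕ → Series
xpow k n = if n ≡ᵇ k then Z.+ 1 else Z.+ 0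

-- 1/(1 - x^k) = Σ_i x^{k i}   (k ≥ 1)
geom : ℕ → Series
geom k n = if ⌊ (n N.% suc (k ∸ 1)) N.≟ 0 ⌋ then Z.+ 1 else Z.+ 0

𝕆 : Series
𝕆 = xpow 3 ⋆ geom 2

𝕊 : Series
𝕊 = xpow 12 ⋆ (geom 4 ⋆ geom 6)

-- T_r(x) = Σ_{N>0} dim ker C_{N,r} x^N for r ≥ 2, T_0 = T_1 = 0,
-- given a function `dim` with dim r N = dim ker C_{N,r}.
T : (ℕ → ℕ → ℕ) → ℕ → Series
T dim r N = if (2 N.≤ᵇ r) ∧ (1 N.≤ᵇ N) then Z.+ (dim r N) else Z.+ 0

HypA : Set
HypA = ∀ (r N : ℕ) → 2 ≤ r → 0 < N →
  ∀ (v v' : Vect N r) → InW N r v → InW N r v' →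
  Eq N r (vecMat N r v (F N r)) (vecMat N r v' (F N r)) → Eq N r v v'

HypB : Set
HypB = ∀ (r N : ℕ) → 3 ≤ r → 0 < N → ∀ (v : Vect N r) →
  (Σ (Vect N r) λ P → InW N r P × Eq N r (Φ N r P) v)
  ⇔ (Eq N r (φ N r r v) (zeroV N r) × Σ (Vect N r) λ P → Eq N r (Φ N r P) v)

{-# OPTIONS --safe #-}
-- The rank of a matrix A is tr (A G) for any G with A G A = A, and rank formulas become
-- identities between traces.  Since π(φ⁽ʲ⁾ P) = π(P) E⁽ʲ⁾, we have C = Φ E with
-- Φ = E⁽²⁾ ⋯ E⁽ʳ⁻¹⁾, and rank Φ − rank C is the dimension of Im Φ ∩ ker φ⁽ʳ⁾, that is, by (b),
-- the rank of Φ on W.  As Φ is block diagonal in n₁ with blocks C_{N−n₁,r−1}, its own rank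
-- accounts for 𝕆 T_{r−1}.  Elements of W are antisymmetric in x₁, x₂, which gives
-- φ⁽ʳ⁻¹⁾ = −F on W, an injective map by (a); the other factors of Φ only move x₃, …, x_r,
-- and W_{N,r} = ⊕ W_{M,2} ⊗ V_{N−M,r−2}, so the rank of Φ on W is ∑ dim W_{M,2} · rank C_{N−M,r−2}.
-- Finally ∑ dim W_{M,2} x^M = 𝕊: with U : (x, y) ↦ (y, y − x) and τ the swap, W_{M,2} consists of
-- the antisymmetric even forms annihilated by 1 + U + U².  A functional fixed by U, negated by τ
-- and vanishing on even forms is invariant under x ↦ x + y, hence zero; so the dimension is the
-- difference of those of the antisymmetric even forms and of the forms fixed by U and negated by
-- τ, and both are computed as traces.
module Submission where

open import Defs
open import Data.Nat as ℕ using (ℕ; zero; suc; _∸_; _≤_; _<_; z≤n; s≤s)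
import Data.Nat.Properties as ℕP
open import Data.Bool using (true; false; if_then_else_)
open import Data.Fin as Fin using (Fin; toℕ)
open import Data.List as List using (List; []; _∷_; _++_; map; concatMap; filter; upTo; allFin; length; foldr; foldl)
import Data.List.Properties as ListP
open import Data.List.Membership.Propositional using (_∈_; _∉_; find; lose)
import Data.List.Membership.Propositional.Properties as ∈P
open import Data.List.Relation.Unary.Any as Any using (Any; here; there)
open import Data.List.Relation.Unary.All as All using (All; []; _∷_)
open import Data.List.Relation.Unary.All.Properties using (¬All⇒Any¬)
open import Data.List.Relation.Unary.AllPairs using ([]; _∷_)
open import Data.List.Relation.Unary.Unique.Propositional using (Unique)
open import Data.Vec as Vec using (Vec; []; _∷_)
import Data.Vec.Properties as VecP
open import Data.Rational as ℚ using (ℚ; 0ℚ; 1ℚ; ½; _+_; _*_; -_; _-_)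
import Data.Rational.Properties as ℚP
open import Data.Product using (Σ; ∃; _×_; _,_; proj₁; proj₂)
open import Data.Sum using (_⊎_; inj₁; inj₂)
open import Data.Empty using (⊥-elim)
open import Function using (_∘_; id; Equivalence)
open import Level using (0ℓ)
open import Relation.Nullary using (Dec; yes; no; ¬_)
open import Relation.Nullary.Decidable using (⌊_⌋; ¬?; dec⇒maybe; _×-dec_)
open import Relation.Binary.Definitions using (DecidableEquality; tri<; tri≈; tri>)
open import Relation.Binary.PropositionalEquality as ≡
  using (_≡_; _≢_; refl; sym; trans; cong; cong₂; module ≡-Reasoning)
open import Tactic.RingSolver using (solve-∀)
open import Tactic.RingSolver.Core.AlmostCommutativeRing using (AlmostCommutativeRing; fromCommutativeRing)
open import Algebra.Bundles using (Ring)
import Algebra.Properties.Ring as RingP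
import Relation.Binary.Reasoning.Setoid as SetoidReasoning
import Data.List.Relation.Unary.Unique.Propositional.Properties as UniqueP
import Data.List.Relation.Unary.Unique.DecPropositional.Properties as DecUniqueP
import Data.List.Relation.Unary.Any.Properties as AnyP
import Data.Nat.DivMod as DivMod
open import Data.Integer as ℤ using (ℤ)
import Data.Integer.Properties as ℤP
import Data.Rational.Unnormalised as ℚᵘ
import Data.Rational.Unnormalised.Properties as ℚᵘP

-- No basis of W or of an image is ever chosen. W is carried by an idempotent matrix that has W as
-- its row space (`𝐊` in two variables, `tensor 𝐊 δᴳ` in general), and its dimension is the trace of
-- that idempotent. Statements about ranks thereby become equations in a ring with a cyclic trace.
-- Both inclusions of (b) enter: one says that Φ carries W into the left kernel of E, the other
-- supplies a preimage in W for every element of Im Φ that E kills. What is proved first is a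
-- recursion for ranks: if R_r is the series of the ranks of C, then R_r = 𝕆 R_{r-1} - 𝕊 R_{r-2}.
-- The number of tuples in S_{N,r} has the series 𝕆^r, so T_r = 𝕆^r - R_r, and passing from ranks to
-- nullities leaves the inhomogeneous term 𝕆^{r-2} 𝕊.

ℚ-ring : AlmostCommutativeRing 0ℓ 0ℓ
ℚ-ring = fromCommutativeRing ℚP.+-*-commutativeRing (λ x → dec⇒maybe (0ℚ ℚP.≟ x))

*-distribˡ-- : ∀ a b c → a * (b - c) ≡ a * b - a * c
*-distribˡ-- = solve-∀ ℚ-ring

*-distribʳ-- : ∀ a b c → (a - b) * c ≡ a * c - b * c
*-distribʳ-- = solve-∀ ℚ-ring

*-interchange : ∀ a b c d → a * b * (c * d) ≡ a * c * (b * d)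
*-interchange = solve-∀ ℚ-ring

neg-diff : ∀ a b → a - b ≡ - (b - a)
neg-diff = solve-∀ ℚ-ring

*-exchange : ∀ a b c → a * (b * c) ≡ b * (a * c)
*-exchange = solve-∀ ℚ-ring

neg-*ˡ : ∀ a b → (- a) * b ≡ - (a * b)
neg-*ˡ = solve-∀ ℚ-ring

-- Finite sums and indicators over ℚ.

∑ : {I : Set} → List I → (I → ℚ) → ℚ
∑ xs f = sumℚ (map f xs)

∑-cong : {I : Set} (xs : List I) {f g : I → ℚ} → (∀ i → f i ≡ g i) → ∑ xs f ≡ ∑ xs g
∑-cong []       h = refl
∑-cong (x ∷ xs) h = cong₂ _+_ (h x) (∑-cong xs h)

∑-cong∈ : {I : Set} (xs : List I) {f g : I → ℚ} → (∀ i → i ∈ xs → f i ≡ g i) → ∑ xs f ≡ ∑ xs g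
∑-cong∈ []       h = refl
∑-cong∈ (x ∷ xs) h = cong₂ _+_ (h x (here refl)) (∑-cong∈ xs (λ i i∈ → h i (there i∈)))

∑-zero : {I : Set} (xs : List I) → ∑ xs (λ _ → 0ℚ) ≡ 0ℚ
∑-zero []       = refl
∑-zero (x ∷ xs) = trans (ℚP.+-identityˡ _) (∑-zero xs)

∑-zero∈ : {I : Set} (xs : List I) {f : I → ℚ} → (∀ i → i ∈ xs → f i ≡ 0ℚ) → ∑ xs f ≡ 0ℚ
∑-zero∈ xs h = trans (∑-cong∈ xs h) (∑-zero xs)

+-interchange : ∀ a b c d → (a + b) + (c + d) ≡ (a + c) + (b + d)
+-interchange = solve-∀ ℚ-ring

∑-+ : {I : Set} (xs : List I) (f g : I → ℚ) → ∑ xs (λ i → f i + g i) ≡ ∑ xs f + ∑ xs g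
∑-+ []       f g = refl
∑-+ (x ∷ xs) f g = trans (cong (f x + g x +_) (∑-+ xs f g)) (+-interchange (f x) (g x) (∑ xs f) (∑ xs g))

∑-*ˡ : {I : Set} (xs : List I) (c : ℚ) (f : I → ℚ) → c * ∑ xs f ≡ ∑ xs (λ i → c * f i)
∑-*ˡ []       c f = ℚP.*-zeroʳ c
∑-*ˡ (x ∷ xs) c f = trans (ℚP.*-distribˡ-+ c (f x) (∑ xs f)) (cong (c * f x +_) (∑-*ˡ xs c f))

∑-*ʳ : {I : Set} (xs : List I) (c : ℚ) (f : I → ℚ) → ∑ xs f * c ≡ ∑ xs (λ i → f i * c)
∑-*ʳ []       c f = ℚP.*-zeroˡ c
∑-*ʳ (x ∷ xs) c f = trans (ℚP.*-distribʳ-+ c (f x) (∑ xs f)) (cong (f x * c +_) (∑-*ʳ xs c f))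

neg≡-1* : ∀ a → - a ≡ (- 1ℚ) * a
neg≡-1* = solve-∀ ℚ-ring

∑-neg : {I : Set} (xs : List I) (f : I → ℚ) → ∑ xs (λ i → - f i) ≡ - ∑ xs f
∑-neg xs f = begin
  ∑ xs (λ i → - f i)          ≡⟨ ∑-cong xs (λ i → neg≡-1* (f i)) ⟩
  ∑ xs (λ i → (- 1ℚ) * f i)   ≡⟨ ∑-*ˡ xs (- 1ℚ) f ⟨
  (- 1ℚ) * ∑ xs f             ≡⟨ neg≡-1* (∑ xs f) ⟨
  - ∑ xs f                    ∎ where open ≡-Reasoning

∑-- : {I : Set} (xs : List I) (f g : I → ℚ) → ∑ xs (λ i → f i - g i) ≡ ∑ xs f - ∑ xs g
∑-- xs f g = trans (∑-+ xs f (λ i → - g i)) (cong (∑ xs f +_) (∑-neg xs g))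

∑-swap : {I J : Set} (xs : List I) (ys : List J) (f : I → J → ℚ) →
  ∑ xs (λ i → ∑ ys (f i)) ≡ ∑ ys (λ j → ∑ xs (λ i → f i j))
∑-swap []       ys f = sym (∑-zero ys)
∑-swap (x ∷ xs) ys f = trans (cong (∑ ys (f x) +_) (∑-swap xs ys f))
  (sym (∑-+ ys (f x) (λ j → ∑ xs (λ i → f i j))))

∑-++ : {I : Set} (xs ys : List I) (f : I → ℚ) → ∑ (xs ++ ys) f ≡ ∑ xs f + ∑ ys f
∑-++ []       ys f = sym (ℚP.+-identityˡ _)
∑-++ (x ∷ xs) ys f = trans (cong (f x +_) (∑-++ xs ys f)) (sym (ℚP.+-assoc (f x) (∑ xs f) (∑ ys f)))

∑-map : {I J : Set} (h : I → J) (xs : List I) (f : J → ℚ) → ∑ (map h xs) f ≡ ∑ xs (f ∘ h)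
∑-map h xs f = cong sumℚ (sym (ListP.map-∘ xs))

∑-concatMap : {I J : Set} (h : I → List J) (xs : List I) (f : J → ℚ) →
  ∑ (concatMap h xs) f ≡ ∑ xs (λ i → ∑ (h i) f)
∑-concatMap h []       f = refl
∑-concatMap h (x ∷ xs) f = trans (∑-++ (h x) (concatMap h xs) f) (cong (∑ (h x) f +_) (∑-concatMap h xs f))

ind : {P : Set} → Dec P → ℚ
ind d = if ⌊ d ⌋ then 1ℚ else 0ℚ

ind-yes : {P : Set} (d : Dec P) → P → ind d ≡ 1ℚ
ind-yes (yes _) p = refl
ind-yes (no ¬p) p = ⊥-elim (¬p p)

ind-no : {P : Set} (d : Dec P) → ¬ P → ind d ≡ 0ℚ
ind-no (yes p) ¬p = ⊥-elim (¬p p)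
ind-no (no _)  ¬p = refl

ind-⇔ : {P Q : Set} (d : Dec P) (d′ : Dec Q) → (P → Q) → (Q → P) → ind d ≡ ind d′
ind-⇔ (yes p) d′ to from = sym (ind-yes d′ (to p))
ind-⇔ (no ¬p) d′ to from = sym (ind-no d′ (¬p ∘ from))

ind-* : {P Q R : Set} (p : Dec P) (q : Dec Q) (r : Dec R) →
  (P → Q → R) → (R → P) → (R → Q) → ind r ≡ ind p * ind q
ind-* (yes p) q r f g h = trans (ind-⇔ r q h (f p)) (sym (ℚP.*-identityˡ (ind q)))
ind-* (no ¬p) q r f g h = trans (ind-no r (¬p ∘ g)) (sym (ℚP.*-zeroˡ (ind q)))

if-ind : {P : Set} (d : Dec P) (c : ℚ) → (if ⌊ d ⌋ then c else 0ℚ) ≡ ind d * c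
if-ind (yes _) c = sym (ℚP.*-identityˡ c)
if-ind (no _)  c = sym (ℚP.*-zeroˡ c)

module _ {I : Set} (_≟_ : DecidableEquality I) where

  ∑-δ∉ : (xs : List I) (f : I → ℚ) {i : I} → i ∉ xs → ∑ xs (λ j → ind (i ≟ j) * f j) ≡ 0ℚ
  ∑-δ∉ xs f {i} i∉ = ∑-zero∈ xs λ j j∈ →
    trans (cong (_* f j) (ind-no (i ≟ j) (λ { refl → i∉ j∈ }))) (ℚP.*-zeroˡ (f j))

  ∑-δ : {xs : List I} → Unique xs → (f : I → ℚ) {i : I} → i ∈ xs → ∑ xs (λ j → ind (i ≟ j) * f j) ≡ f i
  ∑-δ {x ∷ xs} (x∉ ∷ u) f {i} (here refl) = begin
    ind (x ≟ x) * f x + ∑ xs (λ j → ind (x ≟ j) * f j)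
      ≡⟨ cong₂ _+_ (cong (_* f x) (ind-yes (x ≟ x) refl)) (∑-δ∉ xs f (λ x∈ → All.lookup x∉ x∈ refl)) ⟩
    1ℚ * f x + 0ℚ  ≡⟨ trans (ℚP.+-identityʳ _) (ℚP.*-identityˡ (f x)) ⟩
    f x            ∎ where open ≡-Reasoning
  ∑-δ {x ∷ xs} (x∉ ∷ u) f {i} (there i∈) = begin
    ind (i ≟ x) * f x + ∑ xs (λ j → ind (i ≟ j) * f j)
      ≡⟨ cong₂ _+_ (cong (_* f x) (ind-no (i ≟ x) (λ { refl → All.lookup x∉ i∈ refl }))) (∑-δ u f i∈) ⟩
    0ℚ * f x + f i  ≡⟨ trans (cong (_+ f i) (ℚP.*-zeroˡ (f x))) (ℚP.+-identityˡ (f i)) ⟩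
    f i             ∎ where open ≡-Reasoning

  ∑-δʳ : {xs : List I} → Unique xs → (f : I → ℚ) {i : I} → i ∈ xs → ∑ xs (λ j → f j * ind (j ≟ i)) ≡ f i
  ∑-δʳ {xs} u f {i} i∈ = trans
    (∑-cong xs (λ j → trans (ℚP.*-comm (f j) _) (cong (_* f j) (ind-⇔ (j ≟ i) (i ≟ j) sym sym))))
    (∑-δ u f i∈)

-- Matrices and generalised inverses

infixl 7 _⟨_⟩_

-- Matrices are functions on whole index types, and a list says which indices count. The same
-- function can thus serve with several lists, and equations between matrices are claimed on listed
-- indices only.
_⟨_⟩_ : {I J K : Set} → (I → J → ℚ) → List J → (J → K → ℚ) → I → K → ℚ
(A ⟨ ys ⟩ B) i k = ∑ ys (λ j → A i j * B j k)

⟨⟩-assoc : {I J K L : Set} (ys : List J) (zs : List K) (A : I → J → ℚ) (B : J → K → ℚ) (C : K → L → ℚ) →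
  ∀ i l → ((A ⟨ ys ⟩ B) ⟨ zs ⟩ C) i l ≡ (A ⟨ ys ⟩ (B ⟨ zs ⟩ C)) i l
⟨⟩-assoc ys zs A B C i l = begin
  ∑ zs (λ k → ∑ ys (λ j → A i j * B j k) * C k l)
    ≡⟨ ∑-cong zs (λ k → ∑-*ʳ ys (C k l) (λ j → A i j * B j k)) ⟩
  ∑ zs (λ k → ∑ ys (λ j → A i j * B j k * C k l))
    ≡⟨ ∑-swap zs ys (λ k j → A i j * B j k * C k l) ⟩
  ∑ ys (λ j → ∑ zs (λ k → A i j * B j k * C k l))
    ≡⟨ ∑-cong ys (λ j → trans (∑-cong zs (λ k → ℚP.*-assoc (A i j) (B j k) (C k l))) (sym (∑-*ˡ zs (A i j) (λ k → B j k * C k l)))) ⟩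
  ∑ ys (λ j → A i j * ∑ zs (λ k → B j k * C k l)) ∎
  where open ≡-Reasoning

⟨⟩-cong : {I J K : Set} (ys : List J) {A A′ : I → J → ℚ} {B B′ : J → K → ℚ} {i : I} {k : K} →
  (∀ j → j ∈ ys → A i j ≡ A′ i j) → (∀ j → j ∈ ys → B j k ≡ B′ j k) →
  (A ⟨ ys ⟩ B) i k ≡ (A′ ⟨ ys ⟩ B′) i k
⟨⟩-cong ys h h′ = ∑-cong∈ ys (λ j j∈ → cong₂ _*_ (h j j∈) (h′ j j∈))

tr⟨⟩-comm : {I J : Set} (xs : List I) (ys : List J) (A : I → J → ℚ) (B : J → I → ℚ) →
  ∑ xs (λ i → (A ⟨ ys ⟩ B) i i) ≡ ∑ ys (λ j → (B ⟨ xs ⟩ A) j j)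
tr⟨⟩-comm xs ys A B = trans (∑-swap xs ys (λ i j → A i j * B j i))
  (∑-cong ys (λ j → ∑-cong xs (λ i → ℚP.*-comm (A i j) (B j i))))

-‿zero : ∀ a b → a - b ≡ 0ℚ → a ≡ b
-‿zero a b h = trans (lem a b) (trans (cong (_+ b) h) (ℚP.+-identityˡ b))
  where
  lem : ∀ a b → a ≡ (a - b) + b
  lem = solve-∀ ℚ-ring

IsGInv : {I J : Set} → List I → List J → (I → J → ℚ) → (J → I → ℚ) → Set
IsGInv xs ys A G = ∀ i j → i ∈ xs → j ∈ ys → (A ⟨ ys ⟩ (G ⟨ xs ⟩ A)) i j ≡ A i j

module _ {I J : Set} (_≟I_ : DecidableEquality I) (_≟J_ : DecidableEquality J)
         {xs : List I} (uxs : Unique xs) (A : I → J → ℚ) where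

  private
    zero-or-pivot : (c : I → ℚ) → (∀ i → i ∈ xs → c i ≡ 0ℚ) ⊎ Σ I λ i → i ∈ xs × c i ≢ 0ℚ
    zero-or-pivot c with All.all? (λ i → c i ℚP.≟ 0ℚ) xs
    ... | yes p = inj₁ (λ i i∈ → All.lookup p i∈)
    ... | no ¬p with find (¬All⇒Any¬ (λ i → c i ℚP.≟ 0ℚ) xs ¬p)
    ...   | i , i∈ , ci≢0 = inj₂ (i , i∈ , ci≢0)

  -- Greville's recursion: the columns are appended one at a time, and a column independent of
  -- the previous ones is split off by a linear form vanishing on them.
  ginv : {ys : List J} → Unique ys → ∃ (IsGInv xs ys A)
  ginv {[]} [] = (λ _ _ → 0ℚ) , λ _ _ _ ()
  ginv {y ∷ ys} (y∉ ∷ uys) = G′ , proof (zero-or-pivot c) refl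
    where
    ih = ginv uys
    G = proj₁ ih
    -- The residual of the column `y`: `A ⟨ ys ⟩ G` projects onto the span of the earlier columns,
    -- so `c` vanishes on `xs` exactly when `y` depends on them.
    c : I → ℚ
    c i = A i y - (A ⟨ ys ⟩ (G ⟨ xs ⟩ A)) i y
    form : (∀ i → i ∈ xs → c i ≡ 0ℚ) ⊎ (Σ I λ i → i ∈ xs × c i ≢ 0ℚ) → I → ℚ
    form (inj₁ _) k = 0ℚ
    -- Row `i₀` of 1 - A G kills the earlier columns and takes the value `c i₀` on the column `y`;
    -- the division makes the form 1 there.
    form (inj₂ (i₀ , _ , ≢0)) k =
      (ℚ.1/ c i₀) {{ℚ.≢-nonZero ≢0}} * (ind (i₀ ≟I k) - (A ⟨ ys ⟩ G) i₀ k)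
    f = form (zero-or-pivot c)
    G′ : J → I → ℚ
    G′ j k = if ⌊ j ≟J y ⌋ then f k else (G j k - (G ⟨ xs ⟩ A) j y * f k)

    fA : J → ℚ
    fA j = ∑ xs (λ k → f k * A k j)

    G′-y : ∀ k → G′ y k ≡ f k
    G′-y k with y ≟J y
    ... | yes _ = refl
    ... | no ≢  = ⊥-elim (≢ refl)

    G′-ys : ∀ j k → j ∈ ys → G′ j k ≡ G j k - (G ⟨ xs ⟩ A) j y * f k
    G′-ys j k j∈ with j ≟J y
    ... | yes refl = ⊥-elim (All.lookup y∉ j∈ refl)
    ... | no _     = refl

    row : ∀ j l → j ∈ ys → (G′ ⟨ xs ⟩ A) j l ≡ (G ⟨ xs ⟩ A) j l - (G ⟨ xs ⟩ A) j y * fA l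
    row j l j∈ = begin
      ∑ xs (λ k → G′ j k * A k l)
        ≡⟨ ∑-cong xs (λ k → trans (cong (_* A k l) (G′-ys j k j∈)) (lem (G j k) ((G ⟨ xs ⟩ A) j y) (f k) (A k l))) ⟩
      ∑ xs (λ k → G j k * A k l - (G ⟨ xs ⟩ A) j y * (f k * A k l))
        ≡⟨ ∑-- xs (λ k → G j k * A k l) (λ k → (G ⟨ xs ⟩ A) j y * (f k * A k l)) ⟩
      (G ⟨ xs ⟩ A) j l - ∑ xs (λ k → (G ⟨ xs ⟩ A) j y * (f k * A k l))
        ≡⟨ cong (λ z → (G ⟨ xs ⟩ A) j l - z) (∑-*ˡ xs ((G ⟨ xs ⟩ A) j y) (λ k → f k * A k l)) ⟨
      (G ⟨ xs ⟩ A) j l - (G ⟨ xs ⟩ A) j y * fA l ∎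
      where
      open ≡-Reasoning
      lem : ∀ g a f b → (g - a * f) * b ≡ g * b - a * (f * b)
      lem = solve-∀ ℚ-ring

    -- The new row `f` and the corrections of the old rows amount to a rank one update of A G A, so
    -- only the values `fA` of the form on the columns remain to be computed.
    product : ∀ i l → (A ⟨ y ∷ ys ⟩ (G′ ⟨ xs ⟩ A)) i l ≡ (A ⟨ ys ⟩ (G ⟨ xs ⟩ A)) i l + c i * fA l
    product i l = begin
      A i y * (G′ ⟨ xs ⟩ A) y l + ∑ ys (λ j → A i j * (G′ ⟨ xs ⟩ A) j l)
        ≡⟨ cong₂ _+_ (cong (A i y *_) (∑-cong xs (λ k → cong (_* A k l) (G′-y k))))
             (∑-cong∈ ys (λ j j∈ → trans (cong (A i j *_) (row j l j∈)) (lem₁ (A i j) ((G ⟨ xs ⟩ A) j l) ((G ⟨ xs ⟩ A) j y) (fA l)))) ⟩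
      A i y * fA l + ∑ ys (λ j → A i j * (G ⟨ xs ⟩ A) j l - A i j * (G ⟨ xs ⟩ A) j y * fA l)
        ≡⟨ cong (A i y * fA l +_) (trans
             (∑-- ys (λ j → A i j * (G ⟨ xs ⟩ A) j l) (λ j → A i j * (G ⟨ xs ⟩ A) j y * fA l))
             (cong (λ z → (A ⟨ ys ⟩ (G ⟨ xs ⟩ A)) i l - z) (sym (∑-*ʳ ys (fA l) (λ j → A i j * (G ⟨ xs ⟩ A) j y))))) ⟩
      A i y * fA l + ((A ⟨ ys ⟩ (G ⟨ xs ⟩ A)) i l - (A ⟨ ys ⟩ (G ⟨ xs ⟩ A)) i y * fA l)
        ≡⟨ lem₂ (A i y) (fA l) ((A ⟨ ys ⟩ (G ⟨ xs ⟩ A)) i l) ((A ⟨ ys ⟩ (G ⟨ xs ⟩ A)) i y) ⟩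
      (A ⟨ ys ⟩ (G ⟨ xs ⟩ A)) i l + c i * fA l ∎
      where
      open ≡-Reasoning
      lem₁ : ∀ a g h f → a * (g - h * f) ≡ a * g - a * h * f
      lem₁ = solve-∀ ℚ-ring
      lem₂ : ∀ a f p q → a * f + (p - q * f) ≡ p + (a - q) * f
      lem₂ = solve-∀ ℚ-ring

    form-A : ∀ i₀ (i₀∈ : i₀ ∈ xs) (≢0 : c i₀ ≢ 0ℚ) l →
      ∑ xs (λ k → form (inj₂ (i₀ , i₀∈ , ≢0)) k * A k l)
        ≡ (ℚ.1/ c i₀) {{ℚ.≢-nonZero ≢0}} * (A i₀ l - (A ⟨ ys ⟩ (G ⟨ xs ⟩ A)) i₀ l)
    form-A i₀ i₀∈ ≢0 l = begin
      ∑ xs (λ k → d * (ind (i₀ ≟I k) - (A ⟨ ys ⟩ G) i₀ k) * A k l)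
        ≡⟨ ∑-cong xs (λ k → lem d (ind (i₀ ≟I k)) ((A ⟨ ys ⟩ G) i₀ k) (A k l)) ⟩
      ∑ xs (λ k → d * (ind (i₀ ≟I k) * A k l - (A ⟨ ys ⟩ G) i₀ k * A k l))
        ≡⟨ ∑-*ˡ xs d _ ⟨
      d * ∑ xs (λ k → ind (i₀ ≟I k) * A k l - (A ⟨ ys ⟩ G) i₀ k * A k l)
        ≡⟨ cong (d *_) (∑-- xs (λ k → ind (i₀ ≟I k) * A k l) (λ k → (A ⟨ ys ⟩ G) i₀ k * A k l)) ⟩
      d * (∑ xs (λ k → ind (i₀ ≟I k) * A k l) - ∑ xs (λ k → (A ⟨ ys ⟩ G) i₀ k * A k l))
        ≡⟨ cong₂ (λ p q → d * (p - q)) (∑-δ _≟I_ uxs (λ k → A k l) i₀∈) (⟨⟩-assoc ys xs A G A i₀ l) ⟩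
      d * (A i₀ l - (A ⟨ ys ⟩ (G ⟨ xs ⟩ A)) i₀ l) ∎
      where
      open ≡-Reasoning
      d = (ℚ.1/ c i₀) {{ℚ.≢-nonZero ≢0}}
      lem : ∀ d δ a b → d * (δ - a) * b ≡ d * (δ * b - a * b)
      lem = solve-∀ ℚ-ring

    proof : (z : (∀ i → i ∈ xs → c i ≡ 0ℚ) ⊎ (Σ I λ i → i ∈ xs × c i ≢ 0ℚ)) → zero-or-pivot c ≡ z →
      IsGInv xs (y ∷ ys) A G′
    proof (inj₁ c≡0) eq i j i∈ j∈ = trans (product i j) (trans
      (cong ((A ⟨ ys ⟩ (G ⟨ xs ⟩ A)) i j +_) (trans (cong (_* fA j) (c≡0 i i∈)) (ℚP.*-zeroˡ (fA j))))
      (trans (ℚP.+-identityʳ _) (col j∈)))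
      where
      col : j ∈ y ∷ ys → (A ⟨ ys ⟩ (G ⟨ xs ⟩ A)) i j ≡ A i j
      col (here refl) = sym (-‿zero _ _ (c≡0 i i∈))
      col (there j∈′) = proj₂ ih i j i∈ j∈′
    proof (inj₂ (i₀ , i₀∈ , ≢0)) eq i j i∈ j∈ = trans (product i j) (trans
      (cong (λ z → (A ⟨ ys ⟩ (G ⟨ xs ⟩ A)) i j + c i * z) fA≡) (col j∈))
      where
      instance nz = ℚ.≢-nonZero ≢0
      fA≡ : fA j ≡ (ℚ.1/ c i₀) * (A i₀ j - (A ⟨ ys ⟩ (G ⟨ xs ⟩ A)) i₀ j)
      fA≡ = trans (cong (λ z → ∑ xs (λ k → form z k * A k j)) eq) (form-A i₀ i₀∈ ≢0 j)
      open ≡-Reasoning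
      lem : ∀ a b → b + (a - b) * 1ℚ ≡ a
      lem = solve-∀ ℚ-ring
      col : j ∈ y ∷ ys →
        (A ⟨ ys ⟩ (G ⟨ xs ⟩ A)) i j + c i * ((ℚ.1/ c i₀) * (A i₀ j - (A ⟨ ys ⟩ (G ⟨ xs ⟩ A)) i₀ j)) ≡ A i j
      col (here refl) = trans
        (cong (λ z → (A ⟨ ys ⟩ (G ⟨ xs ⟩ A)) i j + c i * z) (ℚP.*-inverseˡ (c i₀)))
        (lem (A i y) ((A ⟨ ys ⟩ (G ⟨ xs ⟩ A)) i y))
      col (there j∈′) = trans
        (cong₂ (λ p q → p + c i * ((ℚ.1/ c i₀) * (A i₀ j - q))) (proj₂ ih i j i∈ j∈′) (proj₂ ih i₀ j i₀∈ j∈′))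
        (trans (cong (λ z → A i j + c i * ((ℚ.1/ c i₀) * z)) (ℚP.+-inverseʳ (A i₀ j)))
          (trans (cong (λ z → A i j + c i * z) (ℚP.*-zeroʳ (ℚ.1/ c i₀)))
            (trans (cong (A i j +_) (ℚP.*-zeroʳ (c i))) (ℚP.+-identityʳ (A i j)))))

module SquareMatrices {I : Set} (_≟_ : DecidableEquality I) (xs : List I) (uxs : Unique xs) where

  -- Equality compares only entries with both indices in `xs`. Since `xs` has no repetitions, `ind`
  -- is a two-sided unit for it, and rank arguments can be carried out in an abstract ring.
  matrixRing : Ring 0ℓ 0ℓ
  matrixRing = record
    { Carrier = I → I → ℚ
    ; _≈_ = λ A B → ∀ i j → i ∈ xs → j ∈ xs → A i j ≡ B i j
    ; _+_ = λ A B i j → A i j + B i j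
    ; _*_ = λ A B → A ⟨ xs ⟩ B
    ; -_  = λ A i j → - A i j
    ; 0#  = λ _ _ → 0ℚ
    ; 1#  = λ i j → ind (i ≟ j)
    ; isRing = record
      { +-isAbelianGroup = record
        { isGroup = record
          { isMonoid = record
            { isSemigroup = record
              { isMagma = record
                { isEquivalence = record
                  { refl  = λ _ _ _ _ → refl
                  ; sym   = λ h i j i∈ j∈ → sym (h i j i∈ j∈)
                  ; trans = λ h h′ i j i∈ j∈ → trans (h i j i∈ j∈) (h′ i j i∈ j∈)
                  }
                ; ∙-cong = λ h h′ i j i∈ j∈ → cong₂ _+_ (h i j i∈ j∈) (h′ i j i∈ j∈)
                }
              ; assoc = λ A B C i j _ _ → ℚP.+-assoc (A i j) (B i j) (C i j)
              }
            ; identity = (λ A i j _ _ → ℚP.+-identityˡ (A i j)) , (λ A i j _ _ → ℚP.+-identityʳ (A i j))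
            }
          ; inverse = (λ A i j _ _ → ℚP.+-inverseˡ (A i j)) , (λ A i j _ _ → ℚP.+-inverseʳ (A i j))
          ; ⁻¹-cong = λ h i j i∈ j∈ → cong -_ (h i j i∈ j∈)
          }
        ; comm = λ A B i j _ _ → ℚP.+-comm (A i j) (B i j)
        }
      ; *-cong = λ {A} {A′} {B} {B′} h h′ i j i∈ j∈ →
          ⟨⟩-cong xs {A} {A′} {B} {B′} (λ k k∈ → h i k i∈ k∈) (λ k k∈ → h′ k j k∈ j∈)
      ; *-assoc = λ A B C i j _ _ → ⟨⟩-assoc xs xs A B C i j
      ; *-identity = (λ A i j i∈ _ → ∑-δ _≟_ uxs (λ k → A k j) i∈)
                   , (λ A i j _ j∈ → ∑-δʳ _≟_ uxs (A i) j∈)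
      ; distrib = (λ A B C i j _ _ → trans (∑-cong xs (λ k → ℚP.*-distribˡ-+ (A i k) (B k j) (C k j)))
                                           (∑-+ xs (λ k → A i k * B k j) (λ k → A i k * C k j)))
                , (λ A B C i j _ _ → trans (∑-cong xs (λ k → ℚP.*-distribʳ-+ (A k j) (B i k) (C i k)))
                                           (∑-+ xs (λ k → B i k * A k j) (λ k → C i k * A k j)))
      }
    }

  open Ring matrixRing using (Carrier; _≈_) renaming (_+_ to _⊞_; _*_ to _⊡_)

  tr : Carrier → ℚ
  tr A = ∑ xs (λ i → A i i)

  tr-cong : ∀ {A B} → A ≈ B → tr A ≡ tr B
  tr-cong h = ∑-cong∈ xs (λ i i∈ → h i i i∈ i∈)

  tr-+ : ∀ A B → tr (A ⊞ B) ≡ tr A + tr B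
  tr-+ A B = ∑-+ xs (λ i → A i i) (λ i → B i i)

  tr-comm : ∀ A B → tr (A ⊡ B) ≡ tr (B ⊡ A)
  tr-comm A B = tr⟨⟩-comm xs xs A B

  ginv² : (A : Carrier) → Σ Carrier λ G → (A ⊡ (G ⊡ A)) ≈ A
  ginv² A = ginv _≟_ _≟_ uxs A uxs

-- Ranks as traces

module TracedRing (R : Ring 0ℓ 0ℓ) (tr : Ring.Carrier R → ℚ)
  (tr-cong : ∀ {a b} → Ring._≈_ R a b → tr a ≡ tr b)
  (tr-+ : ∀ a b → tr (Ring._+_ R a b) ≡ tr a + tr b)
  (tr-comm : ∀ a b → tr (Ring._*_ R a b) ≡ tr (Ring._*_ R b a)) where

  open Ring R using (Carrier; _≈_; 1#; 0#; setoid; *-congˡ; *-congʳ; *-assoc; +-congˡ; +-congʳ; +-cong;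
                     -‿cong; -‿inverseʳ; +-identityʳ; *-identityˡ; zeroˡ; zeroʳ; distribˡ; distribʳ)
    renaming (_+_ to _⊞_; _*_ to _·_; -_ to ⊟_; refl to ≈-refl; sym to ≈-sym; trans to ≈-trans)
  open RingP R using (-‿distribˡ-*; -‿distribʳ-*; -0#≈0#; x≈y⇒x∙y⁻¹≈ε; x∙y⁻¹≈ε⇒x≈y)
  open SetoidReasoning setoid

  infixl 6 _⊟_
  _⊟_ : Carrier → Carrier → Carrier
  a ⊟ b = a ⊞ (⊟ b)

  tr-⊟ : ∀ a b → tr (a ⊟ b) ≡ tr a - tr b
  tr-⊟ a b = trans (lem (tr (a ⊟ b)) (tr b)) (cong (_- tr b) (trans (sym (tr-+ (a ⊟ b) b)) (tr-cong a-b+b)))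
    where
    lem : ∀ x y → x ≡ x + y - y
    lem = solve-∀ ℚ-ring
    a-b+b : (a ⊟ b) ⊞ b ≈ a
    a-b+b = ≈-trans (Ring.+-assoc R a (⊟ b) b) (≈-trans (+-congˡ (Ring.-‿inverseˡ R b)) (+-identityʳ a))

  ⊟-distribʳ : ∀ a b c → (a ⊟ b) · c ≈ a · c ⊟ b · c
  ⊟-distribʳ a b c = ≈-trans (distribʳ c a (⊟ b)) (+-congˡ (≈-sym (-‿distribˡ-* b c)))

  ⊟-distribˡ : ∀ a b c → c · (a ⊟ b) ≈ c · a ⊟ c · b
  ⊟-distribˡ a b c = ≈-trans (distribˡ c a (⊟ b)) (+-congˡ (≈-sym (-‿distribʳ-* c b)))

  ⊟-cong : ∀ {a a′ b b′} → a ≈ a′ → b ≈ b′ → a ⊟ b ≈ a′ ⊟ b′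
  ⊟-cong h h′ = +-cong h (-‿cong h′)

  ⊟-zero : ∀ {a b} → b ≈ 0# → a ⊟ b ≈ a
  ⊟-zero {a} h = ≈-trans (+-congˡ (≈-trans (-‿cong h) -0#≈0#)) (+-identityʳ a)

  infix 4 _isGInvOf_
  _isGInvOf_ : Carrier → Carrier → Set
  g isGInvOf a = a · (g · a) ≈ a

  isGInv-resp : ∀ {a b g} → a ≈ b → g isGInvOf a → g isGInvOf b
  isGInv-resp {a} {b} {g} h aga = begin
    b · (g · b)  ≈⟨ Ring.*-cong R h (*-congˡ h) ⟨
    a · (g · a)  ≈⟨ aga ⟩
    a            ≈⟨ h ⟩
    b            ∎

  -- The idempotents `a · g` and `a · h` have the same image, so each reproduces the other when
  -- multiplied on its left; cyclicity of the trace identifies the two products.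
  rank-unique : ∀ {a g h} → g isGInvOf a → h isGInvOf a → tr (a · g) ≡ tr (a · h)
  rank-unique {a} {g} {h} aga aha = trans (tr-cong one) (trans (tr-comm (a · h) (a · g)) (tr-cong two))
    where
    one : a · g ≈ (a · h) · (a · g)
    one = begin
      a · g              ≈⟨ *-congʳ aha ⟨
      a · (h · a) · g    ≈⟨ *-congʳ (*-assoc a h a) ⟨
      (a · h) · a · g    ≈⟨ *-assoc (a · h) a g ⟩
      (a · h) · (a · g)  ∎
    two : (a · g) · (a · h) ≈ a · h
    two = begin
      (a · g) · (a · h)  ≈⟨ *-assoc (a · g) a h ⟨
      (a · g) · a · h    ≈⟨ *-congʳ (≈-trans (*-assoc a g a) aga) ⟩
      a · h              ∎

  rank-resp : ∀ {a b g h} → a ≈ b → g isGInvOf a → h isGInvOf b → tr (a · g) ≡ tr (b · h)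
  rank-resp {a} {b} {g} h≈ aga bhb = trans (tr-cong (*-congʳ h≈)) (rank-unique (isGInv-resp h≈ aga) bhb)

  -- `g · x` is a generalised inverse of `b`, and `x · (b · g)` has the trace of `b · (g · x)` by
  -- cyclicity.
  rank-sameRows : ∀ {a b x y g h} → a ≈ x · b → b ≈ y · a → g isGInvOf a → h isGInvOf b →
    tr (a · g) ≡ tr (b · h)
  rank-sameRows {a} {b} {x} {y} {g} {h} a≈xb b≈ya aga bhb =
    trans (tr-cong (≈-trans (*-congʳ a≈xb) (*-assoc x b g)))
      (trans (tr-comm x (b · g)) (trans (tr-cong (*-assoc b g x)) (rank-unique bgxb bhb)))
    where
    bgxb : b · (g · x · b) ≈ b
    bgxb = begin
      b · (g · x · b)    ≈⟨ *-congˡ (*-assoc g x b) ⟩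
      b · (g · (x · b))  ≈⟨ Ring.*-cong R b≈ya (*-congˡ (≈-sym a≈xb)) ⟩
      y · a · (g · a)    ≈⟨ *-assoc y a (g · a) ⟩
      y · (a · (g · a))  ≈⟨ *-congˡ aga ⟩
      y · a              ≈⟨ b≈ya ⟨
      b                  ∎

  -- Here `x · g` is a generalised inverse of `b`, and `a · g` equals `b · (x · g)` outright.
  rank-sameColumns : ∀ {a b x y g h} → a ≈ b · x → b ≈ a · y → g isGInvOf a → h isGInvOf b →
    tr (a · g) ≡ tr (b · h)
  rank-sameColumns {a} {b} {x} {y} {g} {h} a≈bx b≈ay aga bhb =
    trans (tr-cong (≈-trans (*-congʳ a≈bx) (*-assoc b x g))) (rank-unique bxgb bhb)
    where
    bxgb : b · (x · g · b) ≈ b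
    bxgb = begin
      b · (x · g · b)    ≈⟨ *-congˡ (*-assoc x g b) ⟩
      b · (x · (g · b))  ≈⟨ *-assoc b x (g · b) ⟨
      b · x · (g · b)    ≈⟨ Ring.*-cong R (≈-sym a≈bx) (*-congˡ b≈ay) ⟩
      a · (g · (a · y))  ≈⟨ *-congˡ (*-assoc g a y) ⟨
      a · (g · a · y)    ≈⟨ *-assoc a (g · a) y ⟨
      a · (g · a) · y    ≈⟨ *-congʳ aga ⟩
      a · y              ≈⟨ b≈ay ⟨
      b                  ∎

  -- With W the row space of k, the hypotheses say that W p is the intersection of the row
  -- space of p with the left kernel of q.
  rank-drop : ∀ {p q k y g h j} → g isGInvOf (p · q) → h isGInvOf p → j isGInvOf (k · p) →
    k · p · q ≈ 0# → y · k ≈ y → y · p ≈ (1# ⊟ p · q · g) · p →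
    tr (k · p · j) ≡ tr (p · h) - tr (p · q · g)
  rank-drop {p} {q} {k} {y} {g} {h} {j} bgb php jkp kpq≈0 yk≈y yp≈m =
    trans (rank-sameRows kp≈km m≈ykp jkp mhm) trm
    where
    b = p · q
    -- The rows of `1# ⊟ b · g` span the left kernel of `b`, hence those of `m` span the part of the
    -- row space of `p` that `q` kills. By the hypotheses this is the row space of `k · p`, so `m`
    -- can replace `k · p`.
    m = (1# ⊟ b · g) · p
    m≈ : m ≈ p ⊟ b · g · p
    m≈ = ≈-trans (⊟-distribʳ 1# (b · g) p) (+-congʳ (*-identityˡ p))
    kp≈km : k · p ≈ k · m
    kp≈km = ≈-sym (begin
      k · m                          ≈⟨ *-congˡ m≈ ⟩
      k · (p ⊟ b · g · p)            ≈⟨ ⊟-distribˡ p (b · g · p) k ⟩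
      k · p ⊟ k · (b · g · p)        ≈⟨ ⊟-zero (begin
        k · (b · g · p)      ≈⟨ *-congˡ (*-assoc b g p) ⟩
        k · (b · (g · p))    ≈⟨ *-assoc k b (g · p) ⟨
        k · b · (g · p)      ≈⟨ *-congʳ (*-assoc k p q) ⟨
        k · p · q · (g · p)  ≈⟨ *-congʳ kpq≈0 ⟩
        0# · (g · p)         ≈⟨ zeroˡ (g · p) ⟩
        0#                   ∎) ⟩
      k · p                          ∎)
    m≈ykp : m ≈ y · (k · p)
    m≈ykp = ≈-sym (≈-trans (≈-sym (*-assoc y k p)) (≈-trans (*-congʳ yk≈y) yp≈m))
    phb≈b : p · h · b ≈ b
    phb≈b = begin
      p · h · (p · q)    ≈⟨ *-assoc (p · h) p q ⟨
      p · h · p · q      ≈⟨ *-congʳ (*-assoc p h p) ⟩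
      p · (h · p) · q    ≈⟨ *-congʳ php ⟩
      p · q              ∎
    phm≈m : p · h · m ≈ m
    phm≈m = begin
      p · h · m                          ≈⟨ *-congˡ m≈ ⟩
      p · h · (p ⊟ b · g · p)            ≈⟨ ⊟-distribˡ p (b · g · p) (p · h) ⟩
      p · h · p ⊟ p · h · (b · g · p)    ≈⟨ ⊟-cong (≈-trans (*-assoc p h p) php) (begin
        p · h · (b · g · p)  ≈⟨ *-assoc (p · h) (b · g) p ⟨
        p · h · (b · g) · p  ≈⟨ *-congʳ (*-assoc (p · h) b g) ⟨
        p · h · b · g · p    ≈⟨ *-congʳ (*-congʳ phb≈b) ⟩
        b · g · p            ∎) ⟩
      p ⊟ b · g · p                      ≈⟨ m≈ ⟨
      m                                  ∎
    bgbg : b · g · (b · g) ≈ b · g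
    bgbg = ≈-trans (≈-sym (*-assoc (b · g) b g)) (*-congʳ (≈-trans (*-assoc b g b) bgb))
    bgm≈0 : b · g · m ≈ 0#
    bgm≈0 = begin
      b · g · ((1# ⊟ b · g) · p)          ≈⟨ *-assoc (b · g) (1# ⊟ b · g) p ⟨
      b · g · (1# ⊟ b · g) · p            ≈⟨ *-congʳ (⊟-distribˡ 1# (b · g) (b · g)) ⟩
      (b · g · 1# ⊟ b · g · (b · g)) · p  ≈⟨ *-congʳ (⊟-cong (Ring.*-identityʳ R (b · g)) bgbg) ⟩
      (b · g ⊟ b · g) · p                 ≈⟨ *-congʳ (-‿inverseʳ (b · g)) ⟩
      0# · p                              ≈⟨ zeroˡ p ⟩
      0#                                  ∎
    -- `h` serves `m` as well, because the projection `p · h` fixes `m` and `b · g` kills it. The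
    -- rank of `m` is thereby expressed through traces belonging to `p` and `b`.
    mhm : m · (h · m) ≈ m
    mhm = begin
      (1# ⊟ b · g) · p · (h · m)      ≈⟨ *-assoc (1# ⊟ b · g) p (h · m) ⟩
      (1# ⊟ b · g) · (p · (h · m))    ≈⟨ *-congˡ (≈-trans (≈-sym (*-assoc p h m)) phm≈m) ⟩
      (1# ⊟ b · g) · m                ≈⟨ ⊟-distribʳ 1# (b · g) m ⟩
      1# · m ⊟ b · g · m              ≈⟨ ⊟-zero bgm≈0 ⟩
      1# · m                          ≈⟨ *-identityˡ m ⟩
      m                               ∎
    trm : tr (m · h) ≡ tr (p · h) - tr (b · g)
    trm = trans (tr-cong (≈-trans (*-congʳ m≈) (⊟-distribʳ p (b · g · p) h)))
      (trans (tr-⊟ (p · h) (b · g · p · h)) (cong (λ t → tr (p · h) - t)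
        (trans (tr-cong (*-assoc (b · g) p h)) (trans (tr-comm (b · g) (p · h))
          (tr-cong (≈-trans (≈-sym (*-assoc (p · h) b g)) (*-congʳ phb≈b)))))))

  -- Let W be the row space of the idempotent `k`; the rows of `a` lie in W and `q` is injective
  -- there. A generalised inverse `z` of `k · q` then gives `k · q · z · k ≈ k`, since the
  -- difference has its rows in W and is killed by `q`. Hence `a ≈ b · (z · k)`, and `a` and `b`
  -- have the same column space.
  rank-injective : ∀ {k a b q g h z} → k · k ≈ k → a · k ≈ a → b ≈ a · q →
    (∀ d → d · k ≈ d → d · q ≈ 0# → d ≈ 0#) →
    z isGInvOf (k · q) → g isGInvOf a → h isGInvOf b → tr (b · h) ≡ tr (a · g)
  rank-injective {k} {a} {b} {q} {g} {h} {z} kk ak b≈aq inj kqz aga bhb =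
    sym (rank-sameColumns a≈bzk b≈aq aga bhb)
    where
    d = k · q · z · k ⊟ k
    dk : d · k ≈ d
    dk = begin
      d · k                              ≈⟨ ⊟-distribʳ (k · q · z · k) k k ⟩
      k · q · z · k · k ⊟ k · k          ≈⟨ ⊟-cong (≈-trans (*-assoc (k · q · z) k k) (*-congˡ kk)) kk ⟩
      d                                  ∎
    dq : d · q ≈ 0#
    dq = ≈-trans (⊟-distribʳ (k · q · z · k) k q) (x≈y⇒x∙y⁻¹≈ε (begin
      k · q · z · k · q      ≈⟨ *-assoc (k · q · z) k q ⟩
      k · q · z · (k · q)    ≈⟨ *-assoc (k · q) z (k · q) ⟩
      k · q · (z · (k · q))  ≈⟨ kqz ⟩
      k · q                  ∎))
    kqzk : k · q · z · k ≈ k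
    kqzk = x∙y⁻¹≈ε⇒x≈y _ _ (inj d dk dq)
    a≈bzk : a ≈ b · (z · k)
    a≈bzk = begin
      a                      ≈⟨ ak ⟨
      a · k                  ≈⟨ *-congˡ kqzk ⟨
      a · (k · q · z · k)    ≈⟨ *-congˡ (≈-trans (*-assoc (k · q) z k) (*-assoc k q (z · k))) ⟩
      a · (k · (q · (z · k)))  ≈⟨ *-assoc a k (q · (z · k)) ⟨
      a · k · (q · (z · k))  ≈⟨ *-congʳ ak ⟩
      a · (q · (z · k))      ≈⟨ *-assoc a q (z · k) ⟨
      a · q · (z · k)        ≈⟨ *-congʳ b≈aq ⟨
      b · (z · k)            ∎

-- Polynomials as functions

pow : ℚ → ℕ → ℚ
pow x zero    = 1ℚ
pow x (suc k) = x * pow x k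

pow-+ : ∀ x k l → pow x (k ℕ.+ l) ≡ pow x k * pow x l
pow-+ x zero    l = sym (ℚP.*-identityˡ _)
pow-+ x (suc k) l = trans (cong (x *_) (pow-+ x k l)) (sym (ℚP.*-assoc x (pow x k) (pow x l)))

pow-* : ∀ x y k → pow (x * y) k ≡ pow x k * pow y k
pow-* x y zero    = refl
pow-* x y (suc k) = trans (cong (x * y *_) (pow-* x y k)) (*-interchange x y (pow x k) (pow y k))

pow-1 : ∀ k → pow 1ℚ k ≡ 1ℚ
pow-1 zero    = refl
pow-1 (suc k) = trans (ℚP.*-identityˡ (pow 1ℚ k)) (pow-1 k)

infix 4 _≟V_
_≟V_ : ∀ {r} → DecidableEquality (Vec ℕ r)
_≟V_ = VecP.≡-dec ℕ._≟_

-- Counted from 1 like `var`; positions outside the list give 0, in accordance with `evM`.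
nth : List ℚ → ℕ → ℚ
nth []       _             = 0ℚ
nth (x ∷ xs) zero          = 0ℚ
nth (x ∷ xs) (suc zero)    = x
nth (x ∷ xs) (suc (suc k)) = nth xs (suc k)

-- The value of a monomial; as in substMono, missing variables are set to 0.
evM : ∀ {r} → Vec ℕ r → List ℚ → ℚ
evM []      _        = 1ℚ
evM (k ∷ e) []       = pow 0ℚ k * evM e []
evM (k ∷ e) (x ∷ xs) = pow x k * evM e xs

-- The linear functional with value `f e` on the monomial of `e`. Evaluation and reading off a
-- coefficient are both of this kind, so linearity is proved once for the two.
lin : ∀ {r} → Poly r → (Vec ℕ r → ℚ) → ℚ
lin p f = ∑ p (λ t → proj₁ t * f (proj₂ t))

eval : ∀ {r} → Poly r → List ℚ → ℚ
eval p xs = lin p (λ e → evM e xs)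

evM-+ : ∀ {r} (e f : Vec ℕ r) xs → evM (Vec.zipWith ℕ._+_ e f) xs ≡ evM e xs * evM f xs
evM-+ []      []      xs       = refl
evM-+ (k ∷ e) (l ∷ f) []       = trans (cong₂ _*_ (pow-+ 0ℚ k l) (evM-+ e f [])) (*-interchange (pow 0ℚ k) (pow 0ℚ l) (evM e []) (evM f []))
evM-+ (k ∷ e) (l ∷ f) (x ∷ xs) = trans (cong₂ _*_ (pow-+ x k l) (evM-+ e f xs)) (*-interchange (pow x k) (pow x l) (evM e xs) (evM f xs))

evM-0 : ∀ r xs → evM (Vec.replicate r 0) xs ≡ 1ℚ
evM-0 zero    xs       = refl
evM-0 (suc r) []       = trans (ℚP.*-identityˡ _) (evM-0 r [])
evM-0 (suc r) (x ∷ xs) = trans (ℚP.*-identityˡ _) (evM-0 r xs)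

evM-0′ : ∀ r xs → evM {r} (Vec.tabulate (λ _ → 0)) xs ≡ 1ℚ
evM-0′ zero    xs       = refl
evM-0′ (suc r) []       = trans (ℚP.*-identityˡ _) (evM-0′ r [])
evM-0′ (suc r) (x ∷ xs) = trans (ℚP.*-identityˡ _) (evM-0′ r xs)

eval-one : ∀ r xs → eval (oneP {r}) xs ≡ 1ℚ
eval-one r xs = trans (ℚP.+-identityʳ _) (trans (ℚP.*-identityˡ _) (evM-0 r xs))

eval-mono : ∀ {r} (e : Vec ℕ r) xs → eval (monoP e) xs ≡ evM e xs
eval-mono e xs = trans (ℚP.+-identityʳ _) (ℚP.*-identityˡ _)

lin-+ : ∀ {r} (p q : Poly r) f → lin (p +P q) f ≡ lin p f + lin q f
lin-+ p q f = ∑-++ p q _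

lin-scale : ∀ {r} c (p : Poly r) f → lin (scaleP c p) f ≡ c * lin p f
lin-scale c p f = trans (∑-map _ p _) (trans (∑-cong p (λ t → ℚP.*-assoc c (proj₁ t) (f (proj₂ t)))) (sym (∑-*ˡ p c _)))

lin-- : ∀ {r} (p q : Poly r) f → lin (p -P q) f ≡ lin p f - lin q f
lin-- p q f = trans (lin-+ p (negP q) f) (cong (lin p f +_) (trans (lin-scale (- 1ℚ) q f) (sym (neg≡-1* (lin q f)))))

lin-sumP : ∀ {r} {I : Set} (is : List I) (h : I → Poly r) f → lin (sumP (map h is)) f ≡ ∑ is (λ i → lin (h i) f)
lin-sumP []       h f = refl
lin-sumP (i ∷ is) h f = trans (lin-+ (h i) _ f) (cong (lin (h i) f +_) (lin-sumP is h f))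

eval-* : ∀ {r} (p q : Poly r) xs → eval (p *P q) xs ≡ eval p xs * eval q xs
eval-* p q xs = begin
  eval (p *P q) xs
    ≡⟨ ∑-concatMap _ p _ ⟩
  ∑ p (λ t → ∑ (map (λ u → (proj₁ t * proj₁ u , Vec.zipWith ℕ._+_ (proj₂ t) (proj₂ u))) q) (λ w → proj₁ w * evM (proj₂ w) xs))
    ≡⟨ ∑-cong p (λ t → trans (∑-map _ q _) (trans (∑-cong q (λ u →
         trans (cong (proj₁ t * proj₁ u *_) (evM-+ (proj₂ t) (proj₂ u) xs)) (*-interchange (proj₁ t) (proj₁ u) (evM (proj₂ t) xs) (evM (proj₂ u) xs))))
         (sym (∑-*ˡ q (proj₁ t * evM (proj₂ t) xs) (λ u → proj₁ u * evM (proj₂ u) xs))))) ⟩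
  ∑ p (λ t → proj₁ t * evM (proj₂ t) xs * eval q xs)
    ≡⟨ ∑-*ʳ p (eval q xs) (λ t → proj₁ t * evM (proj₂ t) xs) ⟨
  eval p xs * eval q xs ∎
  where
  open ≡-Reasoning

eval-pow : ∀ {r} (p : Poly r) k xs → eval (powP p k) xs ≡ pow (eval p xs) k
eval-pow {r} p zero xs = eval-one r xs
eval-pow p (suc k) xs = trans (eval-* p (powP p k) xs) (cong (eval p xs *_) (eval-pow p k xs))

eval-substMono : ∀ {r s} (e : Vec ℕ r) (σ : List (Poly s)) xs →
  eval (substMono e σ) xs ≡ evM e (map (λ q → eval q xs) σ)
eval-substMono {s = s} [] σ xs = eval-one s xs
eval-substMono (k ∷ e) []      xs = trans (eval-* (powP zeroP k) (substMono e []) xs)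
  (cong₂ _*_ (eval-pow zeroP k xs) (eval-substMono e [] xs))
eval-substMono (k ∷ e) (q ∷ σ) xs = trans (eval-* (powP q k) (substMono e σ) xs)
  (cong₂ _*_ (eval-pow q k xs) (eval-substMono e σ xs))

eval-subst : ∀ {r s} (p : Poly r) (σ : List (Poly s)) xs →
  eval (subst p σ) xs ≡ eval p (map (λ q → eval q xs) σ)
eval-subst p σ xs = trans (lin-sumP p _ _) (∑-cong p (λ t →
  trans (lin-scale (proj₁ t) (substMono (proj₂ t) σ) _) (cong (proj₁ t *_) (eval-substMono (proj₂ t) σ xs))))

eval-var : ∀ r k xs → k ≤ r → 1 ≤ k → eval (var r k) xs ≡ nth xs k
eval-var r k xs k≤r 1≤k = trans (eval-mono (Vec.tabulate {n = r} (λ i → if suc (toℕ i) ℕ.≡ᵇ k then 1 else 0)) xs) (go r k xs k≤r 1≤k)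
  where
  go : ∀ r k xs → k ≤ r → 1 ≤ k →
    evM (Vec.tabulate {n = r} (λ i → if suc (toℕ i) ℕ.≡ᵇ k then 1 else 0)) xs ≡ nth xs k
  go (suc r) (suc zero)    []       _ _ = trans (cong (_* evM {r} (Vec.tabulate (λ _ → 0)) []) (ℚP.*-identityʳ 0ℚ)) (ℚP.*-zeroˡ (evM {r} (Vec.tabulate (λ _ → 0)) []))
  go (suc r) (suc zero)    (x ∷ xs) _ _ = trans (cong₂ _*_ (ℚP.*-identityʳ x) (evM-0′ r xs)) (ℚP.*-identityʳ x)
  go (suc r) (suc (suc k)) []       (s≤s k≤r) _ = trans (ℚP.*-identityˡ _) (go r (suc k) [] k≤r (s≤s z≤n))
  go (suc r) (suc (suc k)) (x ∷ xs) (s≤s k≤r) _ = trans (ℚP.*-identityˡ _) (go r (suc k) xs k≤r (s≤s z≤n))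

∑-upTo-suc : ∀ n (f : ℕ → ℚ) → ∑ (upTo (suc n)) f ≡ ∑ (upTo n) f + f n
∑-upTo-suc n f = trans (cong (λ l → ∑ l f) (sym (ListP.upTo-∷ʳ n)))
  (trans (∑-++ (upTo n) (n ∷ []) f) (cong (∑ (upTo n) f +_) (ℚP.+-identityʳ (f n))))

2ℚ : ℚ
2ℚ = 1ℚ + 1ℚ

double : ∀ x → 2ℚ * x ≡ x + x
double x = trans (ℚP.*-distribʳ-+ x 1ℚ 1ℚ) (cong₂ _+_ (ℚP.*-identityˡ x) (ℚP.*-identityˡ x))

0<pow2 : ∀ k → 0ℚ ℚ.< pow 2ℚ k
0<pow2 zero    = ℚP.positive⁻¹ 1ℚ
0<pow2 (suc k) = ≡.subst (0ℚ ℚ.<_) (sym (double (pow 2ℚ k))) (ℚP.+-mono-< (0<pow2 k) (0<pow2 k))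

pow2-< : ∀ {k l} → k ℕ.<′ l → pow 2ℚ k ℚ.< pow 2ℚ l
pow2-< {k} ℕ.<′-base = ≡.subst₂ ℚ._<_ (ℚP.+-identityʳ (pow 2ℚ k)) (sym (double (pow 2ℚ k))) (ℚP.+-monoʳ-< (pow 2ℚ k) (0<pow2 k))
pow2-< {k} (ℕ.≤′-step {l} k<l) = ℚP.<-trans (pow2-< k<l) (pow2-< {l} ℕ.<′-base)

*-zero-cancelʳ : ∀ a b → b ≢ 0ℚ → a * b ≡ 0ℚ → a ≡ 0ℚ
*-zero-cancelʳ a b b≢0 h = begin
  a                    ≡⟨ ℚP.*-identityʳ a ⟨
  a * 1ℚ               ≡⟨ cong (a *_) (ℚP.*-inverseʳ b) ⟨
  a * (b * (ℚ.1/ b))   ≡⟨ ℚP.*-assoc a b (ℚ.1/ b) ⟨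
  a * b * (ℚ.1/ b)     ≡⟨ cong (_* (ℚ.1/ b)) h ⟩
  0ℚ * (ℚ.1/ b)        ≡⟨ ℚP.*-zeroˡ (ℚ.1/ b) ⟩
  0ℚ                   ∎
  where
  open ≡-Reasoning
  instance nz = ℚ.≢-nonZero b≢0

-- Passing from f(x) to f(2x) − 2ᴰ f(x) removes the leading term without dividing by x.
univariate-identity : ∀ D (a : ℕ → ℚ) → (∀ x → ∑ (upTo D) (λ k → a k * pow x k) ≡ 0ℚ) → ∀ k → k < D → a k ≡ 0ℚ
univariate-identity (suc D) a f≡0 k k<1+D = case (ℕP.m≤n⇒m<n∨m≡n (ℕP.≤-pred k<1+D))
  where
  b : ℕ → ℚ
  b k = a k * (pow 2ℚ k - pow 2ℚ D)
  g≡0 : ∀ x → ∑ (upTo D) (λ k → b k * pow x k) ≡ 0ℚ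
  g≡0 x = begin
    ∑ (upTo D) (λ k → b k * pow x k)
      ≡⟨ ℚP.+-identityʳ _ ⟨
    ∑ (upTo D) (λ k → b k * pow x k) + 0ℚ
      ≡⟨ cong (∑ (upTo D) (λ k → b k * pow x k) +_) (lem₀ (a D) (pow 2ℚ D) (pow x D)) ⟨
    ∑ (upTo D) (λ k → b k * pow x k) + b D * pow x D
      ≡⟨ ∑-upTo-suc D (λ k → b k * pow x k) ⟨
    ∑ (upTo (suc D)) (λ k → b k * pow x k)
      ≡⟨ ∑-cong (upTo (suc D)) (λ k → trans (lem₁ (a k) (pow 2ℚ k) (pow 2ℚ D) (pow x k))
           (cong (λ z → a k * z - pow 2ℚ D * (a k * pow x k)) (sym (pow-* 2ℚ x k)))) ⟩
    ∑ (upTo (suc D)) (λ k → a k * pow (2ℚ * x) k - pow 2ℚ D * (a k * pow x k))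
      ≡⟨ ∑-- (upTo (suc D)) (λ k → a k * pow (2ℚ * x) k) (λ k → pow 2ℚ D * (a k * pow x k)) ⟩
    ∑ (upTo (suc D)) (λ k → a k * pow (2ℚ * x) k) - ∑ (upTo (suc D)) (λ k → pow 2ℚ D * (a k * pow x k))
      ≡⟨ cong₂ _-_ (f≡0 (2ℚ * x)) (trans (sym (∑-*ˡ (upTo (suc D)) (pow 2ℚ D) (λ k → a k * pow x k))) (trans (cong (pow 2ℚ D *_) (f≡0 x)) (ℚP.*-zeroʳ (pow 2ℚ D)))) ⟩
    0ℚ - 0ℚ ≡⟨⟩
    0ℚ ∎
    where
    open ≡-Reasoning
    lem₀ : ∀ a p x → a * (p - p) * x ≡ 0ℚ
    lem₀ = solve-∀ ℚ-ring
    lem₁ : ∀ a p q x → a * (p - q) * x ≡ a * (p * x) - q * (a * x)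
    lem₁ = solve-∀ ℚ-ring
  below : ∀ k → k < D → a k ≡ 0ℚ
  -- Powers of 2 are distinct, so only the leading coefficient was lost; once the others are known
  -- to vanish, it is the value at 1.
  below k k<D = *-zero-cancelʳ (a k) (pow 2ℚ k - pow 2ℚ D)
    (λ h → ℚP.<⇒≢ (pow2-< (ℕP.<⇒<′ k<D)) (-‿zero _ _ h)) (univariate-identity D b g≡0 k k<D)
  case : k < D ⊎ k ≡ D → a k ≡ 0ℚ
  case (inj₁ k<D)  = below k k<D
  case (inj₂ refl) = begin
    a k                                              ≡⟨ ℚP.*-identityʳ (a k) ⟨
    a k * 1ℚ                                         ≡⟨ cong (a k *_) (pow-1 k) ⟨
    a k * pow 1ℚ k                                   ≡⟨ ℚP.+-identityˡ (a k * pow 1ℚ k) ⟨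
    0ℚ + a k * pow 1ℚ k                              ≡⟨ cong (_+ a k * pow 1ℚ k) (∑-zero∈ (upTo k) (λ i i∈ →
                                                          trans (cong (_* pow 1ℚ i) (below i (∈P.∈-upTo⁻ i∈))) (ℚP.*-zeroˡ (pow 1ℚ i)))) ⟨
    ∑ (upTo k) (λ i → a i * pow 1ℚ i) + a k * pow 1ℚ k  ≡⟨ ∑-upTo-suc k (λ i → a i * pow 1ℚ i) ⟨
    ∑ (upTo (suc k)) (λ i → a i * pow 1ℚ i)          ≡⟨ f≡0 1ℚ ⟩
    0ℚ                                               ∎
    where
    open ≡-Reasoning

bounded : {I : Set} (h : I → ℕ) (xs : List I) → ∃ λ D → ∀ i → i ∈ xs → h i < D
bounded h []       = 0 , λ _ ()
bounded h (x ∷ xs) with bounded h xs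
... | D , b = suc (h x) ℕ.⊔ D , λ
  { _ (here refl) → ℕP.m≤m⊔n (suc (h x)) D
  ; i (there i∈) → ℕP.≤-trans (b i i∈) (ℕP.m≤n⊔m (suc (h x)) D) }

univariate-coeff : {I : Set} (xs : List I) (c : I → ℚ) (h : I → ℕ) →
  (∀ x → ∑ xs (λ i → c i * pow x (h i)) ≡ 0ℚ) → ∀ k → ∑ xs (λ i → c i * ind (h i ℕ.≟ k)) ≡ 0ℚ
univariate-coeff xs c h f≡0 k with bounded h xs
... | D , b with k ℕ.<? D
...   | no k≮D = ∑-zero∈ xs λ i i∈ →
        trans (cong (c i *_) (ind-no (h i ℕ.≟ k) (λ { refl → k≮D (b i i∈) }))) (ℚP.*-zeroʳ (c i))
...   | yes k<D = univariate-identity D (λ k → ∑ xs (λ i → c i * ind (h i ℕ.≟ k))) g≡0 k k<D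
  where
  g≡0 : ∀ x → ∑ (upTo D) (λ k → ∑ xs (λ i → c i * ind (h i ℕ.≟ k)) * pow x k) ≡ 0ℚ
  g≡0 x = begin
    ∑ (upTo D) (λ k → ∑ xs (λ i → c i * ind (h i ℕ.≟ k)) * pow x k)
      ≡⟨ ∑-cong (upTo D) (λ k → ∑-*ʳ xs (pow x k) _) ⟩
    ∑ (upTo D) (λ k → ∑ xs (λ i → c i * ind (h i ℕ.≟ k) * pow x k))
      ≡⟨ ∑-swap (upTo D) xs _ ⟩
    ∑ xs (λ i → ∑ (upTo D) (λ k → c i * ind (h i ℕ.≟ k) * pow x k))
      ≡⟨ ∑-cong∈ xs (λ i i∈ → trans (∑-cong (upTo D) (λ k → ℚP.*-assoc (c i) (ind (h i ℕ.≟ k)) (pow x k)))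
           (trans (sym (∑-*ˡ (upTo D) (c i) _)) (cong (c i *_) (∑-δ ℕ._≟_ (UniqueP.upTo⁺ D) (pow x) (∈P.∈-upTo⁺ (b i i∈)))))) ⟩
    ∑ xs (λ i → c i * pow x (h i))
      ≡⟨ f≡0 x ⟩
    0ℚ ∎ where open ≡-Reasoning

-- Induction on the number of variables. With the others fixed, the polynomial in the first variable
-- vanishes identically, and so do its coefficients; the one of degree `k` is the value of the
-- polynomial made of the terms `slice t`.
eval≡0⇒lin-δ≡0 : ∀ {r} (p : Poly r) → (∀ (xs : Vec ℚ r) → eval p (Vec.toList xs) ≡ 0ℚ) →
  ∀ e → lin p (λ e′ → ind (e′ ≟V e)) ≡ 0ℚ
eval≡0⇒lin-δ≡0 {zero} p f≡0 [] = trans (∑-cong p (λ { (c , []) → refl })) (f≡0 [])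
eval≡0⇒lin-δ≡0 {suc r} p f≡0 (k ∷ e) = begin
  lin p (λ e′ → ind (e′ ≟V k ∷ e))
    ≡⟨ ∑-cong p (λ { (c , k′ ∷ e′) → trans (cong (c *_) (ind-* (k′ ℕ.≟ k) (e′ ≟V e) (k′ ∷ e′ ≟V k ∷ e)
         (λ { refl refl → refl }) VecP.∷-injectiveˡ VecP.∷-injectiveʳ)) (sym (ℚP.*-assoc c (ind (k′ ℕ.≟ k)) (ind (e′ ≟V e)))) }) ⟩
  ∑ p (λ t → proj₁ (slice t) * ind (proj₂ (slice t) ≟V e))
    ≡⟨ ∑-map slice p _ ⟨
  lin (map slice p) (λ e′ → ind (e′ ≟V e))
    ≡⟨ eval≡0⇒lin-δ≡0 (map slice p) slice≡0 e ⟩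
  0ℚ ∎
  where
  open ≡-Reasoning
  slice : ℚ × Vec ℕ (suc r) → ℚ × Vec ℕ r
  slice t = proj₁ t * ind (Vec.head (proj₂ t) ℕ.≟ k) , Vec.tail (proj₂ t)
  lem : ∀ a b c → a * b * c ≡ a * c * b
  lem = solve-∀ ℚ-ring
  slice≡0 : ∀ xs → eval (map slice p) (Vec.toList xs) ≡ 0ℚ
  slice≡0 xs = trans (∑-map slice p _) (trans
    (∑-cong p (λ t → lem (proj₁ t) (ind (Vec.head (proj₂ t) ℕ.≟ k)) (evM (Vec.tail (proj₂ t)) (Vec.toList xs))))
    (univariate-coeff p (λ t → proj₁ t * evM (Vec.tail (proj₂ t)) (Vec.toList xs)) (Vec.head ∘ proj₂)
      (λ x → trans (∑-cong p (λ { (c , k′ ∷ e′) → lem′ c (evM e′ (Vec.toList xs)) (pow x k′) })) (f≡0 (x ∷ xs))) k))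
    where
    lem′ : ∀ a b c → a * b * c ≡ a * (c * b)
    lem′ = solve-∀ ℚ-ring

-- A list of terms may repeat an exponent vector, so the sum is regrouped over the distinct vectors
-- `B`, each of which then occurs with its full coefficient.
lin-δ≡0⇒lin≡0 : ∀ {r} (p : Poly r) → (∀ e → lin p (λ e′ → ind (e′ ≟V e)) ≡ 0ℚ) → ∀ f → lin p f ≡ 0ℚ
lin-δ≡0⇒lin≡0 p h f = begin
  ∑ p (λ t → proj₁ t * f (proj₂ t))
    ≡⟨ ∑-cong∈ p (λ t t∈ → cong (proj₁ t *_) (sym (∑-δ _≟V_ (DecUniqueP.deduplicate-! _≟V_ _) f
         (∈P.∈-deduplicate⁺ _≟V_ (∈P.∈-map⁺ proj₂ t∈))))) ⟩
  ∑ p (λ t → proj₁ t * ∑ B (λ b → ind (proj₂ t ≟V b) * f b))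
    ≡⟨ ∑-cong p (λ t → trans (∑-*ˡ B (proj₁ t) _) (∑-cong B (λ b → sym (ℚP.*-assoc (proj₁ t) _ (f b))))) ⟩
  ∑ p (λ t → ∑ B (λ b → proj₁ t * ind (proj₂ t ≟V b) * f b))
    ≡⟨ ∑-swap p B _ ⟩
  ∑ B (λ b → ∑ p (λ t → proj₁ t * ind (proj₂ t ≟V b) * f b))
    ≡⟨ ∑-cong B (λ b → trans (sym (∑-*ʳ p (f b) _)) (trans (cong (_* f b) (h b)) (ℚP.*-zeroˡ (f b)))) ⟩
  ∑ B (λ _ → 0ℚ)
    ≡⟨ ∑-zero B ⟩
  0ℚ ∎
  where
  open ≡-Reasoning
  B = List.deduplicate _≟V_ (map proj₂ p)

coeff-lin : ∀ {r} (p : Poly r) e → coeff p e ≡ lin p (λ e′ → ind (e′ ≟V e))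
coeff-lin p e = ∑-cong p (λ t → trans (if-ind (proj₂ t ≟V e) (proj₁ t)) (ℚP.*-comm (ind (proj₂ t ≟V e)) (proj₁ t)))

toList-injective : ∀ {r} (u v : Vec ℕ r) → Vec.toList u ≡ Vec.toList v → u ≡ v
toList-injective []      []      _ = refl
toList-injective (a ∷ u) (b ∷ v) h = cong₂ _∷_ (ListP.∷-injectiveˡ h) (toList-injective u v (ListP.∷-injectiveʳ h))

coeffL-coeff : ∀ {r} (p : Poly r) e → coeffL p (Vec.toList e) ≡ coeff p e
coeffL-coeff p e = ∑-cong p (λ t → trans (if-ind (ListP.≡-dec ℕ._≟_ (Vec.toList (proj₂ t)) (Vec.toList e)) (proj₁ t))
  (trans (cong (_* proj₁ t) (ind-⇔ (ListP.≡-dec ℕ._≟_ (Vec.toList (proj₂ t)) (Vec.toList e)) (proj₂ t ≟V e)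
    (toList-injective _ _) (cong Vec.toList))) (sym (if-ind (proj₂ t ≟V e) (proj₁ t)))))

coeff-- : ∀ {r} (p q : Poly r) e → coeff (p -P q) e ≡ coeff p e - coeff q e
coeff-- p q e = trans (coeff-lin (p -P q) e) (trans (lin-- p q _) (sym (cong₂ _-_ (coeff-lin p e) (coeff-lin q e))))

eval≡⇒coeff≡ : ∀ {r} (p q : Poly r) → (∀ (xs : Vec ℚ r) → eval p (Vec.toList xs) ≡ eval q (Vec.toList xs)) →
  ∀ e → coeff p e ≡ coeff q e
eval≡⇒coeff≡ p q h e = -‿zero _ _ (trans (sym (coeff-- p q e)) (trans (coeff-lin (p -P q) e)
  (eval≡0⇒lin-δ≡0 (p -P q) (λ xs → trans (lin-- p q _) (trans (cong (_- eval q (Vec.toList xs)) (h xs)) (ℚP.+-inverseʳ (eval q (Vec.toList xs))))) e)))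

coeff≡⇒lin≡ : ∀ {r} (p q : Poly r) → (∀ e → coeff p e ≡ coeff q e) → ∀ f → lin p f ≡ lin q f
coeff≡⇒lin≡ p q h f = -‿zero _ _ (trans (sym (lin-- p q f)) (lin-δ≡0⇒lin≡0 (p -P q)
  (λ e → trans (sym (coeff-lin (p -P q) e)) (trans (coeff-- p q e) (trans (cong (_- coeff q e) (h e)) (ℚP.+-inverseʳ (coeff q e))))) f))

-- The index sets S_{N,r}

Odd3 : ℕ → Set
Odd3 n = 3 ≤ n × n ℕ.% 2 ≡ 1

odd3? : ∀ n → Dec (Odd3 n)
odd3? n = (3 ℕ.≤? n) ×-dec ((n ℕ.% 2) ℕ.≟ 1)

∑-filter : {I : Set} {P : I → Set} (P? : ∀ i → Dec (P i)) (xs : List I) (f : I → ℚ) →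
  ∑ (filter P? xs) f ≡ ∑ xs (λ i → ind (P? i) * f i)
∑-filter P? []       f = refl
∑-filter P? (x ∷ xs) f with P? x
... | yes _ = cong₂ _+_ (sym (ℚP.*-identityˡ (f x))) (∑-filter P? xs f)
... | no _  = trans (∑-filter P? xs f) (sym (trans (cong (_+ ∑ xs (λ i → ind (P? i) * f i)) (ℚP.*-zeroˡ (f x))) (ℚP.+-identityˡ (∑ xs (λ i → ind (P? i) * f i)))))

∑-downFrom : ∀ n (f : ℕ → ℚ) → ∑ (List.downFrom n) f ≡ ∑ (upTo n) f
∑-downFrom zero    f = refl
∑-downFrom (suc n) f = trans (cong (f n +_) (∑-downFrom n f)) (trans (ℚP.+-comm (f n) (∑ (upTo n) f)) (sym (∑-upTo-suc n f)))

∑-oddsDown : ∀ N (f : ℕ → ℚ) → ∑ (oddsDown N) f ≡ ∑ (upTo (suc N)) (λ a → ind (odd3? a) * f a)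
∑-oddsDown N f = trans (∑-filter odd3? (List.reverse (upTo (suc N))) f)
  (trans (cong (λ l → ∑ l (λ a → ind (odd3? a) * f a)) (ListP.reverse-upTo (suc N))) (∑-downFrom (suc N) (λ a → ind (odd3? a) * f a)))

∈-oddsDown⁻ : ∀ N {a} → a ∈ oddsDown N → Odd3 a × a ≤ N
∈-oddsDown⁻ N a∈ with ∈P.∈-filter⁻ odd3? {xs = List.reverse (upTo (suc N))} a∈
... | a∈′ , odd = odd , ℕP.≤-pred (∈P.∈-upTo⁻ (AnyP.reverse⁻ a∈′))

∈-oddsDown⁺ : ∀ N {a} → Odd3 a → a ≤ N → a ∈ oddsDown N
∈-oddsDown⁺ N odd a≤N = ∈P.∈-filter⁺ odd3? (AnyP.reverse⁺ (∈P.∈-upTo⁺ (s≤s a≤N))) odd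

Unique-oddsDown : ∀ N → Unique (oddsDown N)
Unique-oddsDown N = UniqueP.filter⁺ odd3?
  (≡.subst Unique (sym (ListP.reverse-upTo (suc N))) (UniqueP.downFrom⁺ (suc N)))

∑-S : ∀ N r (f : Vec ℕ (suc r) → ℚ) →
  ∑ (S N (suc r)) f ≡ ∑ (oddsDown N) (λ a → ∑ (S (N ∸ a) r) (λ l → f (a ∷ l)))
∑-S N r f = trans (∑-concatMap (λ n → map (n ∷_) (S (N ∸ n) r)) (oddsDown N) f)
  (∑-cong (oddsDown N) (λ a → ∑-map (a ∷_) (S (N ∸ a) r) f))

∈-S⁻ : ∀ N {r a} {l : Vec ℕ r} → a ∷ l ∈ S N (suc r) → Odd3 a × a ≤ N × l ∈ S (N ∸ a) r
∈-S⁻ N {r} al∈ with find (∈P.∈-concatMap⁻ (λ n → map (n ∷_) (S (N ∸ n) r)) {xs = oddsDown N} al∈)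
... | a′ , a′∈ , al∈′ with ∈P.∈-map⁻ (a′ ∷_) al∈′
...   | _ , l∈ , refl = proj₁ (∈-oddsDown⁻ N a′∈) , proj₂ (∈-oddsDown⁻ N a′∈) , l∈

∈-S⁺ : ∀ N {r a} {l : Vec ℕ r} → Odd3 a → a ≤ N → l ∈ S (N ∸ a) r → a ∷ l ∈ S N (suc r)
∈-S⁺ N {r} {a} odd a≤N l∈ = ∈P.∈-concatMap⁺ (λ n → map (n ∷_) (S (N ∸ n) r))
  (lose (∈-oddsDown⁺ N odd a≤N) (∈P.∈-map⁺ (a ∷_) l∈))

∈-S-odd : ∀ r N {u : Vec ℕ r} → u ∈ S N r → ∀ i → Odd3 (Vec.lookup u i)
∈-S-odd (suc r) N {a ∷ l} u∈ Fin.zero    = proj₁ (∈-S⁻ N u∈)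
∈-S-odd (suc r) N {a ∷ l} u∈ (Fin.suc i) = ∈-S-odd r (N ∸ a) (proj₂ (proj₂ (∈-S⁻ N u∈))) i

∈-S-sum : ∀ r N {u : Vec ℕ r} → u ∈ S N r → Vec.sum u ≡ N
∈-S-sum zero    zero    {[]}    u∈ = refl
∈-S-sum (suc r) N       {a ∷ l} u∈ with ∈-S⁻ N u∈
... | _ , a≤N , l∈ = trans (cong (a ℕ.+_) (∈-S-sum r (N ∸ a) l∈)) (ℕP.m+[n∸m]≡n a≤N)

Unique-concatMap : {I J : Set} (f : I → List J) {xs : List I} → Unique xs → (∀ x → Unique (f x)) →
  (∀ {x y z} → z ∈ f x → z ∈ f y → x ≡ y) → Unique (concatMap f xs)
Unique-concatMap f {[]}     []       uf inj = []
Unique-concatMap f {x ∷ xs} (x∉ ∷ u) uf inj = UniqueP.++⁺ (uf x) (Unique-concatMap f u uf inj) λ { (z∈ , z∈′) →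
  let y , y∈ , z∈fy = find (∈P.∈-concatMap⁻ f {xs = xs} z∈′) in All.lookup x∉ y∈ (inj z∈ z∈fy) }

Unique-S : ∀ N r → Unique (S N r)
Unique-S zero    zero    = [] ∷ []
Unique-S (suc N) zero    = []
Unique-S N       (suc r) = Unique-concatMap (λ n → map (n ∷_) (S (N ∸ n) r)) (Unique-oddsDown N)
  (λ n → UniqueP.map⁺ VecP.∷-injectiveʳ (Unique-S (N ∸ n) r)) heads
  where
  heads : ∀ {x y z} → z ∈ map (x ∷_) (S (N ∸ x) r) → z ∈ map (y ∷_) (S (N ∸ y) r) → x ≡ y
  heads {x} {y} z∈ z∈′ with ∈P.∈-map⁻ (x ∷_) z∈ | ∈P.∈-map⁻ (y ∷_) z∈′
  ... | _ , _ , refl | _ , _ , eq = VecP.∷-injectiveˡ eq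

∑-lookup : {I : Set} (xs : List I) (f : I → ℚ) → ∑ (allFin (length xs)) (f ∘ List.lookup xs) ≡ ∑ xs f
∑-lookup xs f = trans (sym (∑-map (List.lookup xs) (allFin (length xs)) f))
  (cong (λ l → ∑ l f) (trans (ListP.map-tabulate id (List.lookup xs)) (ListP.tabulate-lookup xs)))

lookup-injective : {I : Set} {xs : List I} → Unique xs → ∀ i j → List.lookup xs i ≡ List.lookup xs j → i ≡ j
lookup-injective (x∉ ∷ u) Fin.zero    Fin.zero    h = refl
lookup-injective (x∉ ∷ u) Fin.zero    (Fin.suc j) h = ⊥-elim (All.lookup x∉ (∈P.∈-lookup j) h)
lookup-injective (x∉ ∷ u) (Fin.suc i) Fin.zero    h = ⊥-elim (All.lookup x∉ (∈P.∈-lookup i) (sym h))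
lookup-injective (x∉ ∷ u) (Fin.suc i) (Fin.suc j) h = cong Fin.suc (lookup-injective u i j h)

tup∈S : ∀ N r i → tup N r i ∈ S N r
tup∈S N r i = ∈P.∈-lookup i

tup-surjective : ∀ N r {u} → u ∈ S N r → ∃ λ i → tup N r i ≡ u
tup-surjective N r u∈ = Any.index u∈ , sym (AnyP.lookup-index u∈)

∑-tup : ∀ N r (f : Vec ℕ r → ℚ) → ∑ (allFin (size N r)) (f ∘ tup N r) ≡ ∑ (S N r) f
∑-tup N r f = ∑-lookup (S N r) f

-- Coordinates indexed by tuples instead of positions in `S N r`, and 0 on all other tuples. Block
-- and tensor structure is visible on tuples only.
extend : ∀ N r → Vect N r → Vec ℕ r → ℚ
extend N r v u = ∑ (allFin (size N r)) (λ i → ind (tup N r i ≟V u) * v i)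

extend-tup : ∀ N r v i → extend N r v (tup N r i) ≡ v i
extend-tup N r v i = trans
  (∑-cong (allFin (size N r)) (λ j → cong (_* v j) (ind-⇔ (tup N r j ≟V tup N r i) (i Fin.≟ j)
    (λ h → sym (lookup-injective (Unique-S N r) j i h)) (λ { refl → refl }))))
  (∑-δ Fin._≟_ (UniqueP.allFin⁺ (size N r)) v (∈P.∈-allFin i))

-- φ⁽ʲ⁾ as right multiplication by E⁽ʲ⁾

map-cong∈ : {A B : Set} (xs : List A) {f g : A → B} → (∀ x → x ∈ xs → f x ≡ g x) → map f xs ≡ map g xs
map-cong∈ []       h = refl
map-cong∈ (x ∷ xs) h = cong₂ _∷_ (h x (here refl)) (map-cong∈ xs (λ y y∈ → h y (there y∈)))

filter-≢-map : (f : ℕ → ℕ) → (∀ {x y} → f x ≡ f y → x ≡ y) → ∀ j xs →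
  filter (λ i → ¬? (i ℕ.≟ f j)) (map f xs) ≡ map f (filter (λ i → ¬? (i ℕ.≟ j)) xs)
filter-≢-map f inj j []       = refl
filter-≢-map f inj j (x ∷ xs) with x ℕ.≟ j
... | yes refl = trans (ListP.filter-reject (λ i → ¬? (i ℕ.≟ f j)) (λ ≢ → ≢ refl))
  (trans (filter-≢-map f inj j xs) (cong (map f) (sym (ListP.filter-reject (λ i → ¬? (i ℕ.≟ j)) (λ ≢ → ≢ refl)))))
... | no x≢j   = trans (ListP.filter-accept (λ i → ¬? (i ℕ.≟ f j)) (λ eq → x≢j (inj eq)))
  (trans (cong (f x ∷_) (filter-≢-map f inj j xs)) (cong (map f) (sym (ListP.filter-accept (λ i → ¬? (i ℕ.≟ j)) x≢j))))

nth-++ : ∀ X Y i → nth (X ++ Y) (suc (length X ℕ.+ i)) ≡ nth Y (suc i)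
nth-++ []      Y i = refl
nth-++ (x ∷ X) Y i = nth-++ X Y i

nth-prefix : ∀ X Y → map (λ x → nth (X ++ Y) (suc x)) (upTo (length X)) ≡ X
nth-prefix []      Y = refl
nth-prefix (x ∷ X) Y = cong (x ∷_) (trans (ListP.map-applyUpTo suc (λ x₁ → nth (x ∷ X ++ Y) (suc x₁)) (length X))
  (trans (sym (ListP.map-upTo (λ i → nth (X ++ Y) (suc i)) (length X))) (nth-prefix X Y)))

between-shift : ∀ k m → between (suc k) (k ℕ.+ m) ≡ map (λ x → suc (k ℕ.+ x)) (upTo m)
between-shift k m = cong (λ n → map (λ x → suc (k ℕ.+ x)) (upTo n)) (ℕP.m+n∸m≡n k m)

eval-vars : ∀ r xs (L : List ℕ) → (∀ x → x ∈ L → 1 ≤ x × x ≤ r) →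
  map (λ q → eval q xs) (map (var r) L) ≡ map (nth xs) L
eval-vars r xs L h = trans (sym (ListP.map-∘ L))
  (map-cong∈ L (λ x x∈ → eval-var r x xs (proj₂ (h x x∈)) (proj₁ (h x x∈))))

eval-var-diff : ∀ r a b xs → a ≤ r → b ≤ r → 1 ≤ a → 1 ≤ b →
  eval (var r a -P var r b) xs ≡ nth xs a - nth xs b
eval-var-diff r a b xs a≤ b≤ 1≤a 1≤b = trans (lin-- (var r a) (var r b) (λ e → evM e xs))
  (cong₂ _-_ (eval-var r a xs a≤ 1≤a) (eval-var r b xs b≤ 1≤b))

-- Y₁, …, Yₙ without Yᵢ₊₁
omit : ℕ → List ℚ → ℕ → List ℚ
omit n Y i = map (λ x → nth Y (suc x)) (filter (λ x → ¬? (x ℕ.≟ i)) (upTo n))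

step : (List ℚ → ℚ) → ℕ → List ℚ → ℕ → ℚ
step f m Y i = f ((nth Y (suc (suc i)) - nth Y (suc i)) ∷ omit (suc m) Y (suc i))
             - f ((nth Y (suc (suc i)) - nth Y (suc i)) ∷ omit (suc m) Y i)

-- The operator common to φ and ∘, on functions of m+1 variables.
cyc : (List ℚ → ℚ) → ℕ → List ℚ → ℚ
cyc f m Y = f Y + ∑ (upTo m) (step f m Y)

cyc-cong : ∀ {f g : List ℚ → ℚ} m Y → (∀ ys → f ys ≡ g ys) → cyc f m Y ≡ cyc g m Y
cyc-cong m Y h = cong₂ _+_ (h Y) (∑-cong (upTo m) (λ i → cong₂ _-_ (h _) (h _)))

cyc-* : ∀ c (f : List ℚ → ℚ) m Y → cyc (λ ys → c * f ys) m Y ≡ c * cyc f m Y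
cyc-* c f m Y = trans (cong (c * f Y +_) (trans (∑-cong (upTo m) (λ i → lem c (f _) (f _))) (sym (∑-*ˡ (upTo m) c _))))
  (sym (ℚP.*-distribˡ-+ c (f Y) _))
  where
  lem : ∀ c x y → c * x - c * y ≡ c * (x - y)
  lem = solve-∀ ℚ-ring

cyc-∑ : {I : Set} (L : List I) (f : I → List ℚ → ℚ) (m : ℕ) (Y : List ℚ) →
  cyc (λ ys → ∑ L (λ i → f i ys)) m Y ≡ ∑ L (λ i → cyc (f i) m Y)
cyc-∑ L f m Y = trans (cong (∑ L (λ i → f i Y) +_)
    (trans (∑-cong (upTo m) (λ s → sym (∑-- L _ _))) (∑-swap (upTo m) L (λ s i → step (f i) m Y s))))
  (sym (∑-+ L (λ i → f i Y) (λ i → ∑ (upTo m) (step (f i) m Y))))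

eval-varsOmit : ∀ k m X Y j → length X ≡ k →
  map (λ q → eval q (X ++ Y)) (varsOmit (k ℕ.+ suc m) (suc k) (k ℕ.+ suc m) (suc (k ℕ.+ j))) ≡ omit (suc m) Y j
eval-varsOmit k m X Y j refl = begin
  map (λ q → eval q (X ++ Y)) (map (var r) (filter (λ i → ¬? (i ℕ.≟ suc (k ℕ.+ j))) (between (suc k) r)))
    ≡⟨ cong (λ l → map (λ q → eval q (X ++ Y)) (map (var r) l)) (trans
         (cong (filter (λ i → ¬? (i ℕ.≟ suc (k ℕ.+ j)))) (between-shift k (suc m)))
         (filter-≢-map (λ x → suc (k ℕ.+ x)) (λ h → ℕP.+-cancelˡ-≡ k _ _ (ℕP.suc-injective h)) j (upTo (suc m)))) ⟩
  map (λ q → eval q (X ++ Y)) (map (var r) (map (λ x → suc (k ℕ.+ x)) kept))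
    ≡⟨ eval-vars r (X ++ Y) (map (λ x → suc (k ℕ.+ x)) kept) bounds ⟩
  map (nth (X ++ Y)) (map (λ x → suc (k ℕ.+ x)) kept)
    ≡⟨ ListP.map-∘ kept ⟨
  map (λ x → nth (X ++ Y) (suc (k ℕ.+ x))) kept
    ≡⟨ ListP.map-cong (nth-++ X Y) kept ⟩
  omit (suc m) Y j ∎
  where
  open ≡-Reasoning
  r = k ℕ.+ suc m
  kept = filter (λ x → ¬? (x ℕ.≟ j)) (upTo (suc m))
  bounds : ∀ x → x ∈ map (λ x → suc (k ℕ.+ x)) kept → 1 ≤ x × x ≤ r
  bounds x x∈ with ∈P.∈-map⁻ (λ x → suc (k ℕ.+ x)) x∈
  ... | y , y∈ , refl with ∈P.∈-filter⁻ (λ x → ¬? (x ℕ.≟ j)) {xs = upTo (suc m)} y∈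
  ...   | y∈′ , _ = s≤s z≤n , ≡.subst (_≤ r) (ℕP.+-suc k y) (ℕP.+-monoʳ-≤ k (∈P.∈-upTo⁻ y∈′))

eval-diff-++ : ∀ k m X Y i → length X ≡ k → i < m →
  eval (var (k ℕ.+ suc m) (suc (suc (k ℕ.+ i))) -P var (k ℕ.+ suc m) (suc (k ℕ.+ i))) (X ++ Y)
    ≡ nth Y (suc (suc i)) - nth Y (suc i)
eval-diff-++ k m X Y i refl i<m = trans
  (eval-var-diff (k ℕ.+ suc m) (suc (suc (k ℕ.+ i))) (suc (k ℕ.+ i)) (X ++ Y) le₂ (ℕP.≤-trans (ℕP.n≤1+n _) le₂) (s≤s z≤n) (s≤s z≤n))
  (cong₂ _-_ (trans (cong (λ z → nth (X ++ Y) (suc z)) (sym (ℕP.+-suc k i))) (nth-++ X Y (suc i))) (nth-++ X Y i))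
  where
  le₂ : suc (suc (k ℕ.+ i)) ≤ k ℕ.+ suc m
  le₂ = ≡.subst (_≤ k ℕ.+ suc m) (trans (ℕP.+-suc k (suc i)) (cong suc (ℕP.+-suc k i))) (ℕP.+-monoʳ-≤ k (s≤s i<m))

-- φ⁽ʲ⁾ before the restriction to totally even monomials, with `k` = r - j the number of variables
-- it leaves alone.
φpoly : (r k : ℕ) → Poly r → Poly r
φpoly r k Q = Q +P sumP (map (λ i →
     subst Q (vars r 1 k ++ ((var r (suc i) -P var r i) ∷ varsOmit r (suc k) r (suc i)))
  -P subst Q (vars r 1 k ++ ((var r (suc i) -P var r i) ∷ varsOmit r (suc k) r i))) (between (suc k) (r ∸ 1)))

eval-φpoly : ∀ k m (Q : Poly (k ℕ.+ suc m)) X Y → length X ≡ k →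
  eval (φpoly (k ℕ.+ suc m) k Q) (X ++ Y) ≡ cyc (λ ys → eval Q (X ++ ys)) m Y
eval-φpoly k m Q X Y refl = trans (lin-+ Q (sumP (map term (between (suc k) (r ∸ 1)))) ev) (cong (eval Q (X ++ Y) +_) (begin
  lin (sumP (map term (between (suc k) (r ∸ 1)))) ev
    ≡⟨ lin-sumP (between (suc k) (r ∸ 1)) term ev ⟩
  ∑ (between (suc k) (r ∸ 1)) (λ i → eval (term i) (X ++ Y))
    ≡⟨ cong (λ l → ∑ l (λ i → eval (term i) (X ++ Y)))
         (trans (cong (λ z → between (suc k) (z ∸ 1)) (ℕP.+-suc k m)) (between-shift k m)) ⟩
  ∑ (map (λ x → suc (k ℕ.+ x)) (upTo m)) (λ i → eval (term i) (X ++ Y))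
    ≡⟨ ∑-map (λ x → suc (k ℕ.+ x)) (upTo m) _ ⟩
  ∑ (upTo m) (λ i → eval (term (suc (k ℕ.+ i))) (X ++ Y))
    ≡⟨ ∑-cong∈ (upTo m) (λ i i∈ → trans (lin-- (subst Q (pts (suc (k ℕ.+ i)) (suc (suc (k ℕ.+ i))))) (subst Q (pts (suc (k ℕ.+ i)) (suc (k ℕ.+ i)))) ev)
         (cong₂ _-_ (trans (cong (λ z → eval (subst Q (pts (suc (k ℕ.+ i)) (suc z))) (X ++ Y)) (sym (ℕP.+-suc k i))) (value i (suc i) (∈P.∈-upTo⁻ i∈)))
                    (value i i (∈P.∈-upTo⁻ i∈)))) ⟩
  ∑ (upTo m) (step (λ ys → eval Q (X ++ ys)) m Y) ∎))
  where
  open ≡-Reasoning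
  r = k ℕ.+ suc m
  ev : Vec ℕ r → ℚ
  ev e = evM e (X ++ Y)
  pts : ℕ → ℕ → List (Poly r)
  pts i j = vars r 1 k ++ ((var r (suc i) -P var r i) ∷ varsOmit r (suc k) r j)
  term : ℕ → Poly r
  term i = subst Q (pts i (suc i)) -P subst Q (pts i i)
  prefix : map (λ q → eval q (X ++ Y)) (vars r 1 k) ≡ X
  prefix = trans (eval-vars r (X ++ Y) (between 1 k) (λ x x∈ → bounds x x∈))
    (trans (sym (ListP.map-∘ (upTo k))) (nth-prefix X Y))
    where
    bounds : ∀ x → x ∈ map suc (upTo k) → 1 ≤ x × x ≤ r
    bounds x x∈ with ∈P.∈-map⁻ suc x∈
    ... | y , y∈ , refl = s≤s z≤n , ℕP.≤-trans (∈P.∈-upTo⁻ y∈) (ℕP.m≤m+n k (suc m))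
  value : ∀ i j → i < m → eval (subst Q (pts (suc (k ℕ.+ i)) (suc (k ℕ.+ j)))) (X ++ Y)
    ≡ eval Q (X ++ ((nth Y (suc (suc i)) - nth Y (suc i)) ∷ omit (suc m) Y j))
  value i j i<m = trans (eval-subst Q (pts (suc (k ℕ.+ i)) (suc (k ℕ.+ j))) (X ++ Y)) (cong (eval Q)
    (trans (ListP.map-++ (λ q → eval q (X ++ Y)) (vars r 1 k) _)
      (cong₂ _++_ prefix (cong₂ _∷_ (eval-diff-++ k m X Y i refl i<m) (eval-varsOmit k m X Y j refl)))))

pow-neg-even : ∀ x h → pow (- x) (h ℕ.* 2) ≡ pow x (h ℕ.* 2)
pow-neg-even x zero    = refl
pow-neg-even x (suc h) = trans (cong (λ z → (- x) * ((- x) * z)) (pow-neg-even x h)) (lem x (pow x (h ℕ.* 2)))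
  where
  lem : ∀ x p → (- x) * ((- x) * p) ≡ x * (x * p)
  lem = solve-∀ ℚ-ring

odd∸1 : ∀ {a} → Odd3 a → ∃ λ h → a ∸ 1 ≡ h ℕ.* 2
odd∸1 {a} (_ , odd) = a ℕ./ 2 , cong (_∸ 1) (trans (DivMod.m≡m%n+[m/n]*n a 2) (cong (ℕ._+ (a ℕ./ 2) ℕ.* 2) odd))

headTimes : ∀ {m} → ℕ → Poly m → List ℚ → ℚ
headTimes d g []       = 0ℚ
headTimes d g (y ∷ ys) = pow y d * eval g ys

-- The degree `h * 2` is even, so the sign in the definition of ∘ is 1, and the two differences
-- x_{i+1} - x_i and x_i - x_{i+1} have the same power. This gives ∘ the shape that φ has.
eval-compose : ∀ m h (g : Poly m) Y → length Y ≡ suc m →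
  eval (compose (monoP (h ℕ.* 2 ∷ [])) (h ℕ.* 2) g) Y
    ≡ cyc (headTimes (h ℕ.* 2) g) m Y
eval-compose m h g (y ∷ Y) lenY = trans (lin-+ (subst mono (var r 1 ∷ []) *P subst g (vars r 2 r)) (sumP (map term (between 1 m))) ev) (cong₂ _+_ first (begin
  lin (sumP (map term (between 1 m))) ev
    ≡⟨ lin-sumP (between 1 m) term ev ⟩
  ∑ (map suc (upTo m)) (λ i → eval (term i) Y₁)
    ≡⟨ ∑-map suc (upTo m) _ ⟩
  ∑ (upTo m) (λ i → eval (term (suc i)) Y₁)
    ≡⟨ ∑-cong∈ (upTo m) (λ i i∈ → trans (lin-- (leftP (suc i)) (rightP (suc i)) ev) (cong₂ _-_ (left i (∈P.∈-upTo⁻ i∈)) (right i (∈P.∈-upTo⁻ i∈)))) ⟩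
  ∑ (upTo m) (step f m Y₁) ∎))
  where
  open ≡-Reasoning
  r = suc m
  d = h ℕ.* 2
  Y₁ = y ∷ Y
  ev : Vec ℕ r → ℚ
  ev e = evM e Y₁
  f = headTimes d g
  sign : ℚ
  sign = if ⌊ (d ℕ.% 2) ℕ.≟ 0 ⌋ then 1ℚ else ℚ.- 1ℚ
  sign≡1 : sign ≡ 1ℚ
  sign≡1 with (d ℕ.% 2) ℕ.≟ 0
  ... | yes _ = refl
  ... | no ≢0 = ⊥-elim (≢0 (DivMod.m*n%n≡0 h 2))
  mono : Poly 1
  mono = monoP (d ∷ [])
  leftP rightP term : ℕ → Poly r
  leftP i  = subst mono ((var r (suc i) -P var r i) ∷ []) *P subst g (varsOmit r 1 r (suc i))
  rightP i = scaleP sign (subst mono ((var r i -P var r (suc i)) ∷ []) *P subst g (varsOmit r 1 r i))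
  term i   = leftP i -P rightP i
  eval-pow-subst : ∀ q → eval (subst mono (q ∷ [])) Y₁ ≡ pow (eval q Y₁) d
  eval-pow-subst q = trans (eval-subst mono (q ∷ []) Y₁)
    (trans (eval-mono (d ∷ []) (eval q Y₁ ∷ [])) (ℚP.*-identityʳ (pow (eval q Y₁) d)))
  tail : map (λ q → eval q Y₁) (vars r 2 r) ≡ Y
  tail = trans (eval-vars r Y₁ (between 2 r) bounds) (trans (sym (ListP.map-∘ (upTo m)))
    (trans (cong (λ n → map (λ x → nth Y₁ (suc (suc x))) (upTo n)) (sym lenY′))
      (trans (ListP.map-cong (λ x → cong (λ l → nth l (suc x)) (sym (ListP.++-identityʳ Y))) (upTo (length Y)))
      (nth-prefix Y []))))
    where
    lenY′ = ℕP.suc-injective lenY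
    bounds : ∀ x → x ∈ map (2 ℕ.+_) (upTo m) → 1 ≤ x × x ≤ r
    bounds x x∈ with ∈P.∈-map⁻ (2 ℕ.+_) x∈
    ... | z , z∈ , refl = s≤s z≤n , s≤s (∈P.∈-upTo⁻ z∈)
  first : eval (subst mono (var r 1 ∷ []) *P subst g (vars r 2 r)) Y₁ ≡ f Y₁
  first = trans (eval-* (subst mono (var r 1 ∷ [])) (subst g (vars r 2 r)) Y₁)
    (cong₂ _*_ (trans (eval-pow-subst (var r 1)) (cong (λ z → pow z d) (eval-var r 1 Y₁ (s≤s z≤n) (s≤s z≤n))))
      (trans (eval-subst g (vars r 2 r) Y₁) (cong (eval g) tail)))
  left : ∀ i → i < m → eval (leftP (suc i)) Y₁
    ≡ pow (nth Y₁ (suc (suc i)) - nth Y₁ (suc i)) d * eval g (omit r Y₁ (suc i))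
  left i i<m = trans (eval-* (subst mono ((var r (suc (suc i)) -P var r (suc i)) ∷ [])) (subst g (varsOmit r 1 r (suc (suc i)))) Y₁)
    (cong₂ _*_ (trans (eval-pow-subst (var r (suc (suc i)) -P var r (suc i))) (cong (λ z → pow z d) (eval-diff-++ 0 m [] Y₁ i refl i<m)))
      (trans (eval-subst g (varsOmit r 1 r (suc (suc i))) Y₁) (cong (eval g) (eval-varsOmit 0 m [] Y₁ (suc i) refl))))
  right : ∀ i → i < m → eval (rightP (suc i)) Y₁
    ≡ pow (nth Y₁ (suc (suc i)) - nth Y₁ (suc i)) d * eval g (omit r Y₁ i)
  right i i<m = trans (lin-scale sign (subst mono ((var r (suc i) -P var r (suc (suc i))) ∷ []) *P subst g (varsOmit r 1 r (suc i))) ev)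
    (trans (cong₂ _*_ sign≡1 (eval-* (subst mono ((var r (suc i) -P var r (suc (suc i))) ∷ [])) (subst g (varsOmit r 1 r (suc i))) Y₁))
    (trans (ℚP.*-identityˡ _)
    (cong₂ _*_ (trans (eval-pow-subst (var r (suc i) -P var r (suc (suc i)))) (trans (cong (λ z → pow z d) flip) (pow-neg-even _ h)))
      (trans (eval-subst g (varsOmit r 1 r (suc i)) Y₁) (cong (eval g) (eval-varsOmit 0 m [] Y₁ i refl))))))
    where
    flip : eval (var r (suc i) -P var r (suc (suc i))) Y₁ ≡ - (nth Y₁ (suc (suc i)) - nth Y₁ (suc i))
    flip = trans (eval-var-diff r (suc i) (suc (suc i)) Y₁ (ℕP.≤-trans (ℕP.n≤1+n _) (s≤s i<m)) (s≤s i<m) (s≤s z≤n) (s≤s z≤n))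
      (neg-diff (nth Y₁ (suc i)) (nth Y₁ (suc (suc i))))

composed : ∀ {m} → Vec ℕ (suc m) → Poly (suc m)
composed (a ∷ ms) = compose (monoP ((a ∸ 1) ∷ [])) (a ∸ 1) (monoP (exps ms))

eval-composed : ∀ {m} (s : Vec ℕ (suc m)) Y → Odd3 (Vec.head s) → length Y ≡ suc m →
  eval (composed s) Y ≡ cyc (evM (exps s)) m Y
eval-composed {m} (a ∷ ms) Y odd lenY with a ∸ 1 | odd∸1 odd
... | _ | h , refl = trans (eval-compose m h (monoP (exps ms)) Y lenY) (cong₂ _+_ (head-value Y lenY) (∑-cong (upTo m) (λ i →
  cong₂ _-_ (cong (pow _ (h ℕ.* 2) *_) (eval-mono (exps ms) _)) (cong (pow _ (h ℕ.* 2) *_) (eval-mono (exps ms) _)))))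
  where
  head-value : ∀ Y → length Y ≡ suc m →
    headTimes (h ℕ.* 2) (monoP (exps ms)) Y ≡ evM (h ℕ.* 2 ∷ exps ms) Y
  head-value (y ∷ ys) _ = cong (pow y (h ℕ.* 2) *_) (eval-mono (exps ms) ys)

-- The lengths of the two vectors agree only propositionally; comparing them under a function `G` of
-- vectors of every length avoids a transport.
fromList-toList : {A : Set} {B : Set} (G : ∀ {l} → Vec A l → B) {l : ℕ} (v : Vec A l) → G (Vec.fromList (Vec.toList v)) ≡ G v
fromList-toList G []      = refl
fromList-toList G (x ∷ v) = fromList-toList (λ w → G (x ∷ w)) v

e-coeff : ∀ {m} (s n : Vec ℕ (suc m)) → e (Vec.toList s) (Vec.toList n) ≡ coeff (composed s) (exps n)
e-coeff (a ∷ ms) n = trans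
  (cong (coeffL (composed (a ∷ Vec.fromList (Vec.toList ms)))) (sym (VecP.toList-map (_∸ 1) n)))
  (trans (fromList-toList (λ w → coeffL (composed (a ∷ w)) (Vec.toList (exps n))) ms)
    (coeffL-coeff (composed (a ∷ ms)) (exps n)))

EjV : ∀ r → ℕ → Vec ℕ r → Vec ℕ r → ℚ
EjV r j u v =
  if ⌊ ListP.≡-dec ℕ._≟_ (List.take (r ∸ j) (Vec.toList u)) (List.take (r ∸ j) (Vec.toList v)) ⌋
  then e (List.drop (r ∸ j) (Vec.toList u)) (List.drop (r ∸ j) (Vec.toList v)) else 0ℚ

take-toList-++ : ∀ {A : Set} {k l} (p : Vec A k) (s : Vec A l) → List.take k (Vec.toList (p Vec.++ s)) ≡ Vec.toList p
take-toList-++ []      s = refl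
take-toList-++ (x ∷ p) s = cong (x ∷_) (take-toList-++ p s)

drop-toList-++ : ∀ {A : Set} {k l} (p : Vec A k) (s : Vec A l) → List.drop k (Vec.toList (p Vec.++ s)) ≡ Vec.toList s
drop-toList-++ []      s = refl
drop-toList-++ (x ∷ p) s = drop-toList-++ p s

EjV-++ : ∀ {k m} (p p′ : Vec ℕ k) (s s′ : Vec ℕ (suc m)) →
  EjV (k ℕ.+ suc m) (suc m) (p Vec.++ s) (p′ Vec.++ s′) ≡ ind (p ≟V p′) * coeff (composed s) (exps s′)
EjV-++ {k} {m} p p′ s s′ rewrite ℕP.m+n∸n≡m k (suc m)
  | take-toList-++ p s | take-toList-++ p′ s′ | drop-toList-++ p s | drop-toList-++ p′ s′ = trans
  (if-ind (ListP.≡-dec ℕ._≟_ (Vec.toList p) (Vec.toList p′)) (e (Vec.toList s) (Vec.toList s′)))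
  (cong₂ _*_ (ind-⇔ (ListP.≡-dec ℕ._≟_ (Vec.toList p) (Vec.toList p′)) (p ≟V p′) (toList-injective p p′) (cong Vec.toList))
    (e-coeff s s′))

evM-++ : ∀ {k l} (p : Vec ℕ k) (s : Vec ℕ l) X Y → length X ≡ k → evM (p Vec.++ s) (X ++ Y) ≡ evM p X * evM s Y
evM-++ []      s []      Y _   = sym (ℚP.*-identityˡ (evM s Y))
evM-++ (a ∷ p) s (x ∷ X) Y len = trans (cong (pow x a *_) (evM-++ p s X Y (ℕP.suc-injective len)))
  (sym (ℚP.*-assoc (pow x a) (evM p X) (evM s Y)))

∸1-injective : ∀ {a b} → Odd3 a → Odd3 b → a ∸ 1 ≡ b ∸ 1 → a ≡ b
∸1-injective {suc a} {suc b} _ _ h = cong suc h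

exps-injective : ∀ {k} (p q : Vec ℕ k) → (∀ i → Odd3 (Vec.lookup p i)) → (∀ i → Odd3 (Vec.lookup q i)) →
  exps p ≡ exps q → p ≡ q
exps-injective []      []      _ _ _ = refl
exps-injective (a ∷ p) (b ∷ q) oddp oddq h = cong₂ _∷_
  (∸1-injective (oddp Fin.zero) (oddq Fin.zero) (VecP.∷-injectiveˡ h))
  (exps-injective p q (oddp ∘ Fin.suc) (oddq ∘ Fin.suc) (VecP.∷-injectiveʳ h))

odd-prefix : ∀ {k l} (p : Vec ℕ k) (s : Vec ℕ l) → (∀ i → Odd3 (Vec.lookup (p Vec.++ s) i)) → ∀ i → Odd3 (Vec.lookup p i)
odd-prefix {l = l} p s h i = ≡.subst Odd3 (VecP.lookup-++ˡ p s i) (h (i Fin.↑ˡ l))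

odd-suffix : ∀ {k l} (p : Vec ℕ k) (s : Vec ℕ (suc l)) → (∀ i → Odd3 (Vec.lookup (p Vec.++ s) i)) → Odd3 (Vec.head s)
odd-suffix []      (a ∷ s) h = h Fin.zero
odd-suffix (x ∷ p) s       h = odd-suffix p s (h ∘ Fin.suc)

exps-++ : ∀ {k l} (p : Vec ℕ k) (s : Vec ℕ l) → exps (p Vec.++ s) ≡ exps p Vec.++ exps s
exps-++ p s = VecP.map-++ (_∸ 1) p s

lin-mapᵉ : ∀ {r r′} (g : Vec ℕ r → Vec ℕ r′) (p : Poly r) f →
  lin (map (λ t → proj₁ t , g (proj₂ t)) p) f ≡ lin p (f ∘ g)
lin-mapᵉ g p f = ∑-map (λ t → proj₁ t , g (proj₂ t)) p _

length-toList : ∀ {A : Set} {n} (v : Vec A n) → length (Vec.toList v) ≡ n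
length-toList = VecP.length-toList

eval-toPoly : ∀ N r v ys → eval (toPoly N r v) ys ≡ ∑ (allFin (size N r)) (λ i → v i * evM (exps (tup N r i)) ys)
eval-toPoly N r v ys = ∑-map (λ i → v i , exps (tup N r i)) (allFin (size N r)) _

-- The first `k` variables are parameters for φ, so each monomial is cut into a prefix and a suffix,
-- and only the suffix is moved, to its `composed` polynomial. The sum `R` of the results has the
-- values of `φpoly`, hence its coefficients, and the coefficients of each row at tuples of `S` are
-- the entries of `Ej`. With the number of variables written as a sum, tuples can be cut by `take`
-- and `drop`.
φ-vecMat-+ : ∀ N k m (v : Vect N (k ℕ.+ suc m)) n →
  coeff (φpoly (k ℕ.+ suc m) k (toPoly N (k ℕ.+ suc m) v)) (exps (tup N (k ℕ.+ suc m) n))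
    ≡ vecMat N (k ℕ.+ suc m) v (Ej N (k ℕ.+ suc m) (suc m)) n
φ-vecMat-+ N k m v n = trans (eval≡⇒coeff≡ (φpoly r k Q) R values (exps u₀)) (begin
  coeff R (exps u₀)
    ≡⟨ coeff-lin R (exps u₀) ⟩
  lin R (λ e′ → ind (e′ ≟V exps u₀))
    ≡⟨ lin-sumP L (λ i → scaleP (v i) (row (tup N r i))) _ ⟩
  ∑ L (λ i → lin (scaleP (v i) (row (tup N r i))) (λ e′ → ind (e′ ≟V exps u₀)))
    ≡⟨ ∑-cong L (λ i → trans (lin-scale (v i) (row (tup N r i)) _) (cong (v i *_) (entry (tup N r i) (∈-S-odd r N (tup∈S N r i))))) ⟩
  ∑ L (λ i → v i * EjV r (suc m) (tup N r i) u₀) ∎)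
  where
  open ≡-Reasoning
  r = k ℕ.+ suc m
  L = allFin (size N r)
  Q = toPoly N r v
  u₀ = tup N r n
  row : Vec ℕ r → Poly r
  row u = map (λ t → proj₁ t , exps (Vec.take k u) Vec.++ proj₂ t) (composed (Vec.drop k u))
  R = sumP (map (λ i → scaleP (v i) (row (tup N r i))) L)
  split : ∀ {A : Set} (u : Vec A r) → Vec.take k u Vec.++ Vec.drop k u ≡ u
  split u = VecP.take++drop≡id k u
  oddSplit : ∀ u → (∀ i → Odd3 (Vec.lookup u i)) → ∀ i → Odd3 (Vec.lookup (Vec.take k u Vec.++ Vec.drop k u) i)
  oddSplit u odd = ≡.subst (λ w → ∀ i → Odd3 (Vec.lookup w i)) (sym (split u)) odd
  evM-split : ∀ u X Y → length X ≡ k → evM (exps u) (X ++ Y) ≡ evM (exps (Vec.take k u)) X * evM (exps (Vec.drop k u)) Y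
  evM-split u X Y len = trans (cong (λ w → evM (exps w) (X ++ Y)) (sym (split u)))
    (trans (cong (λ w → evM w (X ++ Y)) (exps-++ (Vec.take k u) (Vec.drop k u)))
      (evM-++ (exps (Vec.take k u)) (exps (Vec.drop k u)) X Y len))
  values : ∀ (xs : Vec ℚ r) → eval (φpoly r k Q) (Vec.toList xs) ≡ eval R (Vec.toList xs)
  values xs = ≡.subst (λ l → eval (φpoly r k Q) l ≡ eval R l)
    (trans (sym (VecP.toList-++ (Vec.take k xs) (Vec.drop k xs))) (cong Vec.toList (split xs))) (begin
    eval (φpoly r k Q) (X ++ Y)
      ≡⟨ eval-φpoly k m Q X Y lenX ⟩
    cyc (λ ys → eval Q (X ++ ys)) m Y
      ≡⟨ cyc-cong m Y (λ ys → trans (eval-toPoly N r v (X ++ ys)) (∑-cong L (λ i →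
           trans (cong (v i *_) (evM-split (tup N r i) X ys lenX)) (sym (ℚP.*-assoc (v i) (evM (exps (Vec.take k (tup N r i))) X) (evM (exps (Vec.drop k (tup N r i))) ys)))))) ⟩
    cyc (λ ys → ∑ L (λ i → v i * evM (exps (Vec.take k (tup N r i))) X * evM (exps (Vec.drop k (tup N r i))) ys)) m Y
      ≡⟨ cyc-∑ L (λ i ys → v i * evM (exps (Vec.take k (tup N r i))) X * evM (exps (Vec.drop k (tup N r i))) ys) m Y ⟩
    ∑ L (λ i → cyc (λ ys → v i * evM (exps (Vec.take k (tup N r i))) X * evM (exps (Vec.drop k (tup N r i))) ys) m Y)
      ≡⟨ ∑-cong L (λ i → trans (cyc-* (v i * evM (exps (Vec.take k (tup N r i))) X) (evM (exps (Vec.drop k (tup N r i)))) m Y)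
           (trans (ℚP.*-assoc (v i) (evM (exps (Vec.take k (tup N r i))) X) (cyc (evM (exps (Vec.drop k (tup N r i)))) m Y)) (cong (v i *_) (sym (eval-row (tup N r i) (∈-S-odd r N (tup∈S N r i))))))) ⟩
    ∑ L (λ i → v i * eval (row (tup N r i)) (X ++ Y))
      ≡⟨ ∑-cong L (λ i → sym (lin-scale (v i) (row (tup N r i)) _)) ⟩
    ∑ L (λ i → eval (scaleP (v i) (row (tup N r i))) (X ++ Y))
      ≡⟨ lin-sumP L (λ i → scaleP (v i) (row (tup N r i))) _ ⟨
    eval R (X ++ Y) ∎)
    where
    X = Vec.toList (Vec.take k xs)
    Y = Vec.toList (Vec.drop k xs)
    lenX : length X ≡ k
    lenX = length-toList (Vec.take k xs)
    eval-row : ∀ u → (∀ i → Odd3 (Vec.lookup u i)) →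
      eval (row u) (X ++ Y) ≡ evM (exps (Vec.take k u)) X * cyc (evM (exps (Vec.drop k u))) m Y
    eval-row u odd = begin
      eval (row u) (X ++ Y)
        ≡⟨ lin-mapᵉ (exps (Vec.take k u) Vec.++_) (composed (Vec.drop k u)) _ ⟩
      lin (composed (Vec.drop k u)) (λ b → evM (exps (Vec.take k u) Vec.++ b) (X ++ Y))
        ≡⟨ ∑-cong (composed (Vec.drop k u)) (λ t → trans (cong (proj₁ t *_) (evM-++ (exps (Vec.take k u)) (proj₂ t) X Y lenX))
             (*-exchange (proj₁ t) (evM (exps (Vec.take k u)) X) (evM (proj₂ t) Y))) ⟩
      ∑ (composed (Vec.drop k u)) (λ t → evM (exps (Vec.take k u)) X * (proj₁ t * evM (proj₂ t) Y))
        ≡⟨ ∑-*ˡ (composed (Vec.drop k u)) (evM (exps (Vec.take k u)) X) _ ⟨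
      evM (exps (Vec.take k u)) X * eval (composed (Vec.drop k u)) Y
        ≡⟨ cong (evM (exps (Vec.take k u)) X *_) (eval-composed (Vec.drop k u) Y
             (odd-suffix (Vec.take k u) (Vec.drop k u) (oddSplit u odd)) (length-toList (Vec.drop k xs))) ⟩
      evM (exps (Vec.take k u)) X * cyc (evM (exps (Vec.drop k u))) m Y ∎
  entry : ∀ u → (∀ i → Odd3 (Vec.lookup u i)) →
    lin (row u) (λ e′ → ind (e′ ≟V exps u₀)) ≡ EjV r (suc m) u u₀
  entry u odd = begin
    lin (row u) (λ e′ → ind (e′ ≟V exps u₀))
      ≡⟨ lin-mapᵉ (exps p Vec.++_) (composed s) _ ⟩
    lin (composed s) (λ b → ind (exps p Vec.++ b ≟V exps u₀))
      ≡⟨ ∑-cong (composed s) (λ t → trans (cong (proj₁ t *_) (ind-* (p ≟V p₀) (proj₂ t ≟V exps s₀) (exps p Vec.++ proj₂ t ≟V exps u₀)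
           (λ h h′ → trans (cong₂ Vec._++_ (cong exps h) h′) (sym u₀≡))
           (λ h → exps-injective p p₀ (odd-prefix p s (oddSplit u odd)) (odd-prefix p₀ s₀ (oddSplit u₀ odd₀))
             (VecP.++-injectiveˡ (exps p) (exps p₀) (trans h u₀≡)))
           (λ h → VecP.++-injectiveʳ (exps p) (exps p₀) (trans h u₀≡))))
         (*-exchange (proj₁ t) (ind (p ≟V p₀)) (ind (proj₂ t ≟V exps s₀)))) ⟩
    ∑ (composed s) (λ t → ind (p ≟V p₀) * (proj₁ t * ind (proj₂ t ≟V exps s₀)))
      ≡⟨ ∑-*ˡ (composed s) (ind (p ≟V p₀)) _ ⟨
    ind (p ≟V p₀) * lin (composed s) (λ b → ind (b ≟V exps s₀))
      ≡⟨ cong (ind (p ≟V p₀) *_) (coeff-lin (composed s) (exps s₀)) ⟨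
    ind (p ≟V p₀) * coeff (composed s) (exps s₀)
      ≡⟨ EjV-++ p p₀ s s₀ ⟨
    EjV r (suc m) (p Vec.++ s) (p₀ Vec.++ s₀)
      ≡⟨ cong₂ (EjV r (suc m)) (split u) (split u₀) ⟩
    EjV r (suc m) u u₀ ∎
    where
    p = Vec.take k u
    s = Vec.drop k u
    p₀ = Vec.take k u₀
    s₀ = Vec.drop k u₀
    odd₀ = ∈-S-odd r N (tup∈S N r n)
    u₀≡ : exps u₀ ≡ exps p₀ Vec.++ exps s₀
    u₀≡ = trans (cong exps (sym (split u₀))) (exps-++ p₀ s₀)

φ-vecMat : ∀ N r j v n → 1 ≤ j → j ≤ r → φ N r j v n ≡ vecMat N r v (Ej N r j) n
φ-vecMat N r (suc m) v n _ j≤r = go (r ∸ suc m) (ℕP.m∸n+n≡m j≤r) v n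
  where
  go : ∀ k {r} → k ℕ.+ suc m ≡ r → (v : Vect N r) (n : Fin (size N r)) →
    φ N r (suc m) v n ≡ vecMat N r v (Ej N r (suc m)) n
  go k refl v n = trans
    (cong (λ k′ → coeff (φpoly (k ℕ.+ suc m) k′ (toPoly N (k ℕ.+ suc m) v)) (exps (tup N (k ℕ.+ suc m) n))) (ℕP.m+n∸n≡m k (suc m)))
    (φ-vecMat-+ N k m v n)

-- The period equation

evM-pad : ∀ {r} (e : Vec ℕ r) xs → evM e (map (λ x → nth xs (suc x)) (upTo r)) ≡ evM e xs
evM-pad []      xs = refl
evM-pad {suc r} (k ∷ e) [] = cong (pow 0ℚ k *_)
  (trans (cong (evM e) (trans (ListP.map-applyUpTo suc (λ x → nth [] (suc x)) r) (sym (ListP.map-upTo (λ x → nth [] (suc x)) r)))) (evM-pad e []))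
evM-pad {suc r} (k ∷ e) (x ∷ xs) = cong (pow x k *_)
  (trans (cong (evM e) (trans (ListP.map-applyUpTo suc (λ i → nth (x ∷ xs) (suc i)) r) (sym (ListP.map-upTo (λ i → nth xs (suc i)) r)))) (evM-pad e xs))

fval : ∀ N r → (Vec ℕ r → ℚ) → List ℚ → ℚ
fval N r t xs = ∑ (S N r) (λ u → t u * evM (exps u) xs)

fval-even : ∀ N r t x xs → fval N (suc r) t ((- x) ∷ xs) ≡ fval N (suc r) t (x ∷ xs)
fval-even N r t x xs = ∑-cong∈ (S N (suc r)) (λ u u∈ → cong (t u *_) (even u (∈-S-odd (suc r) N u∈)))
  where
  even : ∀ (u : Vec ℕ (suc r)) → (∀ i → Odd3 (Vec.lookup u i)) → evM (exps u) ((- x) ∷ xs) ≡ evM (exps u) (x ∷ xs)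
  even (a ∷ l) odd with a ∸ 1 | odd∸1 (odd Fin.zero)
  ... | _ | h , refl = cong (_* evM (exps l) xs) (pow-neg-even x h)

-- The defining equation of W as an identity of functions of x, y and the remaining variables.
PeriodEq : (List ℚ → ℚ) → Set
PeriodEq f = ∀ x y zs → f (x ∷ y ∷ zs) ≡ f ((y - x) ∷ y ∷ zs) - f ((y - x) ∷ x ∷ zs)

-- Exchanging x and y exchanges the two terms on the right, up to the sign of the first argument,
-- which an even `f` does not see.
period-antisym : ∀ {f : List ℚ → ℚ} → (∀ x xs → f ((- x) ∷ xs) ≡ f (x ∷ xs)) → PeriodEq f →
  ∀ x y zs → f (y ∷ x ∷ zs) ≡ - f (x ∷ y ∷ zs)
period-antisym {f} even eq x y zs = begin
  f (y ∷ x ∷ zs)                                      ≡⟨ eq y x zs ⟩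
  f ((x - y) ∷ x ∷ zs) - f ((x - y) ∷ y ∷ zs)         ≡⟨ cong₂ _-_ (flip x) (flip y) ⟩
  f ((y - x) ∷ x ∷ zs) - f ((y - x) ∷ y ∷ zs)         ≡⟨ neg-diff (f ((y - x) ∷ x ∷ zs)) (f ((y - x) ∷ y ∷ zs)) ⟩
  - (f ((y - x) ∷ y ∷ zs) - f ((y - x) ∷ x ∷ zs))     ≡⟨ cong -_ (eq x y zs) ⟨
  - f (x ∷ y ∷ zs)                                    ∎
  where
  open ≡-Reasoning
  flip : ∀ w → f ((x - y) ∷ w ∷ zs) ≡ f ((y - x) ∷ w ∷ zs)
  flip w = trans (cong (λ z → f (z ∷ w ∷ zs)) (neg-diff x y)) (even (y - x) (w ∷ zs))

module _ (N q : ℕ) where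
  private r = suc (suc q)

  eval-toPoly-extend : ∀ v ys → eval (toPoly N r v) ys ≡ fval N r (extend N r v) ys
  eval-toPoly-extend v ys = trans (eval-toPoly N r v ys) (trans
    (∑-cong (allFin (size N r)) (λ i → cong (_* evM (exps (tup N r i)) ys) (sym (extend-tup N r v i))))
    (∑-tup N r (λ u → extend N r v u * evM (exps u) ys)))

  periodPoly : Poly r → Poly r
  periodPoly P = subst P ((var r 2 -P var r 1) ∷ var r 2 ∷ vars r 3 r) -P subst P ((var r 2 -P var r 1) ∷ var r 1 ∷ vars r 3 r)

  eval-periodPoly : ∀ v x y zs → let f = fval N r (extend N r v) in
    eval (periodPoly (toPoly N r v)) (x ∷ y ∷ zs) ≡ f ((y - x) ∷ y ∷ zs) - f ((y - x) ∷ x ∷ zs)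
  eval-periodPoly v x y zs = trans (lin-- (subst P (pts 2)) (subst P (pts 1)) (λ e → evM e xs))
    (cong₂ _-_ (value 2 (s≤s (s≤s z≤n)) (s≤s z≤n)) (value 1 (s≤s z≤n) (s≤s z≤n)))
    where
    P = toPoly N r v
    xs = x ∷ y ∷ zs
    pts : ℕ → List (Poly r)
    pts k = (var r 2 -P var r 1) ∷ var r k ∷ vars r 3 r
    rest : map (λ q → eval q xs) (vars r 3 r) ≡ map (λ i → nth zs (suc i)) (upTo q)
    rest = trans (eval-vars r xs (between 3 r) bounds) (sym (ListP.map-∘ (upTo q)))
      where
      bounds : ∀ x → x ∈ map (3 ℕ.+_) (upTo q) → 1 ≤ x × x ≤ r
      bounds x x∈ with ∈P.∈-map⁻ (3 ℕ.+_) x∈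
      ... | z , z∈ , refl = s≤s z≤n , s≤s (s≤s (∈P.∈-upTo⁻ z∈))
    value : ∀ k → k ≤ r → 1 ≤ k → eval (subst P (pts k)) xs ≡ fval N r (extend N r v) ((y - x) ∷ nth xs k ∷ zs)
    value k k≤r 1≤k = trans (eval-subst P (pts k) xs) (trans (cong (eval P) (cong₂ _∷_
      (eval-var-diff r 2 1 xs (s≤s (s≤s z≤n)) (s≤s z≤n) (s≤s z≤n) (s≤s z≤n))
      (cong₂ _∷_ (eval-var r k xs k≤r 1≤k) rest))) (trans (eval-toPoly-extend v _)
        (∑-cong (S N r) (λ { (a ∷ b ∷ l) → cong (λ z → extend N r v (a ∷ b ∷ l) * (pow (y - x) (a ∸ 1) * (pow (nth xs k) (b ∸ 1) * z))) (evM-pad (exps l) zs) }))))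

  InW⇒PeriodEq : ∀ v → InW N r v → PeriodEq (fval N r (extend N r v))
  InW⇒PeriodEq v inW x y zs = begin
    fval N r (extend N r v) (x ∷ y ∷ zs)              ≡⟨ eval-toPoly-extend v (x ∷ y ∷ zs) ⟨
    eval (toPoly N r v) (x ∷ y ∷ zs)                  ≡⟨ coeff≡⇒lin≡ (toPoly N r v) (periodPoly (toPoly N r v)) inW (λ e → evM e (x ∷ y ∷ zs)) ⟩
    eval (periodPoly (toPoly N r v)) (x ∷ y ∷ zs)     ≡⟨ eval-periodPoly v x y zs ⟩
    _ ∎ where open ≡-Reasoning

  PeriodEq⇒InW : ∀ v → PeriodEq (fval N r (extend N r v)) → InW N r v
  PeriodEq⇒InW v eq = eval≡⇒coeff≡ (toPoly N r v) (periodPoly (toPoly N r v)) λ { (x ∷ y ∷ zs) →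
    trans (eval-toPoly-extend v _) (trans (eq x y (Vec.toList zs)) (sym (eval-periodPoly v x y (Vec.toList zs)))) }

omit-suc : ∀ n x Y j → omit (suc n) (x ∷ Y) (suc j) ≡ x ∷ omit n Y j
omit-suc n x Y j = cong (x ∷_) (trans
  (cong (λ l → map (λ i → nth (x ∷ Y) (suc i)) (filter (λ i → ¬? (i ℕ.≟ suc j)) l)) (sym (ListP.map-upTo suc n)))
  (trans (cong (map (λ i → nth (x ∷ Y) (suc i))) (filter-≢-map suc ℕP.suc-injective j (upTo n)))
    (sym (ListP.map-∘ (filter (λ i → ¬? (i ℕ.≟ j)) (upTo n))))))

omit-zero : ∀ x Y → omit (suc (length Y)) (x ∷ Y) 0 ≡ Y
omit-zero x Y = trans
  (cong (λ l → map (λ i → nth (x ∷ Y) (suc i)) (filter (λ i → ¬? (i ℕ.≟ 0)) l)) (sym (ListP.map-upTo suc n)))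
  (trans (cong (map (λ i → nth (x ∷ Y) (suc i))) (none (upTo n)))
    (trans (sym (ListP.map-∘ (upTo n))) (trans
      (ListP.map-cong (λ i → cong (λ l → nth l (suc i)) (sym (ListP.++-identityʳ Y))) (upTo n)) (nth-prefix Y []))))
  where
  n = length Y
  none : ∀ xs → filter (λ i → ¬? (i ℕ.≟ 0)) (map suc xs) ≡ map suc xs
  none []       = refl
  none (z ∷ xs) = cong (suc z ∷_) (none xs)

-- On W the summands of φ⁽ʳ⁾ are those of φ⁽ʳ⁻¹⁾ with the opposite sign, except for the first
-- one, which is −f by the period equation.
cyc-cancel : ∀ {f} → (∀ x y zs → f (y ∷ x ∷ zs) ≡ - f (x ∷ y ∷ zs)) → PeriodEq f →
  ∀ x y Z → let m = length Z in
  cyc (λ ys → f (x ∷ ys)) m (y ∷ Z) + cyc f (suc m) (x ∷ y ∷ Z) ≡ f (x ∷ y ∷ Z)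
cyc-cancel {f} anti eq x y Z = begin
  (f Y + A) + (f Y + (step f (suc m) Y 0 + ∑ (List.applyUpTo suc m) (step f (suc m) Y)))
    ≡⟨ cong₂ (λ p q → (f Y + A) + (f Y + (p + q))) first (begin
      ∑ (List.applyUpTo suc m) (step f (suc m) Y)     ≡⟨ cong (λ l → ∑ l (step f (suc m) Y)) (ListP.map-upTo suc m) ⟨
      ∑ (map suc (upTo m)) (step f (suc m) Y)         ≡⟨ ∑-map suc (upTo m) (step f (suc m) Y) ⟩
      ∑ (upTo m) (λ i → step f (suc m) Y (suc i))     ≡⟨ ∑-cong (upTo m) later ⟩
      ∑ (upTo m) (λ i → - step g m (y ∷ Z) i)         ≡⟨ ∑-neg (upTo m) (step g m (y ∷ Z)) ⟩
      - A                                             ∎) ⟩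
  (f Y + A) + (f Y + ((- f Y) + (- A)))
    ≡⟨ lem (f Y) A ⟩
  f Y ∎
  where
  open ≡-Reasoning
  m = length Z
  Y = x ∷ y ∷ Z
  g : List ℚ → ℚ
  g ys = f (x ∷ ys)
  A = ∑ (upTo m) (step g m (y ∷ Z))
  lem : ∀ a b → (a + b) + (a + ((- a) + (- b))) ≡ a
  lem = solve-∀ ℚ-ring
  neg-neg-diff : ∀ a b → (- a) - (- b) ≡ - (a - b)
  neg-neg-diff = solve-∀ ℚ-ring
  first : step f (suc m) Y 0 ≡ - f Y
  first = trans (cong₂ (λ p q → f ((y - x) ∷ p) - f ((y - x) ∷ q))
      (trans (omit-suc (suc m) x (y ∷ Z) 0) (cong (x ∷_) (omit-zero y Z))) (omit-zero x (y ∷ Z)))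
    (trans (neg-diff (f ((y - x) ∷ x ∷ Z)) (f ((y - x) ∷ y ∷ Z))) (cong -_ (sym (eq x y Z))))
  later : ∀ i → step f (suc m) Y (suc i) ≡ - step g m (y ∷ Z) i
  later i = trans (cong₂ (λ p q → f (d ∷ p) - f (d ∷ q)) (omit-suc (suc m) x (y ∷ Z) (suc i)) (omit-suc (suc m) x (y ∷ Z) i))
    (trans (cong₂ _-_ (anti x d (omit (suc m) (y ∷ Z) (suc i))) (anti x d (omit (suc m) (y ∷ Z) i)))
      (neg-neg-diff (f (x ∷ d ∷ omit (suc m) (y ∷ Z) (suc i))) (f (x ∷ d ∷ omit (suc m) (y ∷ Z) i))))
    where d = nth (y ∷ Z) (suc (suc i)) - nth (y ∷ Z) (suc i)

coeff-+ : ∀ {r} (p q : Poly r) e → coeff (p +P q) e ≡ coeff p e + coeff q e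
coeff-+ p q e = trans (coeff-lin (p +P q) e) (trans (lin-+ p q _) (sym (cong₂ _+_ (coeff-lin p e) (coeff-lin q e))))

coeff-toPoly : ∀ N r v n → coeff (toPoly N r v) (exps (tup N r n)) ≡ v n
coeff-toPoly N r v n = begin
  coeff (toPoly N r v) (exps (tup N r n))
    ≡⟨ coeff-lin (toPoly N r v) (exps (tup N r n)) ⟩
  lin (toPoly N r v) (λ e′ → ind (e′ ≟V exps (tup N r n)))
    ≡⟨ ∑-map (λ i → v i , exps (tup N r i)) (allFin (size N r)) _ ⟩
  ∑ (allFin (size N r)) (λ i → v i * ind (exps (tup N r i) ≟V exps (tup N r n)))
    ≡⟨ ∑-cong (allFin (size N r)) (λ i → cong (v i *_) (ind-⇔ (exps (tup N r i) ≟V exps (tup N r n)) (i Fin.≟ n)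
         (λ h → lookup-injective (Unique-S N r) i n (exps-injective _ _ (∈-S-odd r N (tup∈S N r i)) (∈-S-odd r N (tup∈S N r n)) h))
         (λ { refl → refl }))) ⟩
  ∑ (allFin (size N r)) (λ i → v i * ind (i Fin.≟ n))
    ≡⟨ ∑-δʳ Fin._≟_ (UniqueP.allFin⁺ (size N r)) v (∈P.∈-allFin n) ⟩
  v n ∎ where open ≡-Reasoning

φ-cancel : ∀ N m (v : Vect N (suc (suc m))) → InW N (suc (suc m)) v → ∀ n →
  φ N (suc (suc m)) (suc m) v n + φ N (suc (suc m)) (suc (suc m)) v n ≡ v n
φ-cancel N m v inW n = begin
  φ N r (suc m) v n + φ N r r v n
    ≡⟨ cong₂ _+_ (cong (λ k → coeff (φpoly r k Q) (exps (tup N r n))) (ℕP.m+n∸n≡m 1 (suc m)))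
                 (cong (λ k → coeff (φpoly r k Q) (exps (tup N r n))) (ℕP.n∸n≡0 r)) ⟩
  coeff (φpoly r 1 Q) (exps (tup N r n)) + coeff (φpoly r 0 Q) (exps (tup N r n))
    ≡⟨ coeff-+ (φpoly r 1 Q) (φpoly r 0 Q) (exps (tup N r n)) ⟨
  coeff (φpoly r 1 Q +P φpoly r 0 Q) (exps (tup N r n))
    ≡⟨ eval≡⇒coeff≡ (φpoly r 1 Q +P φpoly r 0 Q) Q values (exps (tup N r n)) ⟩
  coeff Q (exps (tup N r n))
    ≡⟨ coeff-toPoly N r v n ⟩
  v n ∎
  where
  open ≡-Reasoning
  r = suc (suc m)
  Q = toPoly N r v
  f = fval N r (extend N r v)
  period = InW⇒PeriodEq N m v inW
  values : ∀ (xs : Vec ℚ r) → eval (φpoly r 1 Q +P φpoly r 0 Q) (Vec.toList xs) ≡ eval Q (Vec.toList xs)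
  values (x ∷ y ∷ zs) = trans (lin-+ (φpoly r 1 Q) (φpoly r 0 Q) (λ e → evM e (x ∷ y ∷ Z))) (trans
    (cong₂ _+_ (trans (eval-φpoly 1 m Q (x ∷ []) (y ∷ Z) refl) (cyc-cong m (y ∷ Z) (λ ys → eval-toPoly-extend N m v (x ∷ ys))))
               (trans (eval-φpoly 0 (suc m) Q [] (x ∷ y ∷ Z) refl) (cyc-cong (suc m) (x ∷ y ∷ Z) (eval-toPoly-extend N m v))))
    (trans (≡.subst (λ k → cyc (λ ys → f (x ∷ ys)) k (y ∷ Z) + cyc f (suc k) (x ∷ y ∷ Z) ≡ f (x ∷ y ∷ Z)) (length-toList zs)
        (cyc-cancel {f} (period-antisym {f} (fval-even N (suc m) (extend N r v)) period) period x y Z))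
      (sym (eval-toPoly-extend N m v (x ∷ y ∷ Z)))))
    where Z = Vec.toList zs

vecMat-E : ∀ N r v n → vecMat N r v (E N r) n ≡ vecMat N r v (Ej N r r) n
vecMat-E N r v n = ∑-cong (allFin (size N r)) (λ i → cong (v i *_) (sym (same (Vec.toList (tup N r i)) (Vec.toList (tup N r n)))))
  where
  same : ∀ ms ns → (if ⌊ ListP.≡-dec ℕ._≟_ (List.take (r ∸ r) ms) (List.take (r ∸ r) ns) ⌋
    then e (List.drop (r ∸ r) ms) (List.drop (r ∸ r) ns) else 0ℚ) ≡ e ms ns
  same ms ns rewrite ℕP.n∸n≡0 r = refl

-- `φ-cancel` says φ⁽ʳ⁻¹⁾ + φ⁽ʳ⁾ = id on W. As E is the matrix of φ⁽ʳ⁾, subtracting the identity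
-- from it leaves -φ⁽ʳ⁻¹⁾.
vecMat-F : ∀ N m (v : Vect N (suc (suc m))) → InW N (suc (suc m)) v → ∀ n →
  vecMat N (suc (suc m)) v (F N (suc (suc m))) n ≡ - vecMat N (suc (suc m)) v (Ej N (suc (suc m)) (suc m)) n
vecMat-F N m v inW n = begin
  vecMat N r v (F N r) n
    ≡⟨ ∑-cong L (λ i → *-distribˡ-- (v i) (E N r i n) (ind (i Fin.≟ n))) ⟩
  ∑ L (λ i → v i * E N r i n - v i * ind (i Fin.≟ n))
    ≡⟨ ∑-- L (λ i → v i * E N r i n) (λ i → v i * ind (i Fin.≟ n)) ⟩
  vecMat N r v (E N r) n - ∑ L (λ i → v i * ind (i Fin.≟ n))
    ≡⟨ cong₂ _-_ (trans (vecMat-E N r v n) (sym (φ-vecMat N r r v n (s≤s z≤n) ℕP.≤-refl)))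
         (∑-δʳ Fin._≟_ (UniqueP.allFin⁺ (size N r)) v (∈P.∈-allFin n)) ⟩
  φ N r r v n - v n
    ≡⟨ cong (λ z → φ N r r v n - z) (φ-cancel N m v inW n) ⟨
  φ N r r v n - (φ N r (suc m) v n + φ N r r v n)
    ≡⟨ lem₂ (φ N r r v n) (φ N r (suc m) v n) ⟩
  - φ N r (suc m) v n
    ≡⟨ cong -_ (φ-vecMat N r (suc m) v n (s≤s z≤n) (ℕP.n≤1+n (suc m))) ⟩
  - vecMat N r v (Ej N r (suc m)) n ∎
  where
  open ≡-Reasoning
  r = suc (suc m)
  L = allFin (size N r)
  lem₂ : ∀ a b → a - (b + a) ≡ - b
  lem₂ = solve-∀ ℚ-ring

zero-InW : ∀ N m → InW N (suc (suc m)) (zeroV N (suc (suc m)))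
zero-InW N m = PeriodEq⇒InW N m (zeroV N r) (λ x y zs → trans (vanish (x ∷ y ∷ zs))
    (sym (cong₂ _-_ (vanish ((y - x) ∷ y ∷ zs)) (vanish ((y - x) ∷ x ∷ zs)))))
  where
  r = suc (suc m)
  vanish : ∀ xs → fval N r (extend N r (zeroV N r)) xs ≡ 0ℚ
  vanish xs = ∑-zero∈ (S N r) (λ u _ → trans (cong (_* evM (exps u) xs)
    (∑-zero∈ (allFin (size N r)) (λ i _ → ℚP.*-zeroʳ (ind (tup N r i ≟V u))))) (ℚP.*-zeroˡ (evM (exps u) xs)))

Ej-injective-on-W : HypA → ∀ N m → 0 < N → (v : Vect N (suc (suc m))) → InW N (suc (suc m)) v →
  Eq N (suc (suc m)) (vecMat N (suc (suc m)) v (Ej N (suc (suc m)) (suc m))) (zeroV N (suc (suc m))) →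
  Eq N (suc (suc m)) v (zeroV N (suc (suc m)))
Ej-injective-on-W hypA N m 0<N v inW vE≡0 = hypA r N (s≤s (s≤s z≤n)) 0<N v (zeroV N r) inW (zero-InW N m) λ n →
  trans (vecMat-F N m v inW n) (trans (cong -_ (vE≡0 n))
    (sym (∑-zero∈ (allFin (size N r)) (λ i _ → ℚP.*-zeroˡ (F N r i n)))))
  where r = suc (suc m)

-- Block diagonal and tensor product matrices

∑-upTo-cong : ∀ n {f g : ℕ → ℚ} → (∀ i → i < n → f i ≡ g i) → ∑ (upTo n) f ≡ ∑ (upTo n) g
∑-upTo-cong n h = ∑-cong∈ (upTo n) (λ i i∈ → h i (∈P.∈-upTo⁻ i∈))

∑-triangle : ∀ N (g : ℕ → ℕ → ℚ) →
  ∑ (upTo (suc N)) (λ a → ∑ (upTo (suc (N ∸ a))) (g a)) ≡ ∑ (upTo (suc N)) (λ M → ∑ (upTo (suc M)) (λ a → g a (M ∸ a)))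
∑-triangle zero    g = refl
∑-triangle (suc N) g = begin
  ∑ (upTo (suc (suc N))) (λ a → ∑ (upTo (suc (suc N ∸ a))) (g a))
    ≡⟨ ∑-upTo-suc (suc N) (λ a → ∑ (upTo (suc (suc N ∸ a))) (g a)) ⟩
  ∑ (upTo (suc N)) (λ a → ∑ (upTo (suc (suc N ∸ a))) (g a)) + ∑ (upTo (suc (N ∸ N))) (g (suc N))
    ≡⟨ cong₂ _+_ (∑-upTo-cong (suc N) (λ a a≤N → trans (cong (λ k → ∑ (upTo (suc k)) (g a)) (ℕP.+-∸-assoc 1 (ℕP.≤-pred a≤N)))
         (trans (∑-upTo-suc (suc (N ∸ a)) (g a)) (cong (λ k → ∑ (upTo (suc (N ∸ a))) (g a) + g a k) (sym (ℕP.+-∸-assoc 1 (ℕP.≤-pred a≤N)))))))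
         (trans (cong (λ k → ∑ (upTo (suc k)) (g (suc N))) (ℕP.n∸n≡0 N)) (ℚP.+-identityʳ (g (suc N) 0))) ⟩
  ∑ (upTo (suc N)) (λ a → ∑ (upTo (suc (N ∸ a))) (g a) + g a (suc N ∸ a)) + g (suc N) 0
    ≡⟨ cong (_+ g (suc N) 0) (∑-+ (upTo (suc N)) (λ a → ∑ (upTo (suc (N ∸ a))) (g a)) (λ a → g a (suc N ∸ a))) ⟩
  ∑ (upTo (suc N)) (λ a → ∑ (upTo (suc (N ∸ a))) (g a)) + ∑ (upTo (suc N)) (λ a → g a (suc N ∸ a)) + g (suc N) 0
    ≡⟨ trans (ℚP.+-assoc (∑ (upTo (suc N)) (λ a → ∑ (upTo (suc (N ∸ a))) (g a))) _ _) (cong₂ _+_ (∑-triangle N g)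
         (cong (λ k → ∑ (upTo (suc N)) (λ a → g a (suc N ∸ a)) + g (suc N) k) (sym (ℕP.n∸n≡0 N)))) ⟩
  ∑ (upTo (suc N)) (λ M → ∑ (upTo (suc M)) (λ a → g a (M ∸ a))) + (∑ (upTo (suc N)) (λ a → g a (suc N ∸ a)) + g (suc N) (N ∸ N))
    ≡⟨ cong (∑ (upTo (suc N)) (λ M → ∑ (upTo (suc M)) (λ a → g a (M ∸ a))) +_) (∑-upTo-suc (suc N) (λ a → g a (suc N ∸ a))) ⟨
  ∑ (upTo (suc N)) (λ M → ∑ (upTo (suc M)) (λ a → g a (M ∸ a))) + ∑ (upTo (suc (suc N))) (λ a → g a (suc N ∸ a))
    ≡⟨ ∑-upTo-suc (suc N) (λ M → ∑ (upTo (suc M)) (λ a → g a (M ∸ a))) ⟨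
  ∑ (upTo (suc (suc N))) (λ M → ∑ (upTo (suc M)) (λ a → g a (M ∸ a))) ∎
  where open ≡-Reasoning

o : ℕ → ℚ
o a = ind (odd3? a)

∑-S₁ : ∀ K (G : Vec ℕ 1 → ℚ) → ∑ (S K 1) G ≡ o K * G (K ∷ [])
∑-S₁ K G = begin
  ∑ (S K 1) G
    ≡⟨ ∑-S K 0 G ⟩
  ∑ (oddsDown K) (λ b → ∑ (S (K ∸ b) 0) (λ l → G (b ∷ l)))
    ≡⟨ ∑-oddsDown K (λ b → ∑ (S (K ∸ b) 0) (λ l → G (b ∷ l))) ⟩
  ∑ (upTo (suc K)) (λ b → o b * ∑ (S (K ∸ b) 0) (λ l → G (b ∷ l)))
    ≡⟨ ∑-upTo-suc K (λ b → o b * ∑ (S (K ∸ b) 0) (λ l → G (b ∷ l))) ⟩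
  ∑ (upTo K) (λ b → o b * ∑ (S (K ∸ b) 0) (λ l → G (b ∷ l))) + o K * ∑ (S (K ∸ K) 0) (λ l → G (K ∷ l))
    ≡⟨ cong₂ _+_ (∑-zero∈ (upTo K) (λ b b∈ → trans (cong (o b *_) (empty b (∈P.∈-upTo⁻ b∈))) (ℚP.*-zeroʳ (o b))))
         (cong (o K *_) (trans (cong (λ z → ∑ (S z 0) (λ l → G (K ∷ l))) (ℕP.n∸n≡0 K)) (ℚP.+-identityʳ (G (K ∷ []))))) ⟩
  0ℚ + o K * G (K ∷ [])
    ≡⟨ ℚP.+-identityˡ (o K * G (K ∷ [])) ⟩
  o K * G (K ∷ []) ∎
  where
  open ≡-Reasoning
  empty : ∀ b → b < K → ∑ (S (K ∸ b) 0) (λ l → G (b ∷ l)) ≡ 0ℚ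
  empty b b<K with K ∸ b | ℕP.m<n⇒0<n∸m b<K
  ... | suc _ | _ = refl

∑-S₂ : ∀ M (G : Vec ℕ 2 → ℚ) → ∑ (S M 2) G ≡ ∑ (upTo (suc M)) (λ a → o a * (o (M ∸ a) * G (a ∷ (M ∸ a) ∷ [])))
∑-S₂ M G = trans (∑-S M 1 G) (trans (∑-oddsDown M (λ a → ∑ (S (M ∸ a) 1) (λ l → G (a ∷ l))))
  (∑-cong (upTo (suc M)) (λ a → cong (o a *_) (∑-S₁ (M ∸ a) (λ l → G (a ∷ l))))))

-- Sorting tuples by the sum M of their first two entries is the decomposition of V_{N,q+2} into the
-- spaces V_{M,2} ⊗ V_{N-M,q}, seen on bases.
∑-split-S : ∀ N q (f : Vec ℕ (2 ℕ.+ q) → ℚ) →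
  ∑ (S N (2 ℕ.+ q)) f ≡ ∑ (upTo (suc N)) (λ M → ∑ (S M 2) (λ w → ∑ (S (N ∸ M) q) (λ l → f (w Vec.++ l))))
∑-split-S N q f = begin
  ∑ (S N (2 ℕ.+ q)) f
    ≡⟨ trans (∑-S N (suc q) f) (∑-oddsDown N (λ a → ∑ (S (N ∸ a) (suc q)) (λ l → f (a ∷ l)))) ⟩
  ∑ (upTo (suc N)) (λ a → o a * ∑ (S (N ∸ a) (suc q)) (λ l → f (a ∷ l)))
    ≡⟨ ∑-cong (upTo (suc N)) (λ a → trans (cong (o a *_) (trans (∑-S (N ∸ a) q (λ l → f (a ∷ l))) (∑-oddsDown (N ∸ a) (λ b → ∑ (S (N ∸ a ∸ b) q) (λ l → f (a ∷ b ∷ l))))))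
         (∑-*ˡ (upTo (suc (N ∸ a))) (o a) (λ b → o b * ∑ (S (N ∸ a ∸ b) q) (λ l → f (a ∷ b ∷ l))))) ⟩
  ∑ (upTo (suc N)) (λ a → ∑ (upTo (suc (N ∸ a))) (λ b → o a * (o b * ∑ (S (N ∸ a ∸ b) q) (λ l → f (a ∷ b ∷ l)))))
    ≡⟨ ∑-triangle N (λ a b → o a * (o b * ∑ (S (N ∸ a ∸ b) q) (λ l → f (a ∷ b ∷ l)))) ⟩
  ∑ (upTo (suc N)) (λ M → ∑ (upTo (suc M)) (λ a → o a * (o (M ∸ a) * ∑ (S (N ∸ a ∸ (M ∸ a)) q) (λ l → f (a ∷ (M ∸ a) ∷ l)))))
    ≡⟨ ∑-cong (upTo (suc N)) (λ M → trans (∑-upTo-cong (suc M) (λ a a≤M → cong (λ k → o a * (o (M ∸ a) * ∑ (S k q) (λ l → f (a ∷ (M ∸ a) ∷ l))))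
         (trans (ℕP.∸-+-assoc N a (M ∸ a)) (cong (N ∸_) (ℕP.m+[n∸m]≡n (ℕP.≤-pred a≤M))))))
         (sym (∑-S₂ M (λ w → ∑ (S (N ∸ M) q) (λ l → f (w Vec.++ l)))))) ⟩
  ∑ (upTo (suc N)) (λ M → ∑ (S M 2) (λ w → ∑ (S (N ∸ M) q) (λ l → f (w Vec.++ l)))) ∎
  where open ≡-Reasoning

∈-S-+ : ∀ N {q a b} {l : Vec ℕ q} → a ∷ b ∷ l ∈ S N (2 ℕ.+ q) → a ℕ.+ b ≤ N × a ∷ b ∷ [] ∈ S (a ℕ.+ b) 2 × l ∈ S (N ∸ (a ℕ.+ b)) q
∈-S-+ N {q} {a} {b} {l} u∈ with ∈-S⁻ N u∈
... | odda , a≤N , bl∈ with ∈-S⁻ (N ∸ a) bl∈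
...   | oddb , b≤ , l∈ =
  ≡.subst (a ℕ.+ b ≤_) (ℕP.m+[n∸m]≡n a≤N) (ℕP.+-monoʳ-≤ a b≤) ,
  ∈-S⁺ (a ℕ.+ b) odda (ℕP.m≤m+n a b) (≡.subst (λ k → b ∷ [] ∈ S k 1) (sym (ℕP.m+n∸m≡n a b))
    (∈-S⁺ b oddb ℕP.≤-refl (≡.subst (λ k → [] ∈ S k 0) (sym (ℕP.n∸n≡0 b)) (here refl)))) ,
  ≡.subst (λ k → l ∈ S k q) (ℕP.∸-+-assoc N a b) l∈

-- Matrices on S_{N,q} for all N simultaneously.
Graded : ℕ → Set
Graded q = ℕ → Vec ℕ q → Vec ℕ q → ℚ

infixl 7 _⊙_
_⊙_ : ∀ {q} → Graded q → Graded q → Graded q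
(_⊙_ {q} A B) N = A N ⟨ S N q ⟩ B N

infix 4 _≐_
_≐_ : ∀ {q} → Graded q → Graded q → Set
_≐_ {q} A B = ∀ N u v → u ∈ S N q → v ∈ S N q → A N u v ≡ B N u v

δᴳ : ∀ {q} → Graded q
δᴳ N u v = ind (u ≟V v)

trᴳ : ∀ {q} → Graded q → ℕ → ℚ
trᴳ {q} A N = ∑ (S N q) (λ u → A N u u)

blk : ∀ {q} → Graded q → Graded (suc q)
blk A N (a ∷ l) (b ∷ l′) = ind (a ℕ.≟ b) * A (N ∸ a) l l′

-- `A M` is meaningful on `S M 2` only; the indicator makes the entries between tuples with
-- different sums of the first two entries 0.
tensor : ∀ {q} → Graded 2 → Graded q → Graded (2 ℕ.+ q)
tensor A B N (a ∷ b ∷ l) (c ∷ d ∷ l′) =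
  ind (a ℕ.+ b ℕ.≟ c ℕ.+ d) * (A (a ℕ.+ b) (a ∷ b ∷ []) (c ∷ d ∷ []) * B (N ∸ (a ℕ.+ b)) l l′)

blk-⊙ : ∀ {q} (A B : Graded q) → (blk A ⊙ blk B) ≐ blk (A ⊙ B)
blk-⊙ {q} A B N (a ∷ l) (c ∷ l″) u∈ _ = begin
  ∑ (S N (suc q)) (λ w → blk A N (a ∷ l) w * blk B N w (c ∷ l″))
    ≡⟨ ∑-S N q _ ⟩
  ∑ (oddsDown N) (λ b → ∑ (S (N ∸ b) q) (λ l′ → ind (a ℕ.≟ b) * A (N ∸ a) l l′ * (ind (b ℕ.≟ c) * B (N ∸ b) l′ l″)))
    ≡⟨ ∑-cong (oddsDown N) (λ b → trans (∑-cong (S (N ∸ b) q) (λ l′ → lem (ind (a ℕ.≟ b)) (A (N ∸ a) l l′) (ind (b ℕ.≟ c)) (B (N ∸ b) l′ l″)))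
         (sym (∑-*ˡ (S (N ∸ b) q) (ind (a ℕ.≟ b)) _))) ⟩
  ∑ (oddsDown N) (λ b → ind (a ℕ.≟ b) * ∑ (S (N ∸ b) q) (λ l′ → ind (b ℕ.≟ c) * (A (N ∸ a) l l′ * B (N ∸ b) l′ l″)))
    ≡⟨ ∑-δ ℕ._≟_ (Unique-oddsDown N) (λ b → ∑ (S (N ∸ b) q) (λ l′ → ind (b ℕ.≟ c) * (A (N ∸ a) l l′ * B (N ∸ b) l′ l″)))
         (∈-oddsDown⁺ N (proj₁ (∈-S⁻ N u∈)) (proj₁ (proj₂ (∈-S⁻ N u∈)))) ⟩
  ∑ (S (N ∸ a) q) (λ l′ → ind (a ℕ.≟ c) * (A (N ∸ a) l l′ * B (N ∸ a) l′ l″))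
    ≡⟨ ∑-*ˡ (S (N ∸ a) q) (ind (a ℕ.≟ c)) _ ⟨
  ind (a ℕ.≟ c) * (A ⊙ B) (N ∸ a) l l″ ∎
  where
  open ≡-Reasoning
  lem : ∀ i x j y → i * x * (j * y) ≡ i * (j * (x * y))
  lem = solve-∀ ℚ-ring

ind-refl : {I : Set} {i : I} (d : Dec (i ≡ i)) → ind d ≡ 1ℚ
ind-refl d = ind-yes d refl

trᴳ-blk : ∀ {q} (A : Graded q) N → trᴳ (blk A) N ≡ ∑ (oddsDown N) (λ a → trᴳ A (N ∸ a))
trᴳ-blk {q} A N = trans (∑-S N q _) (∑-cong (oddsDown N) (λ a → ∑-cong (S (N ∸ a) q) (λ l →
  trans (cong (_* A (N ∸ a) l l) (ind-refl (a ℕ.≟ a))) (ℚP.*-identityˡ (A (N ∸ a) l l)))))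

0*-cong : ∀ x y → 0ℚ * x ≡ 0ℚ * y
0*-cong x y = trans (ℚP.*-zeroˡ x) (sym (ℚP.*-zeroˡ y))

blk-cong : ∀ {q} {A B : Graded q} → A ≐ B → blk A ≐ blk B
blk-cong {A = A} {B} h N (a ∷ l) (b ∷ l′) u∈ v∈ with a ℕ.≟ b
... | yes refl = cong (1ℚ *_) (h (N ∸ a) l l′ (proj₂ (proj₂ (∈-S⁻ N u∈))) (proj₂ (proj₂ (∈-S⁻ N v∈))))
... | no _     = 0*-cong (A (N ∸ a) l l′) (B (N ∸ a) l l′)

tensor-⊙ : ∀ {q} (A A′ : Graded 2) (B B′ : Graded q) → (tensor A B ⊙ tensor A′ B′) ≐ tensor (A ⊙ A′) (B ⊙ B′)
tensor-⊙ {q} A A′ B B′ N (a ∷ b ∷ l) (c ∷ d ∷ l″) u∈ _ = begin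
  ∑ (S N (2 ℕ.+ q)) (λ w → tensor A B N (a ∷ b ∷ l) w * tensor A′ B′ N w (c ∷ d ∷ l″))
    ≡⟨ ∑-split-S N q _ ⟩
  ∑ (upTo (suc N)) (λ M → ∑ (S M 2) (λ w → ∑ (S (N ∸ M) q) (λ l′ → tensor A B N (a ∷ b ∷ l) (w Vec.++ l′) * tensor A′ B′ N (w Vec.++ l′) (c ∷ d ∷ l″))))
    ≡⟨ ∑-cong (upTo (suc N)) (λ M → trans (∑-cong∈ (S M 2) (λ w w∈ → inner M w (∈-S-sum 2 M w∈)))
         (trans (sym (∑-*ˡ (S M 2) (ind (s ℕ.≟ M)) _)) (cong (ind (s ℕ.≟ M) *_) (trans (sym (∑-*ˡ (S M 2) (ind (M ℕ.≟ t)) _))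
           (cong (ind (M ℕ.≟ t) *_) (sym (∑-*ʳ (S M 2) (∑ (S (N ∸ M) q) (λ l′ → B (N ∸ s) l l′ * B′ (N ∸ M) l′ l″)) _))))))) ⟩
  ∑ (upTo (suc N)) (λ M → ind (s ℕ.≟ M) * (ind (M ℕ.≟ t) *
      (∑ (S M 2) (λ w → A s ab w * A′ M w cd) * ∑ (S (N ∸ M) q) (λ l′ → B (N ∸ s) l l′ * B′ (N ∸ M) l′ l″))))
    ≡⟨ ∑-δ ℕ._≟_ (UniqueP.upTo⁺ (suc N)) (λ M → ind (M ℕ.≟ t) *
         (∑ (S M 2) (λ w → A s ab w * A′ M w cd) * ∑ (S (N ∸ M) q) (λ l′ → B (N ∸ s) l l′ * B′ (N ∸ M) l′ l″)))
         (∈P.∈-upTo⁺ (s≤s (proj₁ (∈-S-+ N u∈)))) ⟩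
  ind (s ℕ.≟ t) * ((A ⊙ A′) s ab cd * (B ⊙ B′) (N ∸ s) l l″) ∎
  where
  open ≡-Reasoning
  s = a ℕ.+ b
  t = c ℕ.+ d
  ab = a ∷ b ∷ []
  cd = c ∷ d ∷ []
  lem : ∀ i x y j x′ y′ → i * (x * y) * (j * (x′ * y′)) ≡ i * (j * (x * x′)) * (y * y′)
  lem = solve-∀ ℚ-ring
  lem′ : ∀ i j x z → i * (j * x) * z ≡ i * (j * (x * z))
  lem′ = solve-∀ ℚ-ring
  inner : ∀ M (w : Vec ℕ 2) → Vec.sum w ≡ M →
    ∑ (S (N ∸ M) q) (λ l′ → tensor A B N (a ∷ b ∷ l) (w Vec.++ l′) * tensor A′ B′ N (w Vec.++ l′) (c ∷ d ∷ l″))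
      ≡ ind (s ℕ.≟ M) * (ind (M ℕ.≟ t) * (A s ab w * A′ M w cd * ∑ (S (N ∸ M) q) (λ l′ → B (N ∸ s) l l′ * B′ (N ∸ M) l′ l″)))
  inner _ (x ∷ y ∷ []) refl rewrite ℕP.+-identityʳ y = trans
    (∑-cong (S (N ∸ (x ℕ.+ y)) q) (λ l′ → lem (ind (s ℕ.≟ x ℕ.+ y)) (A s ab (x ∷ y ∷ [])) (B (N ∸ s) l l′) (ind (x ℕ.+ y ℕ.≟ t)) (A′ (x ℕ.+ y) (x ∷ y ∷ []) cd) (B′ (N ∸ (x ℕ.+ y)) l′ l″)))
    (trans (sym (∑-*ˡ (S (N ∸ (x ℕ.+ y)) q) (ind (s ℕ.≟ x ℕ.+ y) * (ind (x ℕ.+ y ℕ.≟ t) * (A s ab (x ∷ y ∷ []) * A′ (x ℕ.+ y) (x ∷ y ∷ []) cd))) (λ l′ → B (N ∸ s) l l′ * B′ (N ∸ (x ℕ.+ y)) l′ l″)))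
      (lem′ (ind (s ℕ.≟ x ℕ.+ y)) (ind (x ℕ.+ y ℕ.≟ t)) (A s ab (x ∷ y ∷ []) * A′ (x ℕ.+ y) (x ∷ y ∷ []) cd) (∑ (S (N ∸ (x ℕ.+ y)) q) (λ l′ → B (N ∸ s) l l′ * B′ (N ∸ (x ℕ.+ y)) l′ l″))))

trᴳ-tensor : ∀ {q} (A : Graded 2) (B : Graded q) N → trᴳ (tensor A B) N ≡ ∑ (upTo (suc N)) (λ M → trᴳ A M * trᴳ B (N ∸ M))
trᴳ-tensor {q} A B N = trans (∑-split-S N q _) (∑-cong (upTo (suc N)) (λ M →
  trans (∑-cong∈ (S M 2) (λ w w∈ → inner M w (∈-S-sum 2 M w∈))) (sym (∑-*ʳ (S M 2) (trᴳ B (N ∸ M)) (λ w → A M w w)))))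
  where
  inner : ∀ M (w : Vec ℕ 2) → Vec.sum w ≡ M →
    ∑ (S (N ∸ M) q) (λ l → tensor A B N (w Vec.++ l) (w Vec.++ l)) ≡ A M w w * trᴳ B (N ∸ M)
  inner _ (x ∷ y ∷ []) refl rewrite ℕP.+-identityʳ y = trans
    (∑-cong (S (N ∸ (x ℕ.+ y)) q) (λ l → trans (cong (_* (A (x ℕ.+ y) (x ∷ y ∷ []) (x ∷ y ∷ []) * B (N ∸ (x ℕ.+ y)) l l)) (ind-refl (x ℕ.+ y ℕ.≟ x ℕ.+ y)))
      (ℚP.*-identityˡ (A (x ℕ.+ y) (x ∷ y ∷ []) (x ∷ y ∷ []) * B (N ∸ (x ℕ.+ y)) l l))))
    (sym (∑-*ˡ (S (N ∸ (x ℕ.+ y)) q) (A (x ℕ.+ y) (x ∷ y ∷ []) (x ∷ y ∷ [])) (λ l → B (N ∸ (x ℕ.+ y)) l l)))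

tensor-cong : ∀ {q} {A A′ : Graded 2} {B B′ : Graded q} → A ≐ A′ → B ≐ B′ → tensor A B ≐ tensor A′ B′
tensor-cong {A = A} {A′} {B} {B′} h h′ N (a ∷ b ∷ l) (c ∷ d ∷ l′) u∈ v∈ with a ℕ.+ b ℕ.≟ c ℕ.+ d | ∈-S-+ N u∈ | ∈-S-+ N v∈
... | no _  | _ | _ = 0*-cong (A (a ℕ.+ b) (a ∷ b ∷ []) (c ∷ d ∷ []) * B (N ∸ (a ℕ.+ b)) l l′) (A′ (a ℕ.+ b) (a ∷ b ∷ []) (c ∷ d ∷ []) * B′ (N ∸ (a ℕ.+ b)) l l′)
... | yes p | _ , ab∈ , l∈ | _ , cd∈ , l′∈ = cong (1ℚ *_) (cong₂ _*_
  (h (a ℕ.+ b) (a ∷ b ∷ []) (c ∷ d ∷ []) ab∈ (≡.subst (λ k → c ∷ d ∷ [] ∈ S k 2) (sym p) cd∈))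
  (h′ (N ∸ (a ℕ.+ b)) l l′ l∈ (≡.subst (λ k → l′ ∈ S (N ∸ k) _) (sym p) l′∈)))

-- Equal first entries and equal second entries have equal sums, so the indicator in `tensor` is
-- absorbed by `δᴳ`. In this form a factor of Φ that only moves x₃, ..., x_r can be multiplied with
-- the projector onto W.
blk-blk : ∀ {q} (B : Graded q) → blk (blk B) ≐ tensor δᴳ B
blk-blk B N (a ∷ b ∷ l) (c ∷ d ∷ l′) _ _ = trans (sym (ℚP.*-assoc (ind (a ℕ.≟ c)) (ind (b ℕ.≟ d)) (B (N ∸ a ∸ b) l l′)))
  (trans (cong₂ _*_ (trans (sym (ind-* (a ℕ.≟ c) (b ℕ.≟ d) (ab ≟V cd) (λ { refl refl → refl }) VecP.∷-injectiveˡ (VecP.∷-injectiveˡ ∘ VecP.∷-injectiveʳ)))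
      (ind-* (a ℕ.+ b ℕ.≟ c ℕ.+ d) (ab ≟V cd) (ab ≟V cd) (λ _ h → h) (λ { refl → refl }) id))
    (cong (λ k → B k l l′) (ℕP.∸-+-assoc N a b)))
  (ℚP.*-assoc (ind (a ℕ.+ b ℕ.≟ c ℕ.+ d)) (ind (ab ≟V cd)) (B (N ∸ (a ℕ.+ b)) l l′)))
  where
  ab = a ∷ b ∷ []
  cd = c ∷ d ∷ []

-- Binary forms and period polynomials

pas : ℕ → ℕ → ℚ
pas n       zero    = 1ℚ
pas zero    (suc k) = 0ℚ
pas (suc n) (suc k) = pas n k + pas n (suc k)

pas-> : ∀ n k → n < k → pas n k ≡ 0ℚ
pas-> zero    (suc k) _         = refl
pas-> (suc n) (suc k) (s≤s n<k) = trans (cong₂ _+_ (pas-> n k n<k) (pas-> n (suc k) (ℕP.≤-trans n<k (ℕP.n≤1+n k)))) (ℚP.+-identityˡ 0ℚ)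

pas-diag : ∀ n → pas n n ≡ 1ℚ
pas-diag zero    = refl
pas-diag (suc n) = trans (cong₂ _+_ (pas-diag n) (pas-> n (suc n) ℕP.≤-refl)) (ℚP.+-identityʳ 1ℚ)

pas-subdiag>0 : ∀ n → 0ℚ ℚ.< pas (suc n) n
pas-subdiag>0 zero    = ℚP.positive⁻¹ 1ℚ
pas-subdiag>0 (suc n) = ℚP.+-mono-< (pas-subdiag>0 n) (≡.subst (0ℚ ℚ.<_) (sym (pas-diag (suc n))) (ℚP.positive⁻¹ 1ℚ))

∑-upTo-0 : ∀ n (f : ℕ → ℚ) → ∑ (upTo (suc n)) f ≡ f 0 + ∑ (upTo n) (f ∘ suc)
∑-upTo-0 n f = cong (f 0 +_) (trans (cong (λ l → ∑ l f) (sym (ListP.map-upTo suc n))) (∑-map suc (upTo n) f))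

-- The binomial theorem for (z + y)ⁿ, made homogeneous of degree w. The sum runs up to w, where the
-- extra terms vanish, so that all rows of a substitution matrix share one index list.
binomial : ∀ n w → n ≤ w → ∀ z y →
  ∑ (upTo (suc w)) (λ j → pas n j * (pow z j * pow y (w ∸ j))) ≡ pow y (w ∸ n) * pow (z + y) n
binomial zero w _ z y = trans (∑-upTo-0 w (λ j → pas 0 j * (pow z j * pow y (w ∸ j)))) (trans (cong (1ℚ * (1ℚ * pow y w) +_) (∑-zero∈ (upTo w) (λ j _ → ℚP.*-zeroˡ (pow z (suc j) * pow y (w ∸ suc j)))))
  (lem (pow y w)))
  where
  lem : ∀ a → 1ℚ * (1ℚ * a) + 0ℚ ≡ a * 1ℚ
  lem = solve-∀ ℚ-ring
binomial (suc n) (suc w) (s≤s n≤w) z y = begin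
  ∑ (upTo (suc (suc w))) (λ j → pas (suc n) j * (pow z j * pow y (suc w ∸ j)))
    ≡⟨ ∑-upTo-0 (suc w) (λ j → pas (suc n) j * (pow z j * pow y (suc w ∸ j))) ⟩
  A + ∑ (upTo (suc w)) (λ j → (pas n j + pas n (suc j)) * (z * pow z j * pow y (w ∸ j)))
    ≡⟨ cong (A +_) (trans (∑-cong (upTo (suc w)) (λ j → lem₁ (pas n j) (pas n (suc j)) z (pow z j) (pow y (w ∸ j))))
         (∑-+ (upTo (suc w)) (λ j → z * (pas n j * (pow z j * pow y (w ∸ j)))) (λ j → pas n (suc j) * (z * pow z j * pow y (w ∸ j))))) ⟩
  A + (∑ (upTo (suc w)) (λ j → z * (pas n j * (pow z j * pow y (w ∸ j)))) + ∑ (upTo (suc w)) (λ j → pas n (suc j) * (z * pow z j * pow y (w ∸ j))))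
    ≡⟨ cong (λ s → A + (s + B)) (∑-*ˡ (upTo (suc w)) z (λ j → pas n j * (pow z j * pow y (w ∸ j)))) ⟨
  A + (z * T₀ + B)
    ≡⟨ lem₂ A (z * T₀) B ⟩
  z * T₀ + (A + B)
    ≡⟨ cong (z * T₀ +_) (∑-upTo-0 (suc w) (λ j → pas n j * (pow z j * pow y (suc w ∸ j)))) ⟨
  z * T₀ + ∑ (upTo (suc (suc w))) (λ j → pas n j * (pow z j * pow y (suc w ∸ j)))
    ≡⟨ cong (z * T₀ +_) (trans (∑-upTo-suc (suc w) (λ j → pas n j * (pow z j * pow y (suc w ∸ j)))) (cong₂ _+_
         (trans (∑-upTo-cong (suc w) (λ j j≤w → trans (cong (λ k → pas n j * (pow z j * pow y k)) (ℕP.+-∸-assoc 1 (ℕP.≤-pred j≤w)))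
           (lem₃ (pas n j) (pow z j) y (pow y (w ∸ j))))) (sym (∑-*ˡ (upTo (suc w)) y (λ j → pas n j * (pow z j * pow y (w ∸ j))))))
         (trans (cong (_* (pow z (suc w) * pow y (suc w ∸ suc w))) (pas-> n (suc w) (s≤s n≤w))) (ℚP.*-zeroˡ (pow z (suc w) * pow y (suc w ∸ suc w)))))) ⟩
  z * T₀ + (y * T₀ + 0ℚ)
    ≡⟨ lem₄ z y T₀ ⟩
  (z + y) * T₀
    ≡⟨ cong ((z + y) *_) (binomial n w n≤w z y) ⟩
  (z + y) * (pow y (w ∸ n) * pow (z + y) n)
    ≡⟨ *-exchange (z + y) (pow y (w ∸ n)) (pow (z + y) n) ⟩
  pow y (w ∸ n) * ((z + y) * pow (z + y) n) ∎
  where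
  open ≡-Reasoning
  A = 1ℚ * (1ℚ * pow y (suc w))
  B = ∑ (upTo (suc w)) (λ j → pas n (suc j) * (z * pow z j * pow y (w ∸ j)))
  T₀ = ∑ (upTo (suc w)) (λ j → pas n j * (pow z j * pow y (w ∸ j)))
  lem₁ : ∀ p q z a b → (p + q) * (z * a * b) ≡ z * (p * (a * b)) + q * (z * a * b)
  lem₁ = solve-∀ ℚ-ring
  lem₂ : ∀ a b c → a + (b + c) ≡ b + (a + c)
  lem₂ = solve-∀ ℚ-ring
  lem₃ : ∀ p a y b → p * (a * (y * b)) ≡ y * (p * (a * b))
  lem₃ = solve-∀ ℚ-ring
  lem₄ : ∀ z y t → z * t + (y * t + 0ℚ) ≡ (z + y) * t
  lem₄ = solve-∀ ℚ-ring

sg : ℕ → ℚ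
sg = pow (- 1ℚ)

pow-neg : ∀ x k → pow (- x) k ≡ sg k * pow x k
pow-neg x k = trans (cong (λ z → pow z k) (neg≡-1* x)) (pow-* (- 1ℚ) x k)

sg-even : ∀ h → sg (h ℕ.* 2) ≡ 1ℚ
sg-even zero    = refl
sg-even (suc h) = cong (λ z → (- 1ℚ) * ((- 1ℚ) * z)) (sg-even h)

even⊎odd : ∀ n → ∃ λ h → n ≡ h ℕ.* 2 ⊎ n ≡ suc (h ℕ.* 2)
even⊎odd zero = 0 , inj₁ refl
even⊎odd (suc n) with even⊎odd n
... | h , inj₁ refl = h , inj₂ refl
... | h , inj₂ refl = suc h , inj₁ refl

swap₂ : Vec ℕ 2 → Vec ℕ 2
swap₂ (a ∷ b ∷ []) = b ∷ a ∷ []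

swap₂-involutive : ∀ u → swap₂ (swap₂ u) ≡ u
swap₂-involutive (a ∷ b ∷ []) = refl

∈-S₂⁺ : ∀ M {a b} → Odd3 a → Odd3 b → a ℕ.+ b ≡ M → a ∷ b ∷ [] ∈ S M 2
∈-S₂⁺ M {a} {b} odda oddb refl = ∈-S⁺ (a ℕ.+ b) odda (ℕP.m≤m+n a b) (≡.subst (λ k → b ∷ [] ∈ S k 1) (sym (ℕP.m+n∸m≡n a b))
    (∈-S⁺ b oddb ℕP.≤-refl (≡.subst (λ k → [] ∈ S k 0) (sym (ℕP.n∸n≡0 b)) (here refl))))

∈-S₂⁻ : ∀ M {a b} → a ∷ b ∷ [] ∈ S M 2 → Odd3 a × Odd3 b × a ℕ.+ b ≡ M
∈-S₂⁻ M {a} {b} u∈ = ∈-S-odd 2 M u∈ Fin.zero , ∈-S-odd 2 M u∈ (Fin.suc Fin.zero) ,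
  trans (cong (a ℕ.+_) (sym (ℕP.+-identityʳ b))) (∈-S-sum 2 M u∈)

swap₂-∈ : ∀ M u → u ∈ S M 2 → swap₂ u ∈ S M 2
swap₂-∈ M (a ∷ b ∷ []) u∈ with ∈-S₂⁻ M u∈
... | odda , oddb , a+b≡M = ∈-S₂⁺ M oddb odda (trans (ℕP.+-comm b a) a+b≡M)

x+x≡0⇒x≡0 : ∀ x → x + x ≡ 0ℚ → x ≡ 0ℚ
x+x≡0⇒x≡0 x h = *-zero-cancelʳ x 2ℚ (λ ()) (trans (ℚP.*-distribˡ-+ x 1ℚ 1ℚ) (trans (cong₂ _+_ (ℚP.*-identityʳ x) (ℚP.*-identityʳ x)) h))

-- Homogeneous polynomials of even degree w in x, y: the row vector v stands for ∑ vⱼ xʲ yʷ⁻ʲ,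
-- and a matrix A for the substitution turning xⁱ yʷ⁻ⁱ into the polynomial of its i-th row.
module BinaryForms (h : ℕ) where

  w M : ℕ
  w = h ℕ.* 2
  M = suc (suc w)

  J : List ℕ
  J = upTo (suc w)

  ∈J : ∀ {i} → i ≤ w → i ∈ J
  ∈J i≤w = ∈P.∈-upTo⁺ (s≤s i≤w)

  J∈ : ∀ {i} → i ∈ J → i ≤ w
  J∈ i∈ = ℕP.≤-pred (∈P.∈-upTo⁻ i∈)

  open SquareMatrices ℕ._≟_ J (UniqueP.upTo⁺ (suc w)) public

  open Ring matrixRing public
    using (Carrier; _≈_; 0#; 1#; setoid; *-congˡ; *-congʳ; *-assoc; *-identityˡ; *-identityʳ; +-congˡ; +-congʳ; +-cong; +-assoc; +-comm;
           distribˡ; distribʳ; -‿cong)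
    renaming (_+_ to _⊞_; _*_ to _·_; -_ to ⊟_; refl to ≈-refl; sym to ≈-sym; trans to ≈-trans)

  mon : ℕ → ℚ → ℚ → ℚ
  mon i x y = pow x i * pow y (w ∸ i)

  ev : (ℕ → ℚ) → ℚ → ℚ → ℚ
  ev v x y = ∑ J (λ j → v j * mon j x y)

  ev-injective : ∀ u v → (∀ x y → ev u x y ≡ ev v x y) → ∀ j → j ∈ J → u j ≡ v j
  ev-injective u v eq j j∈ = -‿zero _ _ (univariate-identity (suc w) (λ j → u j - v j) (λ x → begin
    ∑ J (λ j → (u j - v j) * pow x j)
      ≡⟨ ∑-cong J (λ j → trans (lem (u j) (v j) (pow x j)) (cong (λ z → u j * (pow x j * z) - v j * (pow x j * z)) (sym (pow-1 (w ∸ j))))) ⟩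
    ∑ J (λ j → u j * mon j x 1ℚ - v j * mon j x 1ℚ)
      ≡⟨ ∑-- J (λ j → u j * mon j x 1ℚ) (λ j → v j * mon j x 1ℚ) ⟩
    ev u x 1ℚ - ev v x 1ℚ
      ≡⟨ trans (cong (_- ev v x 1ℚ) (eq x 1ℚ)) (ℚP.+-inverseʳ (ev v x 1ℚ)) ⟩
    0ℚ ∎) j (s≤s (J∈ j∈)))
    where
    open ≡-Reasoning
    lem : ∀ a b p → (a - b) * p ≡ a * (p * 1ℚ) - b * (p * 1ℚ)
    lem = solve-∀ ℚ-ring

  Represents : Carrier → (ℚ → ℚ → ℚ) → (ℚ → ℚ → ℚ) → Set
  Represents A g₁ g₂ = ∀ i → i ∈ J → ∀ x y → ev (A i) x y ≡ mon i (g₁ x y) (g₂ x y)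

  ev-act : ∀ {A g₁ g₂} → Represents A g₁ g₂ → ∀ v x y → ev (λ j → ∑ J (λ i → v i * A i j)) x y ≡ ev v (g₁ x y) (g₂ x y)
  ev-act {A} rep v x y = begin
    ∑ J (λ j → ∑ J (λ i → v i * A i j) * mon j x y)
      ≡⟨ ∑-cong J (λ j → trans (∑-*ʳ J (mon j x y) (λ i → v i * A i j)) (∑-cong J (λ i → ℚP.*-assoc (v i) (A i j) (mon j x y)))) ⟩
    ∑ J (λ j → ∑ J (λ i → v i * (A i j * mon j x y)))
      ≡⟨ ∑-swap J J (λ j i → v i * (A i j * mon j x y)) ⟩
    ∑ J (λ i → ∑ J (λ j → v i * (A i j * mon j x y)))
      ≡⟨ ∑-cong∈ J (λ i i∈ → trans (sym (∑-*ˡ J (v i) (λ j → A i j * mon j x y))) (cong (v i *_) (rep i i∈ x y))) ⟩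
    _ ∎ where open ≡-Reasoning

  rep-· : ∀ {A B g₁ g₂ f₁ f₂} → Represents A g₁ g₂ → Represents B f₁ f₂ →
    Represents (A · B) (λ x y → g₁ (f₁ x y) (f₂ x y)) (λ x y → g₂ (f₁ x y) (f₂ x y))
  rep-· {A} {B} {f₁ = f₁} {f₂} repA repB i i∈ x y = trans (ev-act {B} repB (A i) x y) (repA i i∈ (f₁ x y) (f₂ x y))

  rep-unique : ∀ {A B g₁ g₂ f₁ f₂} → Represents A g₁ g₂ → Represents B f₁ f₂ →
    (∀ i → i ≤ w → ∀ x y → mon i (g₁ x y) (g₂ x y) ≡ mon i (f₁ x y) (f₂ x y)) → A ≈ B
  rep-unique {A} {B} repA repB eq i j i∈ j∈ = ev-injective (A i) (B i)
    (λ x y → trans (repA i i∈ x y) (trans (eq i (J∈ i∈) x y) (sym (repB i i∈ x y)))) j j∈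

  -- In even degree -1 acts trivially. This is what gives `U` order dividing three, the third power
  -- of the substitution being (x, y) ↦ (-x, -y).
  mon-neg : ∀ i → i ≤ w → ∀ x y → mon i (- x) (- y) ≡ mon i x y
  mon-neg i i≤w x y = begin
    pow (- x) i * pow (- y) (w ∸ i)                       ≡⟨ cong₂ _*_ (pow-neg x i) (pow-neg y (w ∸ i)) ⟩
    sg i * pow x i * (sg (w ∸ i) * pow y (w ∸ i))         ≡⟨ *-interchange (sg i) (pow x i) (sg (w ∸ i)) (pow y (w ∸ i)) ⟩
    sg i * sg (w ∸ i) * mon i x y                         ≡⟨ cong (_* mon i x y) (trans (sym (pow-+ (- 1ℚ) i (w ∸ i)))
                                                               (trans (cong sg (ℕP.m+[n∸m]≡n i≤w)) (sg-even h))) ⟩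
    1ℚ * mon i x y                                        ≡⟨ ℚP.*-identityˡ (mon i x y) ⟩
    mon i x y                                             ∎
    where
    open ≡-Reasoning

  mon-swap : ∀ i → i ≤ w → ∀ x y → mon (w ∸ i) x y ≡ mon i y x
  mon-swap i i≤w x y = trans (cong (λ k → pow x (w ∸ i) * pow y k) (ℕP.m∸[m∸n]≡n i≤w)) (ℚP.*-comm (pow x (w ∸ i)) (pow y i))

  τ U : Carrier
  τ i j = ind ((w ∸ i) ℕ.≟ j)
  U i j = sg j * pas (w ∸ i) j

  rep-1 : Represents 1# (λ x y → x) (λ x y → y)
  rep-1 i i∈ x y = ∑-δ ℕ._≟_ (UniqueP.upTo⁺ (suc w)) (λ j → mon j x y) i∈

  rep-τ : Represents τ (λ x y → y) (λ x y → x)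
  rep-τ i i∈ x y = trans (∑-δ ℕ._≟_ (UniqueP.upTo⁺ (suc w)) (λ j → mon j x y) (∈J (ℕP.m∸n≤m w i))) (mon-swap i (J∈ i∈) x y)

  rep-U : Represents U (λ x y → y) (λ x y → y - x)
  rep-U i i∈ x y = begin
    ∑ J (λ j → sg j * pas (w ∸ i) j * mon j x y)
      ≡⟨ ∑-cong J (λ j → trans (lem (sg j) (pas (w ∸ i) j) (pow x j) (pow y (w ∸ j))) (cong (λ z → pas (w ∸ i) j * (z * pow y (w ∸ j))) (sym (pow-neg x j)))) ⟩
    ∑ J (λ j → pas (w ∸ i) j * (pow (- x) j * pow y (w ∸ j)))
      ≡⟨ binomial (w ∸ i) w (ℕP.m∸n≤m w i) (- x) y ⟩
    pow y (w ∸ (w ∸ i)) * pow ((- x) + y) (w ∸ i)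
      ≡⟨ cong₂ (λ k z → pow y k * pow z (w ∸ i)) (ℕP.m∸[m∸n]≡n (J∈ i∈)) (ℚP.+-comm (- x) y) ⟩
    pow y i * pow (y - x) (w ∸ i) ∎
    where
    open ≡-Reasoning
    lem : ∀ s p a b → s * p * (a * b) ≡ p * (s * a * b)
    lem = solve-∀ ℚ-ring

  rep-UU : Represents (U · U) (λ x y → y - x) (λ x y → (y - x) - y)
  rep-UU = rep-· {U} {U} rep-U rep-U

  U³≈1 : U · (U · U) ≈ 1#
  U³≈1 = rep-unique {U · (U · U)} {1#} (rep-· {U} {U · U} rep-U rep-UU) rep-1
    (λ i i≤w x y → trans (cong₂ (mon i) (lem₁ x y) (lem₂ x y)) (mon-neg i i≤w x y))
    where
    lem₁ : ∀ x y → (y - x) - y ≡ - x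
    lem₁ = solve-∀ ℚ-ring
    lem₂ : ∀ x y → ((y - x) - y) - (y - x) ≡ - y
    lem₂ = solve-∀ ℚ-ring

  τ²≈1 : τ · τ ≈ 1#
  τ²≈1 = rep-unique {τ · τ} {1#} (rep-· {τ} {τ} rep-τ rep-τ) rep-1 (λ i i≤w x y → refl)

  -- Together with U³ = 1 and τ² = 1 this defines an action of the symmetric group on three letters;
  -- `P` below is the sum over the group weighted by the sign character.
  τU≈U²τ : τ · U ≈ (U · U) · τ
  τU≈U²τ = rep-unique {τ · U} {(U · U) · τ} (rep-· {τ} {U} rep-τ rep-U) (rep-· {U · U} {τ} rep-UU rep-τ)
    (λ i i≤w x y → trans (sym (mon-neg i i≤w (y - x) y)) (cong₂ (mon i) (lem₁ x y) (lem₂ x y)))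
    where
    lem₁ : ∀ x y → - (y - x) ≡ x - y
    lem₁ = solve-∀ ℚ-ring
    lem₂ : ∀ x y → - y ≡ (x - y) - x
    lem₂ = solve-∀ ℚ-ring

  -- Six times the projector onto the forms fixed by U and negated by τ.
  Nm P : Carrier
  Nm = 1# ⊞ (U ⊞ U · U)
  P  = Nm · (1# ⊞ (⊟ τ))

  private
    module R = Ring matrixRing
    module RP = RingP matrixRing
    open SetoidReasoning R.setoid

    UNm≈Nm : U · Nm ≈ Nm
    UNm≈Nm = begin
      U · (1# ⊞ (U ⊞ U · U))                ≈⟨ distribˡ U 1# (U ⊞ U · U) ⟩
      U · 1# ⊞ U · (U ⊞ U · U)              ≈⟨ +-cong (*-identityʳ U) (distribˡ U U (U · U)) ⟩
      U ⊞ (U · U ⊞ U · (U · U))             ≈⟨ +-congˡ {U} (+-congˡ {U · U} U³≈1) ⟩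
      U ⊞ (U · U ⊞ 1#)                      ≈⟨ R.sym (+-assoc U (U · U) 1#) ⟩
      (U ⊞ U · U) ⊞ 1#                      ≈⟨ +-comm (U ⊞ U · U) 1# ⟩
      Nm                                    ∎

    τU²≈Uτ : τ · (U · U) ≈ U · τ
    τU²≈Uτ = begin
      τ · (U · U)                ≈⟨ R.sym (*-assoc τ U U) ⟩
      τ · U · U                  ≈⟨ *-congʳ {U} τU≈U²τ ⟩
      U · U · τ · U              ≈⟨ *-assoc (U · U) τ U ⟩
      U · U · (τ · U)            ≈⟨ *-congˡ {U · U} τU≈U²τ ⟩
      U · U · (U · U · τ)        ≈⟨ R.sym (*-assoc (U · U) (U · U) τ) ⟩
      U · U · (U · U) · τ        ≈⟨ *-congʳ {τ} (*-assoc U U (U · U)) ⟩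
      U · (U · (U · U)) · τ      ≈⟨ *-congʳ {τ} (*-congˡ {U} U³≈1) ⟩
      U · 1# · τ                 ≈⟨ *-congʳ {τ} (*-identityʳ U) ⟩
      U · τ                      ∎

    τNm≈Nmτ : τ · Nm ≈ Nm · τ
    τNm≈Nmτ = begin
      τ · (1# ⊞ (U ⊞ U · U))              ≈⟨ distribˡ τ 1# (U ⊞ U · U) ⟩
      τ · 1# ⊞ τ · (U ⊞ U · U)            ≈⟨ +-cong (R.trans (*-identityʳ τ) (R.sym (*-identityˡ τ))) (distribˡ τ U (U · U)) ⟩
      1# · τ ⊞ (τ · U ⊞ τ · (U · U))      ≈⟨ +-congˡ {1# · τ} (+-cong τU≈U²τ τU²≈Uτ) ⟩
      1# · τ ⊞ (U · U · τ ⊞ U · τ)        ≈⟨ +-congˡ {1# · τ} (+-comm (U · U · τ) (U · τ)) ⟩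
      1# · τ ⊞ (U · τ ⊞ U · U · τ)        ≈⟨ +-congˡ {1# · τ} (R.sym (distribʳ τ U (U · U))) ⟩
      1# · τ ⊞ (U ⊞ U · U) · τ            ≈⟨ R.sym (distribʳ τ 1# (U ⊞ U · U)) ⟩
      Nm · τ                              ∎

    τ[1-τ]≈ : τ · (1# ⊞ (⊟ τ)) ≈ ⊟ (1# ⊞ (⊟ τ))
    τ[1-τ]≈ = begin
      τ · (1# ⊞ (⊟ τ))                    ≈⟨ distribˡ τ 1# (⊟ τ) ⟩
      τ · 1# ⊞ τ · (⊟ τ)                  ≈⟨ +-cong (*-identityʳ τ) (R.trans (R.sym (RP.-‿distribʳ-* τ τ)) (-‿cong τ²≈1)) ⟩
      τ ⊞ (⊟ 1#)                          ≈⟨ (λ i j _ _ → lem (τ i j) (1# i j)) ⟩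
      ⊟ (1# ⊞ (⊟ τ))                      ∎
      where
      lem : ∀ a b → a + (- b) ≡ - (b + (- a))
      lem = solve-∀ ℚ-ring

  UP≈P : U · P ≈ P
  UP≈P = R.trans (R.sym (*-assoc U Nm (1# ⊞ (⊟ τ)))) (*-congʳ {1# ⊞ (⊟ τ)} UNm≈Nm)

  τP≈-P : τ · P ≈ ⊟ P
  τP≈-P = begin
    τ · (Nm · (1# ⊞ (⊟ τ)))     ≈⟨ R.sym (*-assoc τ Nm (1# ⊞ (⊟ τ))) ⟩
    τ · Nm · (1# ⊞ (⊟ τ))       ≈⟨ *-congʳ {1# ⊞ (⊟ τ)} τNm≈Nmτ ⟩
    Nm · τ · (1# ⊞ (⊟ τ))       ≈⟨ *-assoc Nm τ (1# ⊞ (⊟ τ)) ⟩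
    Nm · (τ · (1# ⊞ (⊟ τ)))     ≈⟨ *-congˡ {Nm} τ[1-τ]≈ ⟩
    Nm · (⊟ (1# ⊞ (⊟ τ)))       ≈⟨ R.sym (RP.-‿distribʳ-* Nm (1# ⊞ (⊟ τ))) ⟩
    ⊟ P                         ∎

  6ℚ : ℚ
  6ℚ = (1ℚ + 1ℚ) * (1ℚ + (1ℚ + 1ℚ))

  PP≈6P : P · P ≈ (λ i j → 6ℚ * P i j)
  PP≈6P = begin
    Nm · (1# ⊞ (⊟ τ)) · P               ≈⟨ *-assoc Nm (1# ⊞ (⊟ τ)) P ⟩
    Nm · ((1# ⊞ (⊟ τ)) · P)             ≈⟨ *-congˡ {Nm} (R.trans (distribʳ P 1# (⊟ τ)) (+-cong (*-identityˡ P)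
                                             (R.trans (R.sym (RP.-‿distribˡ-* τ P)) (R.trans (-‿cong τP≈-P) (RP.-‿involutive P))))) ⟩
    Nm · (P ⊞ P)                        ≈⟨ distribˡ Nm P P ⟩
    Nm · P ⊞ Nm · P                     ≈⟨ +-cong NmP NmP ⟩
    (P ⊞ (P ⊞ P)) ⊞ (P ⊞ (P ⊞ P))       ≈⟨ (λ i j _ _ → lem (P i j)) ⟩
    (λ i j → 6ℚ * P i j)                ∎
    where
    lem : ∀ a → (a + (a + a)) + (a + (a + a)) ≡ (1ℚ + 1ℚ) * (1ℚ + (1ℚ + 1ℚ)) * a
    lem = solve-∀ ℚ-ring
    NmP : Nm · P ≈ P ⊞ (P ⊞ P)
    NmP = R.trans (distribʳ P 1# (U ⊞ U · U)) (+-cong (*-identityˡ P) (R.trans (distribʳ P U (U · U))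
      (+-cong UP≈P (R.trans (*-assoc U U P) (R.trans (*-congˡ {U} UP≈P) UP≈P)))))

  tr-⊟ : ∀ A → tr (⊟ A) ≡ - tr A
  tr-⊟ A = ∑-neg J (λ i → A i i)

  -- The rotations U and U² are conjugate under τ, and the reflections τ, Uτ and U²τ are conjugate
  -- to one another, so three traces suffice.
  tr-P : tr P ≡ tr 1# + (tr U + tr U) - (tr τ + (tr τ + tr τ))
  tr-P = trans (tr-cong {P} {Nm ⊞ (⊟ (τ ⊞ (U · τ ⊞ U · U · τ)))} P≈)
    (trans (tr-+ Nm (⊟ (τ ⊞ (U · τ ⊞ U · U · τ)))) (cong₂ _+_
      (trans (tr-+ 1# (U ⊞ U · U)) (cong (tr 1# +_) (trans (tr-+ U (U · U)) (cong (tr U +_) trUU))))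
      (trans (tr-⊟ (τ ⊞ (U · τ ⊞ U · U · τ))) (cong -_ (trans (tr-+ τ (U · τ ⊞ U · U · τ)) (cong (tr τ +_)
        (trans (tr-+ (U · τ) (U · U · τ)) (cong₂ _+_ trUτ trUUτ))))))))
    where
    P≈ : P ≈ Nm ⊞ (⊟ (τ ⊞ (U · τ ⊞ U · U · τ)))
    P≈ = R.trans (distribˡ Nm 1# (⊟ τ)) (+-cong (*-identityʳ Nm) (R.trans (R.sym (RP.-‿distribʳ-* Nm τ)) (-‿cong
      (R.trans (distribʳ τ 1# (U ⊞ U · U)) (+-cong (*-identityˡ τ) (distribʳ τ U (U · U)))))))
    trUU : tr (U · U) ≡ tr U
    trUU = trans (tr-cong {U · U} {τ · U · τ} (R.sym (R.trans (*-congʳ {τ} τU≈U²τ) (R.trans (*-assoc (U · U) τ τ)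
             (R.trans (*-congˡ {U · U} τ²≈1) (*-identityʳ (U · U)))))))
      (trans (tr-comm (τ · U) τ) (tr-cong {τ · (τ · U)} {U} (R.trans (R.sym (*-assoc τ τ U)) (R.trans (*-congʳ {U} τ²≈1) (*-identityˡ U)))))
    trUτ : tr (U · τ) ≡ tr τ
    trUτ = sym (trans (tr-cong {τ} {τ · U · (U · U)} (R.sym (R.trans (*-assoc τ U (U · U)) (R.trans (*-congˡ {τ} U³≈1) (*-identityʳ τ)))))
      (trans (tr-cong {τ · U · (U · U)} {U · U · τ · (U · U)} (*-congʳ {U · U} τU≈U²τ))
      (trans (tr-comm (U · U · τ) (U · U)) (tr-cong {U · U · (U · U · τ)} {U · τ}
        (R.trans (R.sym (*-assoc (U · U) (U · U) τ)) (*-congʳ {τ} (R.trans (*-assoc U U (U · U)) (R.trans (*-congˡ {U} U³≈1) (*-identityʳ U)))))))))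
    trUUτ : tr (U · U · τ) ≡ tr τ
    trUUτ = trans (tr-cong {U · U · τ} {τ · U} (R.sym τU≈U²τ)) (trans (tr-comm τ U) trUτ)

∑-swap₂ : ∀ M (f : Vec ℕ 2 → ℚ) → ∑ (S M 2) (f ∘ swap₂) ≡ ∑ (S M 2) f
∑-swap₂ M f = begin
  ∑ S₂ (f ∘ swap₂)
    ≡⟨ ∑-cong∈ S₂ (λ u u∈ → sym (∑-δ _≟V_ (Unique-S M 2) f (swap₂-∈ M u u∈))) ⟩
  ∑ S₂ (λ u → ∑ S₂ (λ v → ind (swap₂ u ≟V v) * f v))
    ≡⟨ ∑-swap S₂ S₂ (λ u v → ind (swap₂ u ≟V v) * f v) ⟩
  ∑ S₂ (λ v → ∑ S₂ (λ u → ind (swap₂ u ≟V v) * f v))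
    ≡⟨ ∑-cong∈ S₂ (λ v v∈ → trans (∑-cong S₂ (λ u → cong (_* f v) (ind-⇔ (swap₂ u ≟V v) (swap₂ v ≟V u)
         (λ { refl → swap₂-involutive u }) (λ { refl → swap₂-involutive v }))))
         (∑-δ _≟V_ (Unique-S M 2) (λ _ → f v) (swap₂-∈ M v v∈))) ⟩
  ∑ S₂ f ∎
  where
  open ≡-Reasoning
  S₂ = S M 2

odd3-suc-even : ∀ k → 1 ≤ k → Odd3 (suc (k ℕ.* 2))
odd3-suc-even (suc k) _ = s≤s (s≤s (s≤s z≤n)) , DivMod.[m+kn]%n≡m%n 1 (suc k) 2

-- Even period polynomials in two variables as a left kernel.

module PeriodSpace (h : ℕ) where
  open BinaryForms h

  S₂ : List (Vec ℕ 2)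
  S₂ = S M 2

  hd : Vec ℕ 2 → ℕ
  hd u = Vec.head u ∸ 1

  hd≤w : ∀ u → u ∈ S₂ → hd u ≤ w
  hd≤w (a ∷ b ∷ []) u∈ with ∈-S₂⁻ M u∈
  ... | odda , oddb , a+b≡M with a | b | odda | oddb
  ...   | suc a′ | suc b′ | _ | _ = ℕP.≤-trans (ℕP.m≤m+n a′ b′) (ℕP.≤-reflexive (ℕP.suc-injective (ℕP.suc-injective (trans (cong suc (sym (ℕP.+-suc a′ b′))) a+b≡M))))

  hd-swap₂ : ∀ u → u ∈ S₂ → hd (swap₂ u) ≡ w ∸ hd u
  hd-swap₂ (a ∷ b ∷ []) u∈ with ∈-S₂⁻ M u∈
  ... | odda , oddb , a+b≡M with a | b | odda | oddb
  ...   | suc a′ | suc b′ | _ | _ = sym (trans (cong (_∸ a′) (sym (ℕP.suc-injective (ℕP.suc-injective (trans (cong suc (sym (ℕP.+-suc a′ b′))) a+b≡M)))))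
    (ℕP.m+n∸m≡n a′ b′))

  hd-injective : ∀ u v → u ∈ S₂ → v ∈ S₂ → hd u ≡ hd v → u ≡ v
  hd-injective (a ∷ b ∷ []) (c ∷ d ∷ []) u∈ v∈ eq with ∈-S₂⁻ M u∈ | ∈-S₂⁻ M v∈
  ... | odda , oddb , a+b≡M | oddc , oddd , c+d≡M with ∸1-injective odda oddc eq
  ...   | refl = cong (λ z → a ∷ z ∷ []) (ℕP.+-cancelˡ-≡ a b d (trans a+b≡M (sym c+d≡M)))

  module Vanishing (ℓ : ℕ → ℚ)
    (U-fixed : ∀ i → i ≤ w → ∑ J (λ j → U i j * ℓ j) ≡ ℓ i)
    (τ-negated : ∀ i → i ≤ w → ℓ (w ∸ i) ≡ - ℓ i)
    (interior : ∀ u → u ∈ S₂ → ℓ (hd u) ≡ 0ℚ) where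

    -- `S₂` misses the monomials xʷ and yʷ, so `interior` leaves both ends open. U sends xʷ to yʷ,
    -- which gives this equation; with the opposite sign from τ it forces both values to vanish.
    ℓw≡ℓ0 : ℓ w ≡ ℓ 0
    ℓw≡ℓ0 = begin
      ℓ w                                               ≡⟨ U-fixed w ℕP.≤-refl ⟨
      ∑ J (λ j → sg j * pas (w ∸ w) j * ℓ j)            ≡⟨ cong (λ n → ∑ J (λ j → sg j * pas n j * ℓ j)) (ℕP.n∸n≡0 w) ⟩
      ∑ J (λ j → sg j * pas 0 j * ℓ j)                  ≡⟨ ∑-upTo-0 w (λ j → sg j * pas 0 j * ℓ j) ⟩
      1ℚ * 1ℚ * ℓ 0 + ∑ (upTo w) (λ j → sg (suc j) * 0ℚ * ℓ (suc j))
        ≡⟨ cong₂ _+_ (ℚP.*-identityˡ (ℓ 0)) (∑-zero∈ (upTo w) (λ j _ → trans (cong (_* ℓ (suc j)) (ℚP.*-zeroʳ (sg (suc j)))) (ℚP.*-zeroˡ (ℓ (suc j))))) ⟩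
      ℓ 0 + 0ℚ                                          ≡⟨ ℚP.+-identityʳ (ℓ 0) ⟩
      ℓ 0                                               ∎ where open ≡-Reasoning

    ℓ0≡0 : ℓ 0 ≡ 0ℚ
    ℓ0≡0 = x+x≡0⇒x≡0 (ℓ 0) (trans (cong (_+ ℓ 0) (trans (sym ℓw≡ℓ0) (τ-negated 0 z≤n))) (ℚP.+-inverseˡ (ℓ 0)))

    even-vanish : ∀ k → k ≤ h → ℓ (k ℕ.* 2) ≡ 0ℚ
    even-vanish zero    _   = ℓ0≡0
    even-vanish (suc k) k≤h with ℕP.m≤n⇒m<n∨m≡n k≤h
    ... | inj₂ refl = trans ℓw≡ℓ0 ℓ0≡0
    ... | inj₁ k<h  = interior (suc (suc k ℕ.* 2) ∷ suc ((h ∸ suc k) ℕ.* 2) ∷ [])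
      (∈-S₂⁺ M (odd3-suc-even (suc k) (s≤s z≤n)) (odd3-suc-even (h ∸ suc k) (ℕP.m<n⇒0<n∸m k<h))
        (cong suc (trans (ℕP.+-suc (suc k ℕ.* 2) ((h ∸ suc k) ℕ.* 2)) (cong suc (trans (sym (ℕP.*-distribʳ-+ 2 (suc k) (h ∸ suc k)))
          (cong (ℕ._* 2) (ℕP.m+[n∸m]≡n k≤h)))))))

    sg-ℓ : ∀ j → j ≤ w → sg j * ℓ j ≡ - ℓ j
    sg-ℓ j j≤w with even⊎odd j
    ... | k , inj₁ refl = trans (cong (sg (k ℕ.* 2) *_) zero-at) (trans (ℚP.*-zeroʳ (sg (k ℕ.* 2))) (sym (cong -_ zero-at)))
      where zero-at = even-vanish k (ℕP.*-cancelʳ-≤ k h 2 j≤w)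
    ... | k , inj₂ refl = trans (cong (λ z → (- 1ℚ) * z * ℓ (suc (k ℕ.* 2))) (sg-even k)) (lem (ℓ (suc (k ℕ.* 2))))
      where
      lem : ∀ a → (- 1ℚ) * 1ℚ * a ≡ - a
      lem = solve-∀ ℚ-ring

    -- Since `ℓ` vanishes at even indices, the sign (-1)ʲ in U acts on it as -1. Combined with the
    -- sign from τ, invariance under U at `w ∸ n` becomes invariance under x ↦ x + y at `n`.
    pascal-fixed : ∀ n → n ≤ w → ∑ J (λ j → pas n j * ℓ j) ≡ ℓ n
    pascal-fixed n n≤w = begin
      ∑ J (λ j → pas n j * ℓ j)                         ≡⟨ neg-neg (∑ J (λ j → pas n j * ℓ j)) ⟩
      - (- ∑ J (λ j → pas n j * ℓ j))                   ≡⟨ cong -_ (∑-neg J (λ j → pas n j * ℓ j)) ⟨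
      - ∑ J (λ j → - (pas n j * ℓ j))                   ≡⟨ cong -_ (∑-cong∈ J (λ j j∈ → trans (lem₁ (pas n j) (ℓ j))
                                                             (trans (cong (pas n j *_) (sym (sg-ℓ j (J∈ j∈)))) (lem₂ (pas n j) (sg j) (ℓ j))))) ⟩
      - ∑ J (λ j → sg j * pas n j * ℓ j)                ≡⟨ cong (λ k → - ∑ J (λ j → sg j * pas k j * ℓ j)) (ℕP.m∸[m∸n]≡n n≤w) ⟨
      - ∑ J (λ j → U (w ∸ n) j * ℓ j)                   ≡⟨ cong -_ (trans (U-fixed (w ∸ n) (ℕP.m∸n≤m w n)) (τ-negated n n≤w)) ⟩
      - (- ℓ n)                                         ≡⟨ neg-neg (ℓ n) ⟨
      ℓ n                                               ∎
      where
      open ≡-Reasoning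
      neg-neg : ∀ a → a ≡ - (- a)
      neg-neg = solve-∀ ℚ-ring
      lem₁ : ∀ p a → - (p * a) ≡ p * (- a)
      lem₁ = solve-∀ ℚ-ring
      lem₂ : ∀ p s a → p * (s * a) ≡ s * p * a
      lem₂ = solve-∀ ℚ-ring

    -- For m < w, the invariance is used at xᵐ⁺¹ yʷ⁻ᵐ⁻¹: the terms below m vanish, the top one
    -- cancels against the right side, and a positive multiple of `ℓ m` remains.
    below-vanish : ∀ m → (∀ j → j < m → j ≤ w → ℓ j ≡ 0ℚ) → m ≤ w → ℓ m ≡ 0ℚ
    below-vanish m below m≤w with ℕP.m≤n⇒m<n∨m≡n m≤w
    ... | inj₂ refl = trans ℓw≡ℓ0 ℓ0≡0
    ... | inj₁ m<w  = *-zero-cancelʳ (ℓ m) (pas (suc m) m) (λ eq → ℚP.<⇒≢ (pas-subdiag>0 m) (sym eq)) (begin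
      ℓ m * pas (suc m) m                                 ≡⟨ lem (ℓ m) (pas (suc m) m) (ℓ (suc m)) ⟩
      (pas (suc m) m * ℓ m + 1ℚ * ℓ (suc m)) - ℓ (suc m)  ≡⟨ cong (λ z → (pas (suc m) m * ℓ m + z * ℓ (suc m)) - ℓ (suc m)) (pas-diag (suc m)) ⟨
      (f m + f (suc m)) - ℓ (suc m)                       ≡⟨ cong₂ (λ p q → (p + q) - ℓ (suc m))
                                                               (∑-δ ℕ._≟_ (UniqueP.upTo⁺ (suc w)) f (∈J m≤w)) (∑-δ ℕ._≟_ (UniqueP.upTo⁺ (suc w)) f (∈J m<w)) ⟨
      (∑ J (λ j → ind (m ℕ.≟ j) * f j) + ∑ J (λ j → ind (suc m ℕ.≟ j) * f j)) - ℓ (suc m)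
                                                          ≡⟨ cong (_- ℓ (suc m)) (trans (sym (∑-+ J (λ j → ind (m ℕ.≟ j) * f j) (λ j → ind (suc m ℕ.≟ j) * f j)))
                                                               (sym (∑-cong∈ J (λ j j∈ → two-terms j (J∈ j∈))))) ⟩
      ∑ J f - ℓ (suc m)                                   ≡⟨ trans (cong (_- ℓ (suc m)) (pascal-fixed (suc m) m<w)) (ℚP.+-inverseʳ (ℓ (suc m))) ⟩
      0ℚ                                                  ∎)
      where
      open ≡-Reasoning
      f : ℕ → ℚ
      f j = pas (suc m) j * ℓ j
      lem : ∀ a p b → a * p ≡ (p * a + 1ℚ * b) - b
      lem = solve-∀ ℚ-ring
      vanishing : ∀ {a x y} → a ≡ 0ℚ → a ≡ x * a + y * a
      vanishing {_} {x} {y} refl = sym (cong₂ _+_ (ℚP.*-zeroʳ x) (ℚP.*-zeroʳ y))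
      two-terms : ∀ j → j ≤ w → f j ≡ ind (m ℕ.≟ j) * f j + ind (suc m ℕ.≟ j) * f j
      two-terms j j≤w with ℕP.<-cmp j m
      ... | tri< j<m _ _ = vanishing {f j} {ind (m ℕ.≟ j)} {ind (suc m ℕ.≟ j)} (trans (cong (pas (suc m) j *_) (below j j<m j≤w)) (ℚP.*-zeroʳ (pas (suc m) j)))
      ... | tri≈ _ refl _ = trans (lem₁ (f m)) (sym (cong₂ (λ p q → p * f m + q * f m) (ind-refl (m ℕ.≟ m)) (ind-no (suc m ℕ.≟ m) (λ eq → ℕP.1+n≢n eq))))
        where
        lem₁ : ∀ a → a ≡ 1ℚ * a + 0ℚ * a
        lem₁ = solve-∀ ℚ-ring
      ... | tri> _ _ m<j with ℕP.m≤n⇒m<n∨m≡n m<j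
      ...   | inj₂ refl = trans (lem₁ (f (suc m))) (sym (cong₂ (λ p q → p * f (suc m) + q * f (suc m)) (ind-no (m ℕ.≟ suc m) (λ eq → ℕP.1+n≢n (sym eq))) (ind-refl (suc m ℕ.≟ suc m))))
        where
        lem₁ : ∀ a → a ≡ 0ℚ * a + 1ℚ * a
        lem₁ = solve-∀ ℚ-ring
      ...   | inj₁ 1+m<j = vanishing {f j} {ind (m ℕ.≟ j)} {ind (suc m ℕ.≟ j)} (trans (cong (_* ℓ j) (pas-> (suc m) j 1+m<j)) (ℚP.*-zeroˡ (ℓ j)))

    vanish : ∀ m → m ≤ w → ℓ m ≡ 0ℚ
    vanish m = below-vanish m (go m)
      where
      go : ∀ m j → j < m → j ≤ w → ℓ j ≡ 0ℚ
      go (suc m) j (s≤s j≤m) j≤w = below-vanish j (λ i i<j i≤w → go m i (ℕP.≤-trans i<j j≤m) i≤w) j≤w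

  -- The rows of `P` at the monomials of S_{M,2}: `act t L` is the form of `t` moved by `P`, and its
  -- vanishing will turn out to be the period equation for antisymmetric `t`.
  L : Vec ℕ 2 → ℕ → ℚ
  L u j = P (hd u) j

  L-swap₂ : ∀ u j → u ∈ S₂ → j ∈ J → L (swap₂ u) j ≡ - L u j
  L-swap₂ u j u∈ j∈ = begin
    P (hd (swap₂ u)) j     ≡⟨ cong (λ i → P i j) (hd-swap₂ u u∈) ⟩
    P (w ∸ hd u) j         ≡⟨ ∑-δ ℕ._≟_ (UniqueP.upTo⁺ (suc w)) (λ k → P k j) (∈J (ℕP.m∸n≤m w (hd u))) ⟨
    (τ · P) (hd u) j       ≡⟨ τP≈-P (hd u) j (∈J (hd≤w u u∈)) j∈ ⟩
    - P (hd u) j           ∎ where open ≡-Reasoning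

  -- Every column of `P · X` is a functional fixed by U and negated by τ, and `L ⟨ J ⟩ X` lists its
  -- values on the interior even monomials, so `Vanishing` applies. The few rows kept in `L`
  -- therefore have the full rank of `P`.
  LX≡0⇒PX≡0 : ∀ X k → k ∈ J → (∀ u → u ∈ S₂ → (L ⟨ J ⟩ X) u k ≡ 0ℚ) → ∀ i → i ≤ w → (P · X) i k ≡ 0ℚ
  LX≡0⇒PX≡0 X k k∈ LX≡0 = Vanishing.vanish (λ i → (P · X) i k)
    (λ i i≤w → trans (sym (⟨⟩-assoc J J U P X i k)) (*-congʳ {X} {U · P} {P} UP≈P i k (∈J i≤w) k∈))
    (λ i i≤w → begin
      (P · X) (w ∸ i) k      ≡⟨ ∑-δ ℕ._≟_ (UniqueP.upTo⁺ (suc w)) (λ j → (P · X) j k) (∈J (ℕP.m∸n≤m w i)) ⟨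
      (τ · (P · X)) i k      ≡⟨ ⟨⟩-assoc J J τ P X i k ⟨
      ((τ · P) · X) i k      ≡⟨ *-congʳ {X} {τ · P} {⊟ P} τP≈-P i k (∈J i≤w) k∈ ⟩
      ((⊟ P) · X) i k        ≡⟨ trans (∑-cong J (λ j → neg-*ˡ (P i j) (X j k))) (∑-neg J (λ j → P i j * X j k)) ⟩
      - (P · X) i k          ∎)
    LX≡0
    where
    open ≡-Reasoning

  private
    L-ginv = ginv _≟V_ ℕ._≟_ (Unique-S M 2) L (UniqueP.upTo⁺ (suc w))

  H : ℕ → Vec ℕ 2 → ℚ
  H = proj₁ L-ginv

  LHL≡L : ∀ u j → u ∈ S₂ → j ∈ J → (L ⟨ J ⟩ (H ⟨ S₂ ⟩ L)) u j ≡ L u j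
  LHL≡L = proj₂ L-ginv

  HL : Carrier
  HL = H ⟨ S₂ ⟩ L

  P·HL≈P : P · HL ≈ P
  P·HL≈P i k i∈ k∈ = -‿zero _ _ (trans (sym (split P i k k∈)) (LX≡0⇒PX≡0 X k k∈
    (λ u u∈ → trans (split′ u k k∈) (trans (cong (_- L u k) (LHL≡L u k u∈ k∈)) (ℚP.+-inverseʳ (L u k)))) i (J∈ i∈)))
    where
    X : Carrier
    X i j = HL i j - 1# i j
    expand : ∀ (r : ℕ → ℚ) k → k ∈ J → ∑ J (λ j → r j * X j k) ≡ ∑ J (λ j → r j * HL j k) - r k
    expand r k k∈ = trans (∑-cong J (λ j → *-distribˡ-- (r j) (HL j k) (1# j k))) (trans (∑-- J (λ j → r j * HL j k) (λ j → r j * 1# j k))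
      (cong (λ z → ∑ J (λ j → r j * HL j k) - z) (∑-δʳ ℕ._≟_ (UniqueP.upTo⁺ (suc w)) r k∈)))
    split : ∀ (A : Carrier) i k → k ∈ J → (A · X) i k ≡ (A · HL) i k - A i k
    split A i k k∈ = expand (A i) k k∈
    split′ : ∀ u k → k ∈ J → (L ⟨ J ⟩ X) u k ≡ (L ⟨ J ⟩ HL) u k - L u k
    split′ u k k∈ = expand (L u) k k∈

  -- The trace of `HL` is the rank of `L`. The product `HL · P` is 6 times `HL` because P² = 6 P,
  -- while `P · HL` is `P`; cyclicity compares the two.
  6·trHL≡trP : 6ℚ * tr HL ≡ tr P
  6·trHL≡trP = begin
    6ℚ * tr HL                              ≡⟨ ∑-*ˡ J 6ℚ (λ i → HL i i) ⟩
    ∑ J (λ i → 6ℚ * HL i i)                 ≡⟨ ∑-cong∈ J (λ i i∈ → sym (HLP i i∈)) ⟩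
    tr (HL · P)                             ≡⟨ tr-comm HL P ⟩
    tr (P · HL)                             ≡⟨ tr-cong {P · HL} {P} P·HL≈P ⟩
    tr P                                    ∎
    where
    open ≡-Reasoning
    HLP : ∀ i → i ∈ J → (HL · P) i i ≡ 6ℚ * HL i i
    HLP i i∈ = trans (⟨⟩-assoc S₂ J H L P i i) (trans
      (∑-cong∈ S₂ (λ u u∈ → trans (cong (H i u *_) (PP≈6P (hd u) i (∈J (hd≤w u u∈)) i∈)) (*-exchange (H i u) 6ℚ (L u i))))
      (sym (∑-*ˡ S₂ 6ℚ (λ u → H i u * L u i))))

  q : Vec ℕ 2 → Vec ℕ 2 → ℚ
  q u v = ½ * (ind (u ≟V v) - ind (u ≟V swap₂ v))

  act-q : ∀ (t : Vec ℕ 2 → ℚ) v → v ∈ S₂ → ∑ S₂ (λ u → t u * q u v) ≡ ½ * (t v - t (swap₂ v))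
  act-q t v v∈ = begin
    ∑ S₂ (λ u → t u * q u v)
      ≡⟨ ∑-cong S₂ (λ u → lem (t u) ½ (ind (u ≟V v)) (ind (u ≟V swap₂ v))) ⟩
    ∑ S₂ (λ u → ½ * (t u * ind (u ≟V v) - t u * ind (u ≟V swap₂ v)))
      ≡⟨ ∑-*ˡ S₂ ½ (λ u → t u * ind (u ≟V v) - t u * ind (u ≟V swap₂ v)) ⟨
    ½ * ∑ S₂ (λ u → t u * ind (u ≟V v) - t u * ind (u ≟V swap₂ v))
      ≡⟨ cong (½ *_) (trans (∑-- S₂ (λ u → t u * ind (u ≟V v)) (λ u → t u * ind (u ≟V swap₂ v)))
           (cong₂ _-_ (∑-δʳ _≟V_ (Unique-S M 2) t v∈) (∑-δʳ _≟V_ (Unique-S M 2) t (swap₂-∈ M v v∈)))) ⟩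
    ½ * (t v - t (swap₂ v)) ∎
    where
    open ≡-Reasoning
    lem : ∀ t c a b → t * (c * (a - b)) ≡ c * (t * a - t * b)
    lem = solve-∀ ℚ-ring

  q-sym : ∀ u v → q u v ≡ q v u
  q-sym u v = cong₂ (λ a b → ½ * (a - b)) (ind-⇔ (u ≟V v) (v ≟V u) sym sym)
    (ind-⇔ (u ≟V swap₂ v) (v ≟V swap₂ u) (λ { refl → sym (swap₂-involutive v) }) (λ { refl → sym (swap₂-involutive u) }))

  q-act : ∀ (f : Vec ℕ 2 → ℚ) u → u ∈ S₂ → ∑ S₂ (λ v → q u v * f v) ≡ ½ * (f u - f (swap₂ u))
  q-act f u u∈ = trans (∑-cong S₂ (λ v → trans (ℚP.*-comm (q u v) (f v)) (cong (f v *_) (q-sym u v)))) (act-q f u u∈)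

  half-double : ∀ a → ½ * (a - (- a)) ≡ a
  half-double a = trans (lem a ½) (trans (cong (_* a) {½ + ½} {1ℚ} refl) (ℚP.*-identityˡ a))
    where
    lem : ∀ a c → c * (a - (- a)) ≡ (c + c) * a
    lem = solve-∀ ℚ-ring

  -- K = (1 - L H) q projects onto the antisymmetric t with t L = 0: 1 - L H projects onto the left
  -- kernel of L, and the antisymmetriser q preserves this kernel, because L changes sign under
  -- `swap₂` and so q L = L.
  LH K : Vec ℕ 2 → Vec ℕ 2 → ℚ
  LH = L ⟨ J ⟩ H
  K u v = q u v - (LH ⟨ S₂ ⟩ q) u v

  act : (Vec ℕ 2 → ℚ) → {I : Set} → (Vec ℕ 2 → I → ℚ) → I → ℚ
  act t A k = ∑ S₂ (λ u → t u * A u k)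

  act-assoc : ∀ t {I I′ : Set} (xs : List I) (A : Vec ℕ 2 → I → ℚ) (B : I → I′ → ℚ) k → act t (A ⟨ xs ⟩ B) k ≡ ∑ xs (λ i → act t A i * B i k)
  act-assoc t xs A B k = sym (⟨⟩-assoc S₂ xs (λ (_ : ℕ) → t) A B 0 k)

  act-K : ∀ t v → v ∈ S₂ → let y = λ u → t u - act t LH u in act t K v ≡ ½ * (y v - y (swap₂ v))
  act-K t v v∈ = begin
    act t K v
      ≡⟨ ∑-cong S₂ (λ u → *-distribˡ-- (t u) (q u v) ((LH ⟨ S₂ ⟩ q) u v)) ⟩
    ∑ S₂ (λ u → t u * q u v - t u * (LH ⟨ S₂ ⟩ q) u v)
      ≡⟨ ∑-- S₂ (λ u → t u * q u v) (λ u → t u * (LH ⟨ S₂ ⟩ q) u v) ⟩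
    act t q v - act t (LH ⟨ S₂ ⟩ q) v
      ≡⟨ cong₂ _-_ (act-q t v v∈) (trans (act-assoc t S₂ LH q v) (act-q (act t LH) v v∈)) ⟩
    ½ * (t v - t (swap₂ v)) - ½ * (act t LH v - act t LH (swap₂ v))
      ≡⟨ lem₂ ½ (t v) (t (swap₂ v)) (act t LH v) (act t LH (swap₂ v)) ⟩
    _ ∎
    where
    open ≡-Reasoning
    lem₂ : ∀ c a b x y → c * (a - b) - c * (x - y) ≡ c * ((a - x) - (b - y))
    lem₂ = solve-∀ ℚ-ring

  Antisym : (Vec ℕ 2 → ℚ) → Set
  Antisym t = ∀ u → u ∈ S₂ → t (swap₂ u) ≡ - t u

  K-fix : ∀ t → Antisym t → (∀ j → j ∈ J → act t L j ≡ 0ℚ) → ∀ v → v ∈ S₂ → act t K v ≡ t v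
  K-fix t anti tL≡0 v v∈ = trans (act-K t v v∈) (trans (cong₂ (λ a b → ½ * (a - b)) (y≡t v)
    (trans (y≡t (swap₂ v)) (anti v v∈))) (half-double (t v)))
    where
    y≡t : ∀ u → t u - act t LH u ≡ t u
    y≡t u = trans (cong (λ z → t u - z) (trans (act-assoc t J L H u) (∑-zero∈ J (λ j j∈ → trans (cong (_* H j u) (tL≡0 j j∈)) (ℚP.*-zeroˡ (H j u))))))
      (ℚP.+-identityʳ (t u))

  K-antisym : ∀ t → Antisym (act t K)
  K-antisym t u u∈ = trans (act-K t (swap₂ u) (swap₂-∈ M u u∈)) (trans (cong (λ z → ½ * (y (swap₂ u) - y z)) (swap₂-involutive u))
    (trans (lem ½ (y (swap₂ u)) (y u)) (cong -_ (sym (act-K t u u∈)))))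
    where
    y : Vec ℕ 2 → ℚ
    y u = t u - act t LH u
    lem : ∀ c a b → c * (a - b) ≡ - (c * (b - a))
    lem = solve-∀ ℚ-ring

  K-kills-L : ∀ t j → j ∈ J → act (act t K) L j ≡ 0ℚ
  K-kills-L t j j∈ = begin
    ∑ S₂ (λ v → act t K v * L v j)
      ≡⟨ ∑-cong∈ S₂ (λ v v∈ → cong (_* L v j) (trans (act-K t v v∈) (sym (act-q y v v∈)))) ⟩
    ∑ S₂ (λ v → act y q v * L v j)
      ≡⟨ act-assoc y S₂ q L j ⟨
    act y (q ⟨ S₂ ⟩ L) j
      ≡⟨ ∑-cong∈ S₂ (λ u u∈ → cong (y u *_) (trans (q-act (λ v → L v j) u u∈)
           (trans (cong (λ z → ½ * (L u j - z)) (L-swap₂ u j u∈ j∈)) (half-double (L u j))))) ⟩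
    ∑ S₂ (λ u → (t u - act t LH u) * L u j)
      ≡⟨ trans (∑-cong S₂ (λ u → *-distribʳ-- (t u) (act t LH u) (L u j))) (∑-- S₂ (λ u → t u * L u j) (λ u → act t LH u * L u j)) ⟩
    act t L j - act (act t LH) L j
      ≡⟨ cong (λ z → act t L j - z) (trans (sym (act-assoc t S₂ LH L j))
           (∑-cong∈ S₂ (λ u u∈ → cong (t u *_) (trans (⟨⟩-assoc J S₂ L H L u j) (LHL≡L u j u∈ j∈))))) ⟩
    act t L j - act t L j
      ≡⟨ ℚP.+-inverseʳ (act t L j) ⟩
    0ℚ ∎
    where
    open ≡-Reasoning
    y : Vec ℕ 2 → ℚ
    y u = t u - act t LH u

  trace-K : ∑ S₂ (λ u → K u u) ≡ ∑ S₂ (λ u → q u u) - tr HL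
  trace-K = trans (∑-- S₂ (λ u → q u u) (λ u → (LH ⟨ S₂ ⟩ q) u u)) (cong (λ z → ∑ S₂ (λ u → q u u) - z) (begin
    ∑ S₂ (λ u → (LH ⟨ S₂ ⟩ q) u u)     ≡⟨ tr⟨⟩-comm S₂ S₂ LH q ⟩
    ∑ S₂ (λ u → (q ⟨ S₂ ⟩ LH) u u)     ≡⟨ ∑-cong∈ S₂ (λ u u∈ → trans (q-act (λ v → LH v u) u u∈)
                                            (trans (cong (λ z → ½ * (LH u u - z)) (LH-swap u u u∈)) (half-double (LH u u)))) ⟩
    ∑ S₂ (λ u → (L ⟨ J ⟩ H) u u)       ≡⟨ tr⟨⟩-comm S₂ J L H ⟩
    tr HL                              ∎))
    where
    open ≡-Reasoning
    LH-swap : ∀ u x → u ∈ S₂ → LH (swap₂ u) x ≡ - LH u x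
    LH-swap u x u∈ = trans (∑-cong∈ J (λ j j∈ → trans (cong (_* H j x) (L-swap₂ u j u∈ j∈)) (neg-*ˡ (L u j) (H j x)))) (∑-neg J (λ j → L u j * H j x))

module PeriodForms (h : ℕ) where
  open BinaryForms h
  open PeriodSpace h

  form : (Vec ℕ 2 → ℚ) → ℚ → ℚ → ℚ
  form t x y = ∑ S₂ (λ u → t u * mon (hd u) x y)

  fval≡form : ∀ t x y zs → fval M 2 t (x ∷ y ∷ zs) ≡ form t x y
  fval≡form t x y zs = ∑-cong∈ S₂ (λ u u∈ → cong (t u *_) (value u u∈))
    where
    value : ∀ u → u ∈ S₂ → evM (exps u) (x ∷ y ∷ zs) ≡ mon (hd u) x y
    value (a ∷ b ∷ []) u∈ = cong (pow x (a ∸ 1) *_) (trans (ℚP.*-identityʳ (pow y (b ∸ 1))) (cong (pow y) (hd-swap₂ (a ∷ b ∷ []) u∈)))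

  form-swap : ∀ t x y → form t y x ≡ form (t ∘ swap₂) x y
  form-swap t x y = trans (sym (∑-swap₂ M (λ u → t u * mon (hd u) y x)))
    (∑-cong∈ S₂ (λ u u∈ → cong (t (swap₂ u) *_) (trans (cong (λ i → mon i y x) (hd-swap₂ u u∈)) (mon-swap (hd u) (hd≤w u u∈) y x))))

  form-even : ∀ t x y → form t (- x) y ≡ form t x y
  form-even t x y = trans (sym (fval≡form t (- x) y [])) (trans (fval-even M 1 t x (y ∷ [])) (fval≡form t x y []))

  form-antisym : ∀ t → Antisym t → ∀ x y → form t y x ≡ - form t x y
  form-antisym t anti x y = trans (form-swap t x y) (trans
    (∑-cong∈ S₂ (λ u u∈ → trans (cong (_* mon (hd u) x y) (anti u u∈)) (neg-*ˡ (t u) (mon (hd u) x y))))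
    (∑-neg S₂ (λ u → t u * mon (hd u) x y)))

  -- The value at (x, y) of f moved by 1 + U + U².
  orbit : ℚ → ℚ → (ℚ → ℚ → ℚ) → ℚ
  orbit x y f = f x y + (f y (y - x) + f (y - x) ((y - x) - y))

  ev-+ : ∀ u v x y → ev (λ j → u j + v j) x y ≡ ev u x y + ev v x y
  ev-+ u v x y = trans (∑-cong J (λ j → ℚP.*-distribʳ-+ (mon j x y) (u j) (v j))) (∑-+ J (λ j → u j * mon j x y) (λ j → v j * mon j x y))

  ev-P : ∀ i → i ∈ J → ∀ x y → ev (P i) x y ≡ orbit x y (mon i) - orbit y x (mon i)
  ev-P i i∈ x y = begin
    ev (P i) x y
      ≡⟨ ∑-cong∈ J (λ j j∈ → trans (cong (_* mon j x y) (expand j j∈)) (*-distribʳ-- (Nm i j) ((Nm · τ) i j) (mon j x y))) ⟩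
    ∑ J (λ j → Nm i j * mon j x y - (Nm · τ) i j * mon j x y)
      ≡⟨ ∑-- J (λ j → Nm i j * mon j x y) (λ j → (Nm · τ) i j * mon j x y) ⟩
    ev (Nm i) x y - ev ((Nm · τ) i) x y
      ≡⟨ cong₂ _-_ (ev-Nm x y) (trans (ev-act {τ} rep-τ (Nm i) x y) (ev-Nm y x)) ⟩
    orbit x y (mon i) - orbit y x (mon i) ∎
    where
    open ≡-Reasoning
    expand : ∀ j → j ∈ J → P i j ≡ Nm i j - (Nm · τ) i j
    expand j j∈ = trans (distribˡ Nm 1# (⊟ τ) i j i∈ j∈) (cong₂ _+_ (*-identityʳ Nm i j i∈ j∈)
      (sym (RingP.-‿distribʳ-* matrixRing Nm τ i j i∈ j∈)))
    ev-Nm : ∀ x y → ev (Nm i) x y ≡ orbit x y (mon i)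
    ev-Nm x y = trans (ev-+ (1# i) (λ j → U i j + (U · U) i j) x y)
      (cong₂ _+_ (rep-1 i i∈ x y) (trans (ev-+ (U i) ((U · U) i) x y) (cong₂ _+_ (rep-U i i∈ x y) (rep-UU i i∈ x y))))

  ev-act-L : ∀ t x y → ev (act t L) x y ≡ orbit x y (form t) - orbit y x (form t)
  ev-act-L t x y = begin
    ∑ J (λ j → ∑ S₂ (λ u → t u * P (hd u) j) * mon j x y)
      ≡⟨ ∑-cong J (λ j → trans (∑-*ʳ S₂ (mon j x y) (λ u → t u * P (hd u) j)) (∑-cong S₂ (λ u → ℚP.*-assoc (t u) (P (hd u) j) (mon j x y)))) ⟩
    ∑ J (λ j → ∑ S₂ (λ u → t u * (P (hd u) j * mon j x y)))
      ≡⟨ ∑-swap J S₂ (λ j u → t u * (P (hd u) j * mon j x y)) ⟩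
    ∑ S₂ (λ u → ∑ J (λ j → t u * (P (hd u) j * mon j x y)))
      ≡⟨ ∑-cong∈ S₂ (λ u u∈ → trans (sym (∑-*ˡ J (t u) (λ j → P (hd u) j * mon j x y)))
           (trans (cong (t u *_) (ev-P (hd u) (∈J (hd≤w u u∈)) x y)) (*-distribˡ-- (t u) (orbit x y (mon (hd u))) (orbit y x (mon (hd u)))))) ⟩
    ∑ S₂ (λ u → t u * orbit x y (mon (hd u)) - t u * orbit y x (mon (hd u)))
      ≡⟨ ∑-- S₂ (λ u → t u * orbit x y (mon (hd u))) (λ u → t u * orbit y x (mon (hd u))) ⟩
    ∑ S₂ (λ u → t u * orbit x y (mon (hd u))) - ∑ S₂ (λ u → t u * orbit y x (mon (hd u)))
      ≡⟨ cong₂ _-_ (sum-orbit x y) (sum-orbit y x) ⟩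
    orbit x y (form t) - orbit y x (form t) ∎
    where
    open ≡-Reasoning
    lem₃ : ∀ t a b c → t * (a + (b + c)) ≡ t * a + (t * b + t * c)
    lem₃ = solve-∀ ℚ-ring
    sum-orbit : ∀ x y → ∑ S₂ (λ u → t u * orbit x y (mon (hd u))) ≡ orbit x y (form t)
    sum-orbit x y = trans (∑-cong S₂ (λ u → lem₃ (t u) (mon (hd u) x y) (mon (hd u) y (y - x)) (mon (hd u) (y - x) ((y - x) - y))))
      (trans (∑-+ S₂ _ _) (cong (form t x y +_) (∑-+ S₂ _ _)))

  module _ (t : Vec ℕ 2 → ℚ) (anti : ∀ x y → form t y x ≡ - form t x y) where
    private
      f = form t

    even₂ : ∀ x y → f x (- y) ≡ f x y
    even₂ x y = trans (anti (- y) x) (trans (cong -_ (form-even t y x)) (sym (anti y x)))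

    -- Antisymmetry and evenness turn f(y, y - x) into -f(y - x, y) and f(y - x, -x) into f(y - x,
    -- x). On antisymmetric even forms 1 + U + U² is therefore the defect of the period equation.
    orbit≡ : ∀ x y → orbit x y f ≡ f x y - (f (y - x) y - f (y - x) x)
    orbit≡ x y = trans (cong₂ (λ a b → f x y + (a + b)) (anti (y - x) y)
        (trans (cong (f (y - x)) (lem₁ x y)) (even₂ (y - x) x)))
      (lem₂ (f x y) (f (y - x) y) (f (y - x) x))
      where
      lem₁ : ∀ x y → (y - x) - y ≡ - x
      lem₁ = solve-∀ ℚ-ring
      lem₂ : ∀ a b c → a + ((- b) + c) ≡ a - (b - c)
      lem₂ = solve-∀ ℚ-ring

    orbit-antisym : ∀ x y → orbit y x f ≡ - orbit x y f
    orbit-antisym x y = trans (orbit≡ y x) (trans (cong₂ _-_ (anti x y) (cong₂ _-_ (flip x) (flip y)))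
      (trans (lem (f x y) (f (y - x) x) (f (y - x) y)) (cong -_ (sym (orbit≡ x y)))))
      where
      flip : ∀ z → f (x - y) z ≡ f (y - x) z
      flip z = trans (cong (λ d → f d z) (neg-diff x y)) (form-even t (y - x) z)
      lem : ∀ a b c → (- a) - (b - c) ≡ - (a - (c - b))
      lem = solve-∀ ℚ-ring

  period⇒antisym : ∀ t → PeriodEq (fval M 2 t) → ∀ x y → form t y x ≡ - form t x y
  period⇒antisym t eq x y = trans (sym (fval≡form t y x [])) (trans
    (period-antisym {fval M 2 t} (fval-even M 1 t) eq x y []) (cong -_ (fval≡form t x y [])))

  antisym-coeffs : ∀ t → (∀ x y → form t y x ≡ - form t x y) → Antisym t
  antisym-coeffs t anti u u∈ = trans (lem (t u) (t (swap₂ u))) (trans (cong (_- t u) (trans (sym pick)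
      (univariate-coeff S₂ (λ v → t v + t (swap₂ v)) hd vanishing (hd u)))) (ℚP.+-identityˡ (- t u)))
    where
    lem : ∀ a b → b ≡ (a + b) - a
    lem = solve-∀ ℚ-ring
    vanishing : ∀ x → ∑ S₂ (λ v → (t v + t (swap₂ v)) * pow x (hd v)) ≡ 0ℚ
    vanishing x = trans (∑-cong S₂ (λ v → trans (lem₁ (t v) (t (swap₂ v)) (pow x (hd v)))
        (cong (λ z → t v * (pow x (hd v) * z) + t (swap₂ v) * (pow x (hd v) * z)) (sym (pow-1 (w ∸ hd v))))))
      (trans (∑-+ S₂ (λ v → t v * mon (hd v) x 1ℚ) (λ v → t (swap₂ v) * mon (hd v) x 1ℚ))
        (trans (cong (form t x 1ℚ +_) (trans (sym (form-swap t x 1ℚ)) (anti x 1ℚ))) (ℚP.+-inverseʳ (form t x 1ℚ))))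
      where
      lem₁ : ∀ a b p → (a + b) * p ≡ a * (p * 1ℚ) + b * (p * 1ℚ)
      lem₁ = solve-∀ ℚ-ring
    pick : ∑ S₂ (λ v → (t v + t (swap₂ v)) * ind (hd v ℕ.≟ hd u)) ≡ t u + t (swap₂ u)
    pick = trans (∑-cong∈ S₂ (λ v v∈ → cong ((t v + t (swap₂ v)) *_) (ind-⇔ (hd v ℕ.≟ hd u) (v ≟V u) (hd-injective v u v∈ u∈) (λ { refl → refl }))))
      (∑-δʳ _≟V_ (Unique-S M 2) (λ v → t v + t (swap₂ v)) u∈)

  orbit-zero : ∀ t → PeriodEq (fval M 2 t) → ∀ x y → orbit x y (form t) ≡ 0ℚ
  orbit-zero t eq x y = trans (orbit≡ t (period⇒antisym t eq) x y) (trans (cong (λ z → form t x y - z)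
      (sym (trans (sym (fval≡form t x y [])) (trans (eq x y []) (cong₂ _-_ (fval≡form t (y - x) y []) (fval≡form t (y - x) x []))))))
    (ℚP.+-inverseʳ (form t x y)))

  fix : ∀ t → PeriodEq (fval M 2 t) → ∀ v → v ∈ S₂ → act t K v ≡ t v
  fix t eq = K-fix t (antisym-coeffs t (period⇒antisym t eq)) (ev-injective (act t L) (λ _ → 0ℚ) λ x y →
    trans (ev-act-L t x y) (trans (cong₂ _-_ (orbit-zero t eq x y) (orbit-zero t eq y x))
      (sym (∑-zero∈ J (λ j _ → ℚP.*-zeroˡ (mon j x y))))))

  into : ∀ t → PeriodEq (fval M 2 (act t K))
  into t x y zs = trans (fval≡form s x y zs) (trans (-‿zero _ _ (trans (sym (orbit≡ s anti x y)) zero-orbit))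
    (sym (cong₂ _-_ (fval≡form s (y - x) y zs) (fval≡form s (y - x) x zs))))
    where
    s = act t K
    anti = form-antisym s (K-antisym t)
    zero-orbit : orbit x y (form s) ≡ 0ℚ
    -- That `L` kills `s` only says that the orbit sum is symmetric in x and y. For an antisymmetric
    -- form it is antisymmetric too, so its double is 0.
    zero-orbit = x+x≡0⇒x≡0 _ (trans (lem (orbit x y (form s))) (trans (cong (λ z → orbit x y (form s) - z) (sym (orbit-antisym s anti x y)))
      (trans (sym (ev-act-L s x y)) (∑-zero∈ J (λ j j∈ → trans (cong (_* mon j x y) (K-kills-L t j j∈)) (ℚP.*-zeroˡ (mon j x y)))))))
      where
      lem : ∀ a → a + a ≡ a - (- a)
      lem = solve-∀ ℚ-ring

-- Generating series

-- Traces live in ℚ and coefficients of series in ℤ; the final identity is proved after this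
-- embedding and pulled back by `ι-injective`.
ι : ℤ → ℚ
ι i = i ℚ./ 1

private
  toℚᵘ-ι : ∀ i → ℚ.toℚᵘ (ι i) ℚᵘ.≃ ℚᵘ.mkℚᵘ i 0
  toℚᵘ-ι i = ℚP.toℚᵘ-fromℚᵘ (ℚᵘ.mkℚᵘ i 0)

ι-+ : ∀ i j → ι (i ℤ.+ j) ≡ ι i + ι j
ι-+ i j = ℚP.toℚᵘ-injective (begin
  ℚ.toℚᵘ (ι (i ℤ.+ j))                    ≈⟨ toℚᵘ-ι (i ℤ.+ j) ⟩
  ℚᵘ.mkℚᵘ (i ℤ.+ j) 0                     ≈⟨ ℚᵘ.*≡* (cong (λ k → k ℤ.* ℤ.+ 1) (sym (cong₂ ℤ._+_ (ℤP.*-identityʳ i) (ℤP.*-identityʳ j)))) ⟩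
  ℚᵘ.mkℚᵘ i 0 ℚᵘ.+ ℚᵘ.mkℚᵘ j 0            ≈⟨ ℚᵘP.+-cong (toℚᵘ-ι i) (toℚᵘ-ι j) ⟨
  ℚ.toℚᵘ (ι i) ℚᵘ.+ ℚ.toℚᵘ (ι j)          ≈⟨ ℚP.toℚᵘ-homo-+ (ι i) (ι j) ⟨
  ℚ.toℚᵘ (ι i + ι j)                      ∎)
  where open SetoidReasoning ℚᵘP.≃-setoid

ι-* : ∀ i j → ι (i ℤ.* j) ≡ ι i * ι j
ι-* i j = ℚP.toℚᵘ-injective (begin
  ℚ.toℚᵘ (ι (i ℤ.* j))                    ≈⟨ toℚᵘ-ι (i ℤ.* j) ⟩
  ℚᵘ.mkℚᵘ i 0 ℚᵘ.* ℚᵘ.mkℚᵘ j 0            ≈⟨ ℚᵘP.*-cong (toℚᵘ-ι i) (toℚᵘ-ι j) ⟨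
  ℚ.toℚᵘ (ι i) ℚᵘ.* ℚ.toℚᵘ (ι j)          ≈⟨ ℚP.toℚᵘ-homo-* (ι i) (ι j) ⟨
  ℚ.toℚᵘ (ι i * ι j)                      ∎)
  where open SetoidReasoning ℚᵘP.≃-setoid

ι-- : ∀ i j → ι (i ℤ.- j) ≡ ι i - ι j
ι-- i j = trans (lem (ι (i ℤ.- j)) (ι j)) (cong (_- ι j) (trans (sym (ι-+ (i ℤ.- j) j))
  (cong ι (trans (ℤP.+-assoc i (ℤ.- j) j) (trans (cong (λ k → i ℤ.+ k) (ℤP.+-inverseˡ j)) (ℤP.+-identityʳ i))))))
  where
  lem : ∀ a b → a ≡ (a + b) - b
  lem = solve-∀ ℚ-ring

ι-injective : ∀ {i j} → ι i ≡ ι j → i ≡ j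
ι-injective {i} {j} eq with ℚᵘP.≃-trans (ℚᵘP.≃-sym (toℚᵘ-ι i)) (ℚᵘP.≃-trans (ℚᵘP.≃-reflexive (cong ℚ.toℚᵘ eq)) (toℚᵘ-ι j))
... | ℚᵘ.*≡* i*1≡j*1 = trans (sym (ℤP.*-identityʳ i)) (trans i*1≡j*1 (ℤP.*-identityʳ j))

ι-sum : {I : Set} (f : I → ℤ) (xs : List I) → ι (foldr ℤ._+_ (ℤ.+ 0) (map f xs)) ≡ ∑ xs (ι ∘ f)
ι-sum f []       = refl
ι-sum f (x ∷ xs) = trans (ι-+ (f x) _) (cong (λ z → ι (f x) + z) (ι-sum f xs))

ι-⋆ : ∀ f g n → ι ((f ⋆ g) n) ≡ ∑ (upTo (suc n)) (λ a → ι (f a) * ι (g (n ∸ a)))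
ι-⋆ f g n = trans (ι-sum (λ a → f a ℤ.* g (n ∸ a)) (upTo (suc n))) (∑-cong (upTo (suc n)) (λ a → ι-* (f a) (g (n ∸ a))))

ι-if : ∀ b → ι (if b then ℤ.+ 1 else ℤ.+ 0) ≡ (if b then 1ℚ else 0ℚ)
ι-if true  = refl
ι-if false = refl

ι-xpow : ∀ k a → ι (xpow k a) ≡ ind (k ℕ.≟ a)
ι-xpow k a with a ℕ.≡ᵇ k | ℕP.≡ᵇ⇒≡ a k | ℕP.≡⇒≡ᵇ a k
... | true  | to | _    = sym (ind-yes (k ℕ.≟ a) (sym (to _)))
... | false | _  | from = sym (ind-no (k ℕ.≟ a) (λ eq → from (sym eq)))

ι-xpow-⋆ : ∀ k f n → ι ((xpow k ⋆ f) n) ≡ ∑ (upTo (suc n)) (λ a → ind (k ℕ.≟ a) * ι (f (n ∸ a)))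
ι-xpow-⋆ k f n = trans (ι-⋆ (xpow k) f n) (∑-cong (upTo (suc n)) (λ a → cong (_* ι (f (n ∸ a))) (ι-xpow k a)))

xpow-⋆-shift : ∀ k f m → ι ((xpow k ⋆ f) (k ℕ.+ m)) ≡ ι (f m)
xpow-⋆-shift k f m = trans (ι-xpow-⋆ k f (k ℕ.+ m)) (trans
  (∑-δ ℕ._≟_ (UniqueP.upTo⁺ (suc (k ℕ.+ m))) (λ a → ι (f (k ℕ.+ m ∸ a))) (∈P.∈-upTo⁺ (s≤s (ℕP.m≤m+n k m))))
  (cong (ι ∘ f) (ℕP.m+n∸m≡n k m)))

xpow-⋆-below : ∀ k f n → n < k → ι ((xpow k ⋆ f) n) ≡ 0ℚ
xpow-⋆-below k f n n<k = trans (ι-xpow-⋆ k f n)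
  (∑-δ∉ ℕ._≟_ (upTo (suc n)) (λ a → ι (f (n ∸ a))) (λ k∈ → ℕP.<⇒≱ n<k (ℕP.≤-pred (∈P.∈-upTo⁻ k∈))))

ι-𝕆 : ∀ n → ι (𝕆 n) ≡ o n
ι-𝕆 0 = refl
ι-𝕆 1 = refl
ι-𝕆 2 = refl
ι-𝕆 (suc (suc (suc m))) = trans (xpow-⋆-shift 3 (geom 2) m) (trans (ι-if ⌊ (m ℕ.% 2) ℕ.≟ 0 ⌋)
  (ind-⇔ ((m ℕ.% 2) ℕ.≟ 0) (odd3? (3 ℕ.+ m)) (λ h → s≤s (s≤s (s≤s z≤n)) , to m h) (λ h → from m (proj₂ h))))
  where
  to : ∀ m → m ℕ.% 2 ≡ 0 → suc m ℕ.% 2 ≡ 1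
  to zero          _ = refl
  to (suc (suc m)) h = to m h
  from : ∀ m → suc m ℕ.% 2 ≡ 1 → m ℕ.% 2 ≡ 0
  from zero          _ = refl
  from (suc (suc m)) h = from m h

num : ℕ → ℕ → ℚ
num N r = ∑ (S N r) (λ _ → 1ℚ)

num-suc : ∀ N r → num N (suc r) ≡ ∑ (upTo (suc N)) (λ a → o a * num (N ∸ a) r)
num-suc N r = trans (∑-S N r (λ _ → 1ℚ)) (∑-oddsDown N (λ a → num (N ∸ a) r))

ι-powS : ∀ k n → ι (powS 𝕆 k n) ≡ num n k
ι-powS zero    zero    = refl
ι-powS zero    (suc n) = refl
ι-powS (suc k) n       = trans (ι-⋆ 𝕆 (powS 𝕆 k) n) (trans
  (∑-cong (upTo (suc n)) (λ a → cong₂ _*_ (ι-𝕆 a) (ι-powS k (n ∸ a)))) (sym (num-suc n k)))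

γ₄ γ₆ : ℕ → ℚ
γ₄ n = ι (geom 4 n)
γ₆ n = ι (geom 6 n)

g₄₆ : ℕ → ℚ
g₄₆ m = ∑ (upTo (suc m)) (λ a → γ₄ a * γ₆ (m ∸ a))

ι-𝕊-shift : ∀ m → ι (𝕊 (12 ℕ.+ m)) ≡ g₄₆ m
ι-𝕊-shift m = trans (xpow-⋆-shift 12 (geom 4 ⋆ geom 6) m) (ι-⋆ (geom 4) (geom 6) m)

-- The increase from g₄₆(m) to g₄₆(12 + m): of the first twelve summands only a = 0, 4, 8 survive,
-- and the later ones are those of g₄₆(m), as 12 is a multiple of 4. Exactly one of m, m + 4, m + 8
-- is divisible by 6 when m is even, and none when m is odd.
window : ℕ → ℚ
window m = γ₆ m + (γ₆ (8 ℕ.+ m) + γ₆ (4 ℕ.+ m))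

g₄₆-step : ∀ m → g₄₆ (12 ℕ.+ m) ≡ window m + g₄₆ m
g₄₆-step m = trans (peel 12 m (λ a → γ₄ a * γ₆ (12 ℕ.+ m ∸ a)))
  (cong (λ z → z + g₄₆ m) (lem (γ₆ m) (γ₆ (11 ℕ.+ m)) (γ₆ (10 ℕ.+ m)) (γ₆ (9 ℕ.+ m)) (γ₆ (8 ℕ.+ m)) (γ₆ (7 ℕ.+ m))
    (γ₆ (6 ℕ.+ m)) (γ₆ (5 ℕ.+ m)) (γ₆ (4 ℕ.+ m)) (γ₆ (3 ℕ.+ m)) (γ₆ (2 ℕ.+ m)) (γ₆ (1 ℕ.+ m))))
  where
  peel : ∀ k m (f : ℕ → ℚ) → ∑ (upTo (suc (k ℕ.+ m))) f ≡ ∑ (upTo k) f + ∑ (upTo (suc m)) (λ a → f (k ℕ.+ a))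
  peel zero    m f = sym (ℚP.+-identityˡ (∑ (upTo (suc m)) f))
  peel (suc k) m f = begin
    ∑ (upTo (suc (suc (k ℕ.+ m)))) f                                         ≡⟨ ∑-upTo-0 (suc (k ℕ.+ m)) f ⟩
    f 0 + ∑ (upTo (suc (k ℕ.+ m))) (f ∘ suc)                                 ≡⟨ cong (f 0 +_) (peel k m (f ∘ suc)) ⟩
    f 0 + (∑ (upTo k) (f ∘ suc) + ∑ (upTo (suc m)) (λ a → f (suc k ℕ.+ a)))  ≡⟨ ℚP.+-assoc (f 0) _ _ ⟨
    f 0 + ∑ (upTo k) (f ∘ suc) + ∑ (upTo (suc m)) (λ a → f (suc k ℕ.+ a))    ≡⟨ cong (_+ ∑ (upTo (suc m)) (λ a → f (suc k ℕ.+ a))) (∑-upTo-0 k f) ⟨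
    ∑ (upTo (suc k)) f + ∑ (upTo (suc m)) (λ a → f (suc k ℕ.+ a))            ∎
    where open ≡-Reasoning
  lem : ∀ a b c d e f g h i j k l →
    1ℚ * a + (0ℚ * b + (0ℚ * c + (0ℚ * d + (1ℚ * e + (0ℚ * f + (0ℚ * g + (0ℚ * h + (1ℚ * i + (0ℚ * j + (0ℚ * k + (0ℚ * l + 0ℚ)))))))))))
      ≡ a + (e + i)
  lem = solve-∀ ℚ-ring

window-even : ∀ k → window (k ℕ.* 2) ≡ 1ℚ
window-even 0 = refl
window-even 1 = refl
window-even 2 = refl
window-even (suc (suc (suc k))) = window-even k

window-odd : ∀ k → window (suc (k ℕ.* 2)) ≡ 0ℚ
window-odd 0 = refl
window-odd 1 = refl
window-odd 2 = refl
window-odd (suc (suc (suc k))) = window-odd k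

g₄₆-odd : ∀ k → g₄₆ (suc (k ℕ.* 2)) ≡ 0ℚ
g₄₆-odd 0 = refl
g₄₆-odd 1 = refl
g₄₆-odd 2 = refl
g₄₆-odd 3 = refl
g₄₆-odd 4 = refl
g₄₆-odd 5 = refl
g₄₆-odd (suc (suc (suc (suc (suc (suc k)))))) = trans (g₄₆-step (suc (k ℕ.* 2)))
  (trans (cong (λ z → z + g₄₆ (suc (k ℕ.* 2))) (window-odd k)) (trans (ℚP.+-identityˡ (g₄₆ (suc (k ℕ.* 2)))) (g₄₆-odd k)))

ι-𝕊-odd : ∀ k → ι (𝕊 (suc (k ℕ.* 2))) ≡ 0ℚ
ι-𝕊-odd k with suc (k ℕ.* 2) ℕ.<? 12
... | yes lt = xpow-⋆-below 12 (geom 4 ⋆ geom 6) (suc (k ℕ.* 2)) lt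
ι-𝕊-odd (suc (suc (suc (suc (suc (suc k)))))) | no _ = trans (ι-𝕊-shift (suc (k ℕ.* 2))) (g₄₆-odd k)
ι-𝕊-odd 0 | no ¬lt = ⊥-elim (¬lt (ℕP.m≤m+n 2 10))
ι-𝕊-odd 1 | no ¬lt = ⊥-elim (¬lt (ℕP.m≤m+n 4 8))
ι-𝕊-odd 2 | no ¬lt = ⊥-elim (¬lt (ℕP.m≤m+n 6 6))
ι-𝕊-odd 3 | no ¬lt = ⊥-elim (¬lt (ℕP.m≤m+n 8 4))
ι-𝕊-odd 4 | no ¬lt = ⊥-elim (¬lt (ℕP.m≤m+n 10 2))
ι-𝕊-odd 5 | no ¬lt = ⊥-elim (¬lt (ℕP.m≤m+n 12 0))

nat : ℕ → ℚ
nat zero    = 0ℚ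
nat (suc n) = nat n + 1ℚ

∑-1 : ∀ n → ∑ (upTo n) (λ _ → 1ℚ) ≡ nat n
∑-1 zero    = refl
∑-1 (suc n) = trans (∑-upTo-suc n (λ _ → 1ℚ)) (cong (_+ 1ℚ) (∑-1 n))

-- The trace of U on forms of degree n: Uₙ(1/2) for the Chebyshev polynomial of the second kind.
cheb : ℕ → ℚ
cheb 0             = 1ℚ
cheb 1             = 1ℚ
cheb (suc (suc n)) = cheb (suc n) - cheb n

-- The recursion has characteristic polynomial T² - T + 1, whose roots are the primitive sixth roots
-- of unity.
cheb-period : ∀ n → cheb (6 ℕ.+ n) ≡ cheb n
cheb-period n = lem (cheb (suc n)) (cheb n)
  where
  lem : ∀ b a → let c = b - a ; d = c - b ; e = d - c ; f = e - d in f - e ≡ a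
  lem = solve-∀ ℚ-ring

trU : ℕ → ℚ
trU w = ∑ (upTo (suc w)) (λ j → sg j * pas (w ∸ j) j)

-- Pascal's rule, applied to the alternating sums of the binomials C(w - j, j).
trU-step : ∀ w → trU (2 ℕ.+ w) ≡ trU (1 ℕ.+ w) - trU w
trU-step w = begin
  trU (2 ℕ.+ w)
    ≡⟨ ∑-upTo-0 (2 ℕ.+ w) (λ j → sg j * pas (2 ℕ.+ w ∸ j) j) ⟩
  1ℚ * 1ℚ + ∑ (upTo (2 ℕ.+ w)) (λ j → sg (suc j) * pas (suc w ∸ j) (suc j))
    ≡⟨ cong (1ℚ * 1ℚ +_) (trans (∑-upTo-suc (suc w) (λ j → sg (suc j) * pas (suc w ∸ j) (suc j))) (cong₂ _+_
         (trans (∑-upTo-cong (suc w) (λ j j≤w → trans (cong (λ k → sg (suc j) * pas k (suc j)) (ℕP.+-∸-assoc 1 (ℕP.≤-pred j≤w)))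
             (lem (sg j) (pas (w ∸ j) j) (pas (w ∸ j) (suc j)))))
           (∑-- (upTo (suc w)) (λ j → sg (suc j) * pas (w ∸ j) (suc j)) (λ j → sg j * pas (w ∸ j) j)))
         (trans (cong (λ k → sg (2 ℕ.+ w) * pas k (2 ℕ.+ w)) (ℕP.n∸n≡0 w)) (ℚP.*-zeroʳ (sg (2 ℕ.+ w)))))) ⟩
  1ℚ * 1ℚ + (A - trU w + 0ℚ)
    ≡⟨ lem₂ (1ℚ * 1ℚ) A (trU w) ⟩
  1ℚ * 1ℚ + A - trU w
    ≡⟨ cong (_- trU w) (∑-upTo-0 (suc w) (λ j → sg j * pas (suc w ∸ j) j)) ⟨
  trU (1 ℕ.+ w) - trU w ∎
  where
  open ≡-Reasoning
  A = ∑ (upTo (suc w)) (λ j → sg (suc j) * pas (w ∸ j) (suc j))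
  lem : ∀ s p q → (- 1ℚ) * s * (p + q) ≡ (- 1ℚ) * s * q - s * p
  lem = solve-∀ ℚ-ring
  lem₂ : ∀ a b c → a + (b - c + 0ℚ) ≡ a + b - c
  lem₂ = solve-∀ ℚ-ring

trU≡cheb : ∀ w → trU w ≡ cheb w × trU (suc w) ≡ cheb (suc w)
trU≡cheb zero    = refl , refl
trU≡cheb (suc w) with trU≡cheb w
... | eq₀ , eq₁ = eq₁ , trans (trU-step w) (cong₂ _-_ eq₁ eq₀)

o-idem : ∀ a → o a * o a ≡ o a
o-idem a = sym (ind-* (odd3? a) (odd3? a) (odd3? a) (λ p _ → p) id id)

o-2+ : ∀ a → o (2 ℕ.+ a) ≡ o a + ind (1 ℕ.≟ a)
o-2+ 0 = refl
o-2+ 1 = refl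
o-2+ 2 = refl
o-2+ (suc (suc (suc a))) = trans (o-2+3+ a) (sym (ℚP.+-identityʳ (o (3 ℕ.+ a))))
  where
  o-2+3+ : ∀ a → o (5 ℕ.+ a) ≡ o (3 ℕ.+ a)
  o-2+3+ a = ind-⇔ (odd3? (5 ℕ.+ a)) (odd3? (3 ℕ.+ a)) (λ { (_ , h) → s≤s (s≤s (s≤s z≤n)) , h }) (λ { (_ , h) → s≤s (s≤s (s≤s z≤n)) , h })

-- h - 1, cut off at 0: the pairs of odd numbers ≥ 3 with sum 2h + 2 are (2i + 1, 2j + 1) with i, j
-- ≥ 1 and i + j = h.
pairs : ℕ → ℚ
pairs 0       = 0ℚ
pairs (suc h) = nat h

num₂ : ∀ h → num (2 ℕ.+ h ℕ.* 2) 2 ≡ pairs h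
num₂ zero    = refl
num₂ (suc h) = begin
  num (2 ℕ.+ M) 2
    ≡⟨ ∑-S₂ (2 ℕ.+ M) (λ _ → 1ℚ) ⟩
  ∑ (upTo (3 ℕ.+ M)) (λ a → o a * (o (2 ℕ.+ M ∸ a) * 1ℚ))
    ≡⟨ trans (∑-upTo-0 (2 ℕ.+ M) (λ a → o a * (o (2 ℕ.+ M ∸ a) * 1ℚ)))
         (cong (λ z → 0ℚ * (o (2 ℕ.+ M) * 1ℚ) + z) (∑-upTo-0 (suc M) (λ a → o (suc a) * (o (suc M ∸ a) * 1ℚ)))) ⟩
  0ℚ * (o (2 ℕ.+ M) * 1ℚ) + (0ℚ * (o (suc M) * 1ℚ) + ∑ (upTo (suc M)) (λ a → o (2 ℕ.+ a) * (o (M ∸ a) * 1ℚ)))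
    ≡⟨ trans (lem₁ (o (2 ℕ.+ M) * 1ℚ) (o (suc M) * 1ℚ) _) (trans
         (∑-cong (upTo (suc M)) (λ a → trans (cong (_* (o (M ∸ a) * 1ℚ)) (o-2+ a)) (ℚP.*-distribʳ-+ (o (M ∸ a) * 1ℚ) (o a) (ind (1 ℕ.≟ a)))))
         (∑-+ (upTo (suc M)) (λ a → o a * (o (M ∸ a) * 1ℚ)) (λ a → ind (1 ℕ.≟ a) * (o (M ∸ a) * 1ℚ)))) ⟩
  ∑ (upTo (suc M)) (λ a → o a * (o (M ∸ a) * 1ℚ)) + ∑ (upTo (suc M)) (λ a → ind (1 ℕ.≟ a) * (o (M ∸ a) * 1ℚ))
    ≡⟨ cong₂ _+_ (trans (sym (∑-S₂ M (λ _ → 1ℚ))) (num₂ h))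
         (trans (∑-δ ℕ._≟_ (UniqueP.upTo⁺ (suc M)) (λ a → o (M ∸ a) * 1ℚ) (∈P.∈-upTo⁺ (s≤s (s≤s z≤n)))) (ℚP.*-identityʳ (o (suc (h ℕ.* 2))))) ⟩
  pairs h + o (suc (h ℕ.* 2))
    ≡⟨ last h ⟩
  nat h ∎
  where
  open ≡-Reasoning
  M = 2 ℕ.+ h ℕ.* 2
  lem₁ : ∀ a b c → 0ℚ * a + (0ℚ * b + c) ≡ c
  lem₁ = solve-∀ ℚ-ring
  last : ∀ h → pairs h + o (suc (h ℕ.* 2)) ≡ nat h
  last zero    = refl
  last (suc h) = cong (nat h +_) (ind-yes (odd3? (suc (suc h ℕ.* 2))) (odd3-suc-even (suc h) (s≤s z≤n)))

diagonal₂ : ∀ h → ∑ (S (2 ℕ.+ h ℕ.* 2) 2) (λ u → ind (u ≟V swap₂ u)) ≡ o (suc h)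
diagonal₂ h = trans (∑-S₂ M (λ u → ind (u ≟V swap₂ u))) (trans
  (∑-upTo-cong (suc M) (λ a a≤M → term a (ℕP.≤-pred a≤M)))
  (∑-δ ℕ._≟_ (UniqueP.upTo⁺ (suc M)) o (∈P.∈-upTo⁺ (s≤s (ℕP.≤-trans (ℕP.m≤m+n (suc h) (suc h)) (ℕP.≤-reflexive h+h))))))
  where
  M = 2 ℕ.+ h ℕ.* 2
  h+h : suc h ℕ.+ suc h ≡ M
  h+h = cong suc (trans (ℕP.+-suc h h) (cong suc (trans (cong (h ℕ.+_) (sym (ℕP.+-identityʳ h))) (ℕP.*-comm 2 h))))
  doubled : ∀ a → a ≤ M → a ≡ M ∸ a → suc h ≡ a
  doubled a a≤M eq = ℕP.*-cancelʳ-≡ (suc h) a 2 (trans (sym (trans (cong (ℕ._+ a) eq) (ℕP.m∸n+n≡m a≤M)))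
    (trans (cong (a ℕ.+_) (sym (ℕP.+-identityʳ a))) (ℕP.*-comm 2 a)))
  term : ∀ a → a ≤ M → o a * (o (M ∸ a) * ind (a ∷ (M ∸ a) ∷ [] ≟V (M ∸ a) ∷ a ∷ [])) ≡ ind (suc h ℕ.≟ a) * o a
  term a a≤M with suc h ℕ.≟ a
  ... | no ≢ = trans (cong (λ z → o a * (o (M ∸ a) * z)) (ind-no (a ∷ (M ∸ a) ∷ [] ≟V (M ∸ a) ∷ a ∷ []) (λ eq → ≢ (doubled a a≤M (VecP.∷-injectiveˡ eq)))))
    (lem (o a) (o (M ∸ a)))
    where
    lem : ∀ x y → x * (y * 0ℚ) ≡ 0ℚ * x
    lem = solve-∀ ℚ-ring
  ... | yes refl = trans (cong (λ k → o (suc h) * (o k * ind (suc h ∷ k ∷ [] ≟V k ∷ suc h ∷ []))) (trans (cong (_∸ suc h) (sym h+h)) (ℕP.m+n∸m≡n (suc h) (suc h))))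
    (trans (cong (λ z → o (suc h) * (o (suc h) * z)) (ind-refl (suc h ∷ suc h ∷ [] ≟V suc h ∷ suc h ∷ [])))
      (trans (cong (o (suc h) *_) (ℚP.*-identityʳ (o (suc h)))) (trans (o-idem (suc h)) (sym (ℚP.*-identityˡ (o (suc h)))))))

⅙ : ℚ
⅙ = ℤ.+ 1 ℚ./ 6

-- dim W_{2h+2,2} = dim (antisymmetric forms in S_{2h+2,2}) − dim (U-fixed, τ-negated forms of degree 2h)
dimW : ℕ → ℚ
dimW h = ½ * (pairs h - o (suc h)) - ⅙ * (nat (suc (h ℕ.* 2)) + (cheb (h ℕ.* 2) + cheb (h ℕ.* 2)) - (1ℚ + (1ℚ + 1ℚ)))

-- Raising h by 6 adds 6 pairs and 12 to the degree, while the periodic terms repeat: ½ · 6 - ⅙ · 12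
-- = 1. The offset 5 lies beyond the cut-offs in `pairs` and `odd3?` and belongs to weight 12, where
-- 𝕊 begins.
dimW-step : ∀ k → dimW (11 ℕ.+ k) ≡ 1ℚ + dimW (5 ℕ.+ k)
dimW-step k = trans (cong₂ (λ x y → ½ * (nat (10 ℕ.+ k) - x) - ⅙ * (nat (suc (22 ℕ.+ k ℕ.* 2)) + (y + y) - (1ℚ + (1ℚ + 1ℚ))))
    o-period (trans (cheb-period (16 ℕ.+ k ℕ.* 2)) (cheb-period (10 ℕ.+ k ℕ.* 2))))
  (lem (nat (4 ℕ.+ k)) (o (6 ℕ.+ k)) (nat (suc (10 ℕ.+ k ℕ.* 2))) (cheb (10 ℕ.+ k ℕ.* 2)))
  where
  o-period : o (12 ℕ.+ k) ≡ o (6 ℕ.+ k)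
  o-period = ind-⇔ (odd3? (12 ℕ.+ k)) (odd3? (6 ℕ.+ k)) (λ { (_ , h) → s≤s (s≤s (s≤s z≤n)) , h }) (λ { (_ , h) → s≤s (s≤s (s≤s z≤n)) , h })
  lem : ∀ n x m y → ½ * (n + 1ℚ + 1ℚ + 1ℚ + 1ℚ + 1ℚ + 1ℚ - x)
      - ⅙ * (m + 1ℚ + 1ℚ + 1ℚ + 1ℚ + 1ℚ + 1ℚ + 1ℚ + 1ℚ + 1ℚ + 1ℚ + 1ℚ + 1ℚ + (y + y) - (1ℚ + (1ℚ + 1ℚ)))
    ≡ 1ℚ + (½ * (n - x) - ⅙ * (m + (y + y) - (1ℚ + (1ℚ + 1ℚ))))
  lem = solve-∀ ℚ-ring

dimW≡g₄₆ : ∀ k → dimW (5 ℕ.+ k) ≡ g₄₆ (k ℕ.* 2)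
dimW≡g₄₆ 0 = refl
dimW≡g₄₆ 1 = refl
dimW≡g₄₆ 2 = refl
dimW≡g₄₆ 3 = refl
dimW≡g₄₆ 4 = refl
dimW≡g₄₆ 5 = refl
dimW≡g₄₆ (suc (suc (suc (suc (suc (suc k)))))) = trans (dimW-step k) (sym (trans (g₄₆-step (k ℕ.* 2))
  (cong₂ _+_ (window-even k) (sym (dimW≡g₄₆ k)))))

dimW≡𝕊 : ∀ h → dimW h ≡ ι (𝕊 (2 ℕ.+ h ℕ.* 2))
dimW≡𝕊 0 = sym (xpow-⋆-below 12 (geom 4 ⋆ geom 6) 2 (ℕP.m≤m+n 3 9))
dimW≡𝕊 1 = sym (xpow-⋆-below 12 (geom 4 ⋆ geom 6) 4 (ℕP.m≤m+n 5 7))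
dimW≡𝕊 2 = sym (xpow-⋆-below 12 (geom 4 ⋆ geom 6) 6 (ℕP.m≤m+n 7 5))
dimW≡𝕊 3 = sym (xpow-⋆-below 12 (geom 4 ⋆ geom 6) 8 (ℕP.m≤m+n 9 3))
dimW≡𝕊 4 = sym (xpow-⋆-below 12 (geom 4 ⋆ geom 6) 10 (ℕP.m≤m+n 11 1))
dimW≡𝕊 (suc (suc (suc (suc (suc k))))) = trans (dimW≡g₄₆ k) (sym (ι-𝕊-shift (k ℕ.* 2)))

-- An idempotent in place of a basis: by `fix` and `into`, right multiplication by `K` is a
-- projection onto W_{M,2}, whose dimension is then the trace.
record PeriodProjector (M : ℕ) : Set where
  field
    K     : Vec ℕ 2 → Vec ℕ 2 → ℚ
    fix   : ∀ t → PeriodEq (fval M 2 t) → ∀ v → v ∈ S M 2 → ∑ (S M 2) (λ u → t u * K u v) ≡ t v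
    into  : ∀ (t : Vec ℕ 2 → ℚ) → PeriodEq (fval M 2 (λ v → ∑ (S M 2) (λ u → t u * K u v)))
    trace : ∑ (S M 2) (λ u → K u u) ≡ ι (𝕊 M)

module _ (h : ℕ) where
  private
    module B = BinaryForms h
    module W = PeriodSpace h

    tr-1 : B.tr B.1# ≡ nat (suc B.w)
    tr-1 = trans (∑-cong B.J (λ i → ind-refl (i ℕ.≟ i))) (∑-1 (suc B.w))

    tr-τ : B.tr B.τ ≡ 1ℚ
    tr-τ = trans (∑-cong∈ B.J (λ i i∈ → trans (ind-⇔ ((B.w ∸ i) ℕ.≟ i) (h ℕ.≟ i) (middle i (B.J∈ i∈)) (λ { refl → trans (cong (_∸ h) h*2≡h+h) (ℕP.m+n∸m≡n h h) }))
        (sym (ℚP.*-identityʳ (ind (h ℕ.≟ i))))))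
      (∑-δ ℕ._≟_ (UniqueP.upTo⁺ (suc B.w)) (λ _ → 1ℚ) (B.∈J (≡.subst (h ≤_) (sym h*2≡h+h) (ℕP.m≤m+n h h))))
      where
      h*2≡h+h : h ℕ.* 2 ≡ h ℕ.+ h
      h*2≡h+h = trans (ℕP.*-comm h 2) (cong (h ℕ.+_) (ℕP.+-identityʳ h))
      middle : ∀ i → i ≤ B.w → B.w ∸ i ≡ i → h ≡ i
      middle i i≤w eq = ℕP.*-cancelʳ-≡ h i 2 (trans (sym (ℕP.m∸n+n≡m i≤w)) (trans (cong (ℕ._+ i) eq)
        (trans (cong (i ℕ.+_) (sym (ℕP.+-identityʳ i))) (ℕP.*-comm 2 i))))

    tr-q : ∑ W.S₂ (λ u → W.q u u) ≡ ½ * (pairs h - o (suc h))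
    tr-q = trans (sym (∑-*ˡ W.S₂ ½ (λ u → ind (u ≟V u) - ind (u ≟V swap₂ u)))) (cong (½ *_)
      (trans (∑-- W.S₂ (λ u → ind (u ≟V u)) (λ u → ind (u ≟V swap₂ u))) (cong₂ _-_
        (trans (∑-cong W.S₂ (λ u → ind-refl (u ≟V u))) (num₂ h)) (diagonal₂ h))))

    tr-HL : B.tr W.HL ≡ ⅙ * (nat (suc B.w) + (cheb B.w + cheb B.w) - (1ℚ + (1ℚ + 1ℚ)))
    tr-HL = begin
      B.tr W.HL                              ≡⟨ ℚP.*-identityˡ (B.tr W.HL) ⟨
      1ℚ * B.tr W.HL                         ≡⟨⟩
      ⅙ * B.6ℚ * B.tr W.HL                   ≡⟨ ℚP.*-assoc ⅙ B.6ℚ (B.tr W.HL) ⟩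
      ⅙ * (B.6ℚ * B.tr W.HL)                 ≡⟨ cong (⅙ *_) (trans W.6·trHL≡trP B.tr-P) ⟩
      ⅙ * (B.tr B.1# + (B.tr B.U + B.tr B.U) - (B.tr B.τ + (B.tr B.τ + B.tr B.τ)))
        ≡⟨ cong₂ (λ a b → ⅙ * (B.tr B.1# + (a + a) - (b + (b + b)))) (proj₁ (trU≡cheb B.w)) tr-τ ⟩
      ⅙ * (B.tr B.1# + (cheb B.w + cheb B.w) - (1ℚ + (1ℚ + 1ℚ)))
        ≡⟨ cong (λ a → ⅙ * (a + (cheb B.w + cheb B.w) - (1ℚ + (1ℚ + 1ℚ)))) tr-1 ⟩
      ⅙ * (nat (suc B.w) + (cheb B.w + cheb B.w) - (1ℚ + (1ℚ + 1ℚ))) ∎ where open ≡-Reasoning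

  evenProjector : PeriodProjector (2 ℕ.+ h ℕ.* 2)
  evenProjector = record
    { K = W.K ; fix = PeriodForms.fix h ; into = PeriodForms.into h
    ; trace = trans W.trace-K (trans (cong₂ _-_ tr-q tr-HL) (dimW≡𝕊 h)) }

emptyProjector : ∀ M → (∀ u → u ∉ S M 2) → ι (𝕊 M) ≡ 0ℚ → PeriodProjector M
emptyProjector M none 𝕊≡0 = record
  { K     = λ _ _ → 0ℚ
  ; fix   = λ t _ v v∈ → ⊥-elim (none v v∈)
  ; into  = λ t x y zs → trans (vanish t (x ∷ y ∷ zs)) (sym (cong₂ _-_ (vanish t ((y - x) ∷ y ∷ zs)) (vanish t ((y - x) ∷ x ∷ zs))))
  ; trace = trans (∑-zero (S M 2)) (sym 𝕊≡0) }
  where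
  vanish : ∀ t xs → fval M 2 (λ v → ∑ (S M 2) (λ u → t u * 0ℚ)) xs ≡ 0ℚ
  vanish t xs = ∑-zero∈ (S M 2) (λ u u∈ → ⊥-elim (none u u∈))

no-odd-pairs : ∀ k u → u ∉ S (suc (k ℕ.* 2)) 2
no-odd-pairs k (a ∷ b ∷ []) u∈ with ∈-S₂⁻ (suc (k ℕ.* 2)) u∈
... | odda , oddb , a+b≡ with a | b | odda | oddb | odd∸1 odda | odd∸1 oddb
...   | suc _ | suc _ | _ | _ | i , refl | j , refl = parity
  (trans (sym (DivMod.[m+kn]%n≡m%n 1 k 2)) (trans (cong (ℕ._% 2) (sym a+b≡))
    (trans (cong (ℕ._% 2) (trans (cong suc (ℕP.+-suc (i ℕ.* 2) (j ℕ.* 2))) (cong (suc ∘ suc) (sym (ℕP.*-distribʳ-+ 2 i j)))))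
      (DivMod.m*n%n≡0 (suc (i ℕ.+ j)) 2))))
  where
  parity : 1 ≢ 0
  parity ()

periodProjector : ∀ M → PeriodProjector M
periodProjector M with even⊎odd M
... | zero  , inj₁ refl = emptyProjector 0 (λ _ ()) (xpow-⋆-below 12 (geom 4 ⋆ geom 6) 0 (s≤s z≤n))
... | suc h , inj₁ refl = evenProjector h
... | k     , inj₂ refl = emptyProjector (suc (k ℕ.* 2)) (no-odd-pairs k) (ι-𝕊-odd k)

𝐊 : Graded 2
𝐊 M = PeriodProjector.K (periodProjector M)

fval-cong : ∀ N r {s t : Vec ℕ r → ℚ} → (∀ u → u ∈ S N r → s u ≡ t u) → ∀ xs → fval N r s xs ≡ fval N r t xs
fval-cong N r h xs = ∑-cong∈ (S N r) (λ u u∈ → cong (_* evM (exps u) xs) (h u u∈))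

PeriodEq-cong : ∀ {f g : List ℚ → ℚ} → (∀ xs → f xs ≡ g xs) → PeriodEq f → PeriodEq g
PeriodEq-cong h eq x y zs = trans (sym (h _)) (trans (eq x y zs) (cong₂ _-_ (h _) (h _)))

-- A row of `𝐊` is the image of a unit vector, so it satisfies the period equation by `into` and is
-- reproduced by `fix`.
𝐊-idem : (𝐊 ⊙ 𝐊) ≐ 𝐊
𝐊-idem M u v u∈ v∈ = PeriodProjector.fix (periodProjector M) (𝐊 M u)
  (PeriodEq-cong (fval-cong M 2 (λ w w∈ → ∑-δ _≟V_ (Unique-S M 2) (λ x → 𝐊 M x w) u∈))
    (PeriodProjector.into (periodProjector M) (λ x → ind (u ≟V x)))) v v∈

-- The projector onto W in any number of variables.

module Slices (N p : ℕ) where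
  private r = 2 ℕ.+ p

  slice : (Vec ℕ r → ℚ) → Vec ℕ p → Vec ℕ 2 → ℚ
  slice t l w = t (w Vec.++ l)

  evM-pair : ∀ (w : Vec ℕ 2) (l : Vec ℕ p) x y zs → evM (exps (w Vec.++ l)) (x ∷ y ∷ zs) ≡ evM (exps w) (x ∷ y ∷ []) * evM (exps l) zs
  evM-pair (a ∷ b ∷ []) l x y zs = lem (pow x (a ∸ 1)) (pow y (b ∸ 1)) (evM (exps l) zs)
    where
    lem : ∀ p q z → p * (q * z) ≡ p * (q * 1ℚ) * z
    lem = solve-∀ ℚ-ring

  fval-slices : ∀ t x y zs → fval N r t (x ∷ y ∷ zs) ≡
    ∑ (upTo (suc N)) (λ M → ∑ (S (N ∸ M) p) (λ l → fval M 2 (slice t l) (x ∷ y ∷ []) * evM (exps l) zs))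
  fval-slices t x y zs = trans (∑-split-S N p (λ u → t u * evM (exps u) (x ∷ y ∷ zs))) (∑-cong (upTo (suc N)) (λ M →
    trans (∑-swap (S M 2) (S (N ∸ M) p) (λ w l → t (w Vec.++ l) * evM (exps (w Vec.++ l)) (x ∷ y ∷ zs)))
      (∑-cong (S (N ∸ M) p) (λ l → trans (∑-cong (S M 2) (λ w → trans (cong (t (w Vec.++ l) *_) (evM-pair w l x y zs))
          (sym (ℚP.*-assoc (t (w Vec.++ l)) (evM (exps w) (x ∷ y ∷ [])) (evM (exps l) zs)))))
        (sym (∑-*ʳ (S M 2) (evM (exps l) zs) (λ w → t (w Vec.++ l) * evM (exps w) (x ∷ y ∷ []))))))))

  period-from-slices : ∀ t → (∀ M l → M ≤ N → l ∈ S (N ∸ M) p → PeriodEq (fval M 2 (slice t l))) → PeriodEq (fval N r t)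
  period-from-slices t eqs x y zs = begin
    fval N r t (x ∷ y ∷ zs)
      ≡⟨ fval-slices t x y zs ⟩
    ∑ (upTo (suc N)) (λ M → ∑ (S (N ∸ M) p) (λ l → fval M 2 (slice t l) (x ∷ y ∷ []) * evM (exps l) zs))
      ≡⟨ ∑-upTo-cong (suc N) (λ M M≤N → trans (∑-cong∈ (S (N ∸ M) p) (λ l l∈ → trans (cong (_* evM (exps l) zs) (eqs M l (ℕP.≤-pred M≤N) l∈ x y []))
           (*-distribʳ-- (fval M 2 (slice t l) ((y - x) ∷ y ∷ [])) (fval M 2 (slice t l) ((y - x) ∷ x ∷ [])) (evM (exps l) zs))))
           (∑-- (S (N ∸ M) p) (λ l → fval M 2 (slice t l) ((y - x) ∷ y ∷ []) * evM (exps l) zs) (λ l → fval M 2 (slice t l) ((y - x) ∷ x ∷ []) * evM (exps l) zs))) ⟩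
    ∑ (upTo (suc N)) (λ M → A y M - A x M)
      ≡⟨ ∑-- (upTo (suc N)) (A y) (A x) ⟩
    ∑ (upTo (suc N)) (A y) - ∑ (upTo (suc N)) (A x)
      ≡⟨ cong₂ _-_ (fval-slices t (y - x) y zs) (fval-slices t (y - x) x zs) ⟨
    fval N r t ((y - x) ∷ y ∷ zs) - fval N r t ((y - x) ∷ x ∷ zs) ∎
    where
    open ≡-Reasoning
    A : ℚ → ℕ → ℚ
    A z M = ∑ (S (N ∸ M) p) (λ l → fval M 2 (slice t l) ((y - x) ∷ z ∷ []) * evM (exps l) zs)

  -- For fixed x and y the defect of the period equation is a polynomial in the remaining variables.
  -- It vanishes as a function, hence so does its coefficient at `l₀`, which is the defect of the
  -- slice: the sum of the entries of `l₀` determines `M₀`, so no other weight contributes.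
  slices-period : ∀ t → PeriodEq (fval N r t) → ∀ M l → M ≤ N → l ∈ S (N ∸ M) p → PeriodEq (fval M 2 (slice t l))
  slices-period t eq M₀ l₀ M₀≤N l₀∈ x y zs = trans (ignore x y) (trans (-‿zero _ _ (trans (sym pick)
      (eval≡0⇒lin-δ≡0 defect defect≡0 (exps l₀)))) (sym (cong₂ _-_ (ignore (y - x) y) (ignore (y - x) x))))
    where
    open ≡-Reasoning
    ignore : ∀ x y → fval M₀ 2 (slice t l₀) (x ∷ y ∷ zs) ≡ fval M₀ 2 (slice t l₀) (x ∷ y ∷ [])
    ignore x y = ∑-cong (S M₀ 2) (λ { (a ∷ b ∷ []) → refl })
    m : Vec ℕ 2 → ℚ
    m w = evM (exps w) (x ∷ y ∷ []) - (evM (exps w) ((y - x) ∷ y ∷ []) - evM (exps w) ((y - x) ∷ x ∷ []))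
    fst : Vec ℕ r → Vec ℕ 2
    fst (a ∷ b ∷ _) = a ∷ b ∷ []
    snd : Vec ℕ r → Vec ℕ p
    snd (_ ∷ _ ∷ l) = l
    defect : Poly p
    defect = map (λ u → t u * m (fst u) , exps (snd u)) (S N r)
    lem₁ : ∀ t a b c z → t * (a - (b - c)) * z ≡ t * (a * z) - (t * (b * z) - t * (c * z))
    lem₁ = solve-∀ ℚ-ring
    evM-fst : ∀ u x y zs → evM (exps (fst u)) (x ∷ y ∷ []) * evM (exps (snd u)) zs ≡ evM (exps u) (x ∷ y ∷ zs)
    evM-fst (a ∷ b ∷ l) x y zs = sym (evM-pair (a ∷ b ∷ []) l x y zs)
    defect≡0 : ∀ (zs : Vec ℚ p) → eval defect (Vec.toList zs) ≡ 0ℚ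
    defect≡0 zs = begin
      eval defect Z
        ≡⟨ ∑-map (λ u → t u * m (fst u) , exps (snd u)) (S N r) _ ⟩
      ∑ (S N r) (λ u → t u * m (fst u) * evM (exps (snd u)) Z)
        ≡⟨ ∑-cong (S N r) (λ u → trans (lem₁ (t u) (evM (exps (fst u)) (x ∷ y ∷ [])) (evM (exps (fst u)) ((y - x) ∷ y ∷ [])) (evM (exps (fst u)) ((y - x) ∷ x ∷ [])) (evM (exps (snd u)) Z))
             (cong₂ _-_ (cong (t u *_) (evM-fst u x y Z)) (cong₂ _-_ (cong (t u *_) (evM-fst u (y - x) y Z)) (cong (t u *_) (evM-fst u (y - x) x Z))))) ⟩
      ∑ (S N r) (λ u → t u * evM (exps u) (x ∷ y ∷ Z) - (t u * evM (exps u) ((y - x) ∷ y ∷ Z) - t u * evM (exps u) ((y - x) ∷ x ∷ Z)))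
        ≡⟨ trans (∑-- (S N r) _ _) (cong (λ z → fval N r t (x ∷ y ∷ Z) - z) (∑-- (S N r) _ _)) ⟩
      fval N r t (x ∷ y ∷ Z) - (fval N r t ((y - x) ∷ y ∷ Z) - fval N r t ((y - x) ∷ x ∷ Z))
        ≡⟨ trans (cong (λ z → fval N r t (x ∷ y ∷ Z) - z) (sym (eq x y Z))) (ℚP.+-inverseʳ (fval N r t (x ∷ y ∷ Z))) ⟩
      0ℚ ∎
      where Z = Vec.toList zs
    lem₂ : ∀ t a b c → t * (a - (b - c)) ≡ t * a - (t * b - t * c)
    lem₂ = solve-∀ ℚ-ring
    fst-++ : ∀ (w : Vec ℕ 2) l → fst (w Vec.++ l) ≡ w
    fst-++ (a ∷ b ∷ []) l = refl
    snd-++ : ∀ (w : Vec ℕ 2) l → snd (w Vec.++ l) ≡ l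
    snd-++ (a ∷ b ∷ []) l = refl
    choose : ∀ M → M ≤ N → ∀ w → ∑ (S (N ∸ M) p) (λ l → t (w Vec.++ l) * m (fst (w Vec.++ l)) * ind (exps (snd (w Vec.++ l)) ≟V exps l₀))
      ≡ ind (M₀ ℕ.≟ M) * (slice t l₀ w * m w)
    choose M M≤N w = trans (∑-cong∈ (S (N ∸ M) p) (λ l l∈ → cong₂ _*_ (cong (λ z → t (w Vec.++ l) * m z) (fst-++ w l))
        (trans (cong (λ z → ind (exps z ≟V exps l₀)) (snd-++ w l)) (ind-⇔ (exps l ≟V exps l₀) (l ≟V l₀)
          (exps-injective l l₀ (∈-S-odd p (N ∸ M) l∈) (∈-S-odd p (N ∸ M₀) l₀∈)) (λ { refl → refl })))))
      (by-cases (M₀ ℕ.≟ M))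
      where
      by-cases : (d : Dec (M₀ ≡ M)) → ∑ (S (N ∸ M) p) (λ l → t (w Vec.++ l) * m w * ind (l ≟V l₀)) ≡ ind d * (slice t l₀ w * m w)
      by-cases (yes refl) = trans (∑-δʳ _≟V_ (Unique-S (N ∸ M) p) (λ l → t (w Vec.++ l) * m w) l₀∈) (sym (ℚP.*-identityˡ _))
      by-cases (no M₀≢M)  = trans (∑-zero∈ (S (N ∸ M) p) (λ l l∈ → trans (cong (t (w Vec.++ l) * m w *_) (ind-no (l ≟V l₀)
          (λ { refl → M₀≢M (ℕP.∸-cancelˡ-≡ M₀≤N M≤N (trans (sym (∈-S-sum p (N ∸ M₀) l₀∈)) (∈-S-sum p (N ∸ M) l∈))) })))
          (ℚP.*-zeroʳ (t (w Vec.++ l) * m w)))) (sym (ℚP.*-zeroˡ (slice t l₀ w * m w)))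
    pick : lin defect (λ e′ → ind (e′ ≟V exps l₀)) ≡
      fval M₀ 2 (slice t l₀) (x ∷ y ∷ []) - (fval M₀ 2 (slice t l₀) ((y - x) ∷ y ∷ []) - fval M₀ 2 (slice t l₀) ((y - x) ∷ x ∷ []))
    pick = begin
      lin defect (λ e′ → ind (e′ ≟V exps l₀))
        ≡⟨ trans (∑-map (λ u → t u * m (fst u) , exps (snd u)) (S N r) _) (∑-split-S N p (λ u → t u * m (fst u) * ind (exps (snd u) ≟V exps l₀))) ⟩
      ∑ (upTo (suc N)) (λ M → ∑ (S M 2) (λ w → ∑ (S (N ∸ M) p) (λ l → t (w Vec.++ l) * m (fst (w Vec.++ l)) * ind (exps (snd (w Vec.++ l)) ≟V exps l₀))))
        ≡⟨ ∑-upTo-cong (suc N) (λ M M≤N → trans (∑-cong (S M 2) (choose M (ℕP.≤-pred M≤N))) (sym (∑-*ˡ (S M 2) (ind (M₀ ℕ.≟ M)) (λ w → slice t l₀ w * m w)))) ⟩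
      ∑ (upTo (suc N)) (λ M → ind (M₀ ℕ.≟ M) * ∑ (S M 2) (λ w → slice t l₀ w * m w))
        ≡⟨ ∑-δ ℕ._≟_ (UniqueP.upTo⁺ (suc N)) (λ M → ∑ (S M 2) (λ w → slice t l₀ w * m w)) (∈P.∈-upTo⁺ (s≤s M₀≤N)) ⟩
      ∑ (S M₀ 2) (λ w → slice t l₀ w * m w)
        ≡⟨ trans (∑-cong (S M₀ 2) (λ w → lem₂ (slice t l₀ w) (evM (exps w) (x ∷ y ∷ [])) (evM (exps w) ((y - x) ∷ y ∷ [])) (evM (exps w) ((y - x) ∷ x ∷ []))))
             (trans (∑-- (S M₀ 2) _ _) (cong (λ z → fval M₀ 2 (slice t l₀) (x ∷ y ∷ []) - z) (∑-- (S M₀ 2) _ _))) ⟩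
      _ ∎

  𝐤 : Vec ℕ r → Vec ℕ r → ℚ
  𝐤 = tensor 𝐊 δᴳ N

  act-𝐤 : ∀ t (w : Vec ℕ 2) l M → w ∈ S M 2 → M ≤ N → l ∈ S (N ∸ M) p →
    ∑ (S N r) (λ u → t u * 𝐤 u (w Vec.++ l)) ≡ ∑ (S M 2) (λ w′ → slice t l w′ * 𝐊 M w′ w)
  act-𝐤 t w@(c ∷ d ∷ []) l₀ M₀ w∈ M₀≤N l₀∈ = begin
    ∑ (S N r) (λ u → t u * 𝐤 u (w Vec.++ l₀))
      ≡⟨ ∑-split-S N p (λ u → t u * 𝐤 u (w Vec.++ l₀)) ⟩
    ∑ (upTo (suc N)) (λ M → ∑ (S M 2) (λ w′ → ∑ (S (N ∸ M) p) (λ l → t (w′ Vec.++ l) * 𝐤 (w′ Vec.++ l) (w Vec.++ l₀))))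
      ≡⟨ ∑-cong (upTo (suc N)) (λ M → trans (∑-cong∈ (S M 2) (λ w′ w′∈ → choose M w′ (∈-S-sum 2 M w′∈) (M₀ ℕ.≟ M)))
           (sym (∑-*ˡ (S M 2) (ind (M₀ ℕ.≟ M)) (λ w′ → slice t l₀ w′ * 𝐊 M w′ w)))) ⟩
    ∑ (upTo (suc N)) (λ M → ind (M₀ ℕ.≟ M) * ∑ (S M 2) (λ w′ → slice t l₀ w′ * 𝐊 M w′ w))
      ≡⟨ ∑-δ ℕ._≟_ (UniqueP.upTo⁺ (suc N)) (λ M → ∑ (S M 2) (λ w′ → slice t l₀ w′ * 𝐊 M w′ w)) (∈P.∈-upTo⁺ (s≤s M₀≤N)) ⟩
    ∑ (S M₀ 2) (λ w′ → slice t l₀ w′ * 𝐊 M₀ w′ w) ∎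
    where
    open ≡-Reasoning
    c+d≡M₀ : c ℕ.+ d ≡ M₀
    c+d≡M₀ = proj₂ (proj₂ (∈-S₂⁻ M₀ w∈))
    lem₁ : ∀ t k i → t * (1ℚ * (k * i)) ≡ t * k * i
    lem₁ = solve-∀ ℚ-ring
    lem₂ : ∀ t k → t * (0ℚ * k) ≡ 0ℚ
    lem₂ = solve-∀ ℚ-ring
    choose : ∀ M (w′ : Vec ℕ 2) → Vec.sum w′ ≡ M → (d : Dec (M₀ ≡ M)) →
      ∑ (S (N ∸ M) p) (λ l → t (w′ Vec.++ l) * 𝐤 (w′ Vec.++ l) (w Vec.++ l₀)) ≡ ind d * (slice t l₀ w′ * 𝐊 M w′ w)
    choose _ (a ∷ b ∷ []) refl dec rewrite ℕP.+-identityʳ b = by-cases dec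
      where
      K′ = 𝐊 (a ℕ.+ b) (a ∷ b ∷ []) w
      by-cases : (dec : Dec (M₀ ≡ a ℕ.+ b)) →
        ∑ (S (N ∸ (a ℕ.+ b)) p) (λ l → t (a ∷ b ∷ l) * (ind (a ℕ.+ b ℕ.≟ c ℕ.+ d) * (K′ * ind (l ≟V l₀)))) ≡ ind dec * (t (a ∷ b ∷ l₀) * K′)
      by-cases (yes refl) = trans (∑-cong (S (N ∸ M₀) p) (λ l → trans
          (cong (λ z → t (a ∷ b ∷ l) * (z * (K′ * ind (l ≟V l₀)))) (ind-yes (a ℕ.+ b ℕ.≟ c ℕ.+ d) (sym c+d≡M₀)))
          (lem₁ (t (a ∷ b ∷ l)) K′ (ind (l ≟V l₀)))))
        (trans (∑-δʳ _≟V_ (Unique-S (N ∸ M₀) p) (λ l → t (a ∷ b ∷ l) * K′) l₀∈) (sym (ℚP.*-identityˡ (t (a ∷ b ∷ l₀) * K′))))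
      by-cases (no M₀≢) = trans (∑-zero∈ (S (N ∸ (a ℕ.+ b)) p) (λ l _ → trans
          (cong (λ z → t (a ∷ b ∷ l) * (z * (K′ * ind (l ≟V l₀)))) (ind-no (a ℕ.+ b ℕ.≟ c ℕ.+ d) (λ eq → M₀≢ (trans (sym c+d≡M₀) (sym eq)))))
          (lem₂ (t (a ∷ b ∷ l)) (K′ * ind (l ≟V l₀)))))
        (sym (ℚP.*-zeroˡ (t (a ∷ b ∷ l₀) * K′)))

  𝐤-fix : ∀ t → PeriodEq (fval N r t) → ∀ v → v ∈ S N r → ∑ (S N r) (λ u → t u * 𝐤 u v) ≡ t v
  𝐤-fix t eq (a ∷ b ∷ l) v∈ with ∈-S-+ N v∈
  ... | M≤N , w∈ , l∈ = trans (act-𝐤 t (a ∷ b ∷ []) l (a ℕ.+ b) w∈ M≤N l∈)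
    (PeriodProjector.fix (periodProjector (a ℕ.+ b)) (slice t l) (slices-period t eq (a ℕ.+ b) l M≤N l∈) (a ∷ b ∷ []) w∈)

  𝐤-into : ∀ t → PeriodEq (fval N r (λ v → ∑ (S N r) (λ u → t u * 𝐤 u v)))
  𝐤-into t = period-from-slices (λ v → ∑ (S N r) (λ u → t u * 𝐤 u v)) (λ M l M≤N l∈ → PeriodEq-cong
    (fval-cong M 2 (λ w w∈ → sym (act-𝐤 t w l M w∈ M≤N l∈))) (PeriodProjector.into (periodProjector M) (slice t l)))

-- Products of the matrices E⁽ʲ⁾

-- rank A = tr (A G) for any G with A G A = A
module MatricesOn (N r : ℕ) where
  open SquareMatrices (_≟V_ {r}) (S N r) (Unique-S N r) public
  open TracedRing matrixRing tr (λ {A} {B} → tr-cong {A} {B}) tr-+ tr-comm public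
  open Ring matrixRing public
    using (Carrier; _≈_; 1#; 0#; *-congˡ; *-congʳ; *-assoc; *-identityʳ; *-identityˡ)
    renaming (_*_ to _·_; refl to ≈-refl; sym to ≈-sym; trans to ≈-trans; *-cong to ·-cong)

  rank : Carrier → ℚ
  rank A = tr (A · proj₁ (ginv² A))

  rank≡ : ∀ A G → A · (G · A) ≈ A → rank A ≡ tr (A · G)
  rank≡ A G AGA = rank-unique {A} {proj₁ (ginv² A)} {G} (proj₂ (ginv² A)) AGA

  rank-cong : ∀ A B → A ≈ B → rank A ≡ rank B
  rank-cong A B A≈B = rank-resp {A} {B} {proj₁ (ginv² A)} {proj₁ (ginv² B)} A≈B (proj₂ (ginv² A)) (proj₂ (ginv² B))

ginvᴳ : ∀ {r} → Graded r → Graded r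
ginvᴳ {r} A N = proj₁ (MatricesOn.ginv² N r (A N))

ginvᴳ-law : ∀ {r} (A : Graded r) → (A ⊙ (ginvᴳ A ⊙ A)) ≐ A
ginvᴳ-law {r} A N u v u∈ v∈ = proj₂ (MatricesOn.ginv² N r (A N)) u v u∈ v∈

rankᴳ : ∀ {r} → Graded r → ℕ → ℚ
rankᴳ {r} A N = MatricesOn.rank N r (A N)

≐-refl : ∀ {r} {A : Graded r} → A ≐ A
≐-refl _ _ _ _ _ = refl

≐-sym : ∀ {r} {A B : Graded r} → A ≐ B → B ≐ A
≐-sym h N u v u∈ v∈ = sym (h N u v u∈ v∈)

≐-trans : ∀ {r} {A B C : Graded r} → A ≐ B → B ≐ C → A ≐ C
≐-trans h h′ N u v u∈ v∈ = trans (h N u v u∈ v∈) (h′ N u v u∈ v∈)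

⊙-cong : ∀ {r} {A A′ B B′ : Graded r} → A ≐ A′ → B ≐ B′ → (A ⊙ B) ≐ (A′ ⊙ B′)
⊙-cong {r} {A} {A′} {B} {B′} h h′ N u v u∈ v∈ =
  ⟨⟩-cong (S N r) {A N} {A′ N} {B N} {B′ N} (λ w w∈ → h N u w u∈ w∈) (λ w w∈ → h′ N w v w∈ v∈)

δᴳ-⊙ : ∀ {r} (A : Graded r) → (δᴳ ⊙ A) ≐ A
δᴳ-⊙ {r} A N u v u∈ v∈ = MatricesOn.*-identityˡ N r (A N) u v u∈ v∈

⊙-δᴳ : ∀ {r} (A : Graded r) → (A ⊙ δᴳ) ≐ A
⊙-δᴳ {r} A N u v u∈ v∈ = MatricesOn.*-identityʳ N r (A N) u v u∈ v∈

-- A generalised inverse may be taken block by block, and traces add up over the blocks.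
rank-blk : ∀ {r} (A : Graded r) N → rankᴳ (blk A) N ≡ ∑ (oddsDown N) (λ a → rankᴳ A (N ∸ a))
rank-blk {r} A N = trans (MatricesOn.rank≡ N (suc r) (blk A N) (blk G N) (law N))
  (trans (MatricesOn.tr-cong N (suc r) {(blk A ⊙ blk G) N} {blk (A ⊙ G) N} (blk-⊙ A G N)) (trᴳ-blk (A ⊙ G) N))
  where
  G = ginvᴳ A
  law : (blk A ⊙ (blk G ⊙ blk A)) ≐ blk A
  law = ≐-trans {B = blk A ⊙ blk (G ⊙ A)} (⊙-cong {A = blk A} {blk A} {blk G ⊙ blk A} {blk (G ⊙ A)} ≐-refl (blk-⊙ G A))
    (≐-trans {B = blk (A ⊙ (G ⊙ A))} (blk-⊙ A (G ⊙ A)) (blk-cong {A = A ⊙ (G ⊙ A)} {A} (ginvᴳ-law A)))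

-- An idempotent is its own generalised inverse, so `tensor 𝐊 G` is one of `tensor 𝐊 A`. Within each
-- weight M the trace is multiplicative, and the trace of `𝐊` is the coefficient of 𝕊.
rank-tensor-𝐊 : ∀ {p} (A : Graded p) N → rankᴳ (tensor 𝐊 A) N ≡ ∑ (upTo (suc N)) (λ M → ι (𝕊 M) * rankᴳ A (N ∸ M))
rank-tensor-𝐊 {p} A N = trans (MatricesOn.rank≡ N (2 ℕ.+ p) (tensor 𝐊 A N) (tensor 𝐊 G N) (law N))
  (trans (MatricesOn.tr-cong N (2 ℕ.+ p) {(tensor 𝐊 A ⊙ tensor 𝐊 G) N} {tensor (𝐊 ⊙ 𝐊) (A ⊙ G) N} (tensor-⊙ 𝐊 𝐊 A G N))
    (trans (trᴳ-tensor (𝐊 ⊙ 𝐊) (A ⊙ G) N) (∑-cong (upTo (suc N)) (λ M → cong (_* rankᴳ A (N ∸ M))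
      (trans (∑-cong∈ (S M 2) (λ u u∈ → 𝐊-idem M u u u∈ u∈)) (PeriodProjector.trace (periodProjector M)))))))
  where
  G = ginvᴳ A
  law : (tensor 𝐊 A ⊙ (tensor 𝐊 G ⊙ tensor 𝐊 A)) ≐ tensor 𝐊 A
  law = ≐-trans {B = tensor 𝐊 A ⊙ tensor (𝐊 ⊙ 𝐊) (G ⊙ A)}
      (⊙-cong {A = tensor 𝐊 A} {tensor 𝐊 A} {tensor 𝐊 G ⊙ tensor 𝐊 A} {tensor (𝐊 ⊙ 𝐊) (G ⊙ A)} ≐-refl (tensor-⊙ 𝐊 𝐊 G A))
    (≐-trans {B = tensor (𝐊 ⊙ (𝐊 ⊙ 𝐊)) (A ⊙ (G ⊙ A))} (tensor-⊙ 𝐊 (𝐊 ⊙ 𝐊) A (G ⊙ A))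
      (tensor-cong {A = 𝐊 ⊙ (𝐊 ⊙ 𝐊)} {𝐊} {A ⊙ (G ⊙ A)} {A}
        (≐-trans {B = 𝐊 ⊙ 𝐊} (⊙-cong {A = 𝐊} {𝐊} {𝐊 ⊙ 𝐊} {𝐊} ≐-refl 𝐊-idem) 𝐊-idem) (ginvᴳ-law A)))

-- The last factor is left open: E completes the product to C, a matrix E⁽ʲ⁾ to Φ, and `δᴳ` gives
-- the bare product.
prodE : ∀ r → List ℕ → Graded r → Graded r
prodE r L X N = foldr (λ j A → EjV r j ⟨ S N r ⟩ A) (X N) L

eV : ∀ r → Graded r
eV r _ u v = e (Vec.toList u) (Vec.toList v)

EV : ∀ r → ℕ → Graded r
EV r j _ = EjV r j

CV : ∀ r → Graded r
CV r = prodE r (between 2 (r ∸ 1)) (eV r)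

prodE-tup : ∀ N r L (A : Mat N r) (X : Graded r) → (∀ i k → A i k ≡ X N (tup N r i) (tup N r k)) → ∀ i k →
  foldr (λ j B → matMul N r (Ej N r j) B) A L i k ≡ prodE r L X N (tup N r i) (tup N r k)
prodE-tup N r []      A X h i k = h i k
prodE-tup N r (j ∷ L) A X h i k = trans
  (∑-cong (allFin (size N r)) (λ l → cong (Ej N r j i l *_) (prodE-tup N r L A X h l k)))
  (∑-tup N r (λ w → EjV r j (tup N r i) w * prodE r L X N w (tup N r k)))

C-tup : ∀ N r i k → C N r i k ≡ CV r N (tup N r i) (tup N r k)
C-tup N r = prodE-tup N r (between 2 (r ∸ 1)) (E N r) (eV r) (λ i k → refl)

prodE-cong : ∀ r L {X Y : Graded r} → X ≐ Y → prodE r L X ≐ prodE r L Y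
prodE-cong r []      h = h
prodE-cong r (j ∷ L) {X} {Y} h = ⊙-cong {A = EV r j} {EV r j} {prodE r L X} {prodE r L Y} ≐-refl (prodE-cong r L h)

prodE-⊙ : ∀ r L (X Y : Graded r) → prodE r L (X ⊙ Y) ≐ (prodE r L X ⊙ Y)
prodE-⊙ r []      X Y N u v _ _ = refl
prodE-⊙ r (j ∷ L) X Y = ≐-trans {B = EV r j ⊙ (prodE r L X ⊙ Y)}
  (⊙-cong {A = EV r j} {EV r j} {prodE r L (X ⊙ Y)} {prodE r L X ⊙ Y} ≐-refl (prodE-⊙ r L X Y))
  (λ N u v _ _ → sym (⟨⟩-assoc (S N r) (S N r) (EjV r j) (prodE r L X N) (Y N) u v))

prodE-snoc : ∀ r L q (X : Graded r) N → prodE r (L ++ q ∷ []) X N ≡ prodE r L (EV r q ⊙ X) N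
prodE-snoc r L q X N = ListP.foldr-++ (λ j A → EjV r j ⟨ S N r ⟩ A) (X N) L (q ∷ [])

between-snoc : ∀ n → between 2 (2 ℕ.+ n) ≡ between 2 (suc n) ++ (2 ℕ.+ n) ∷ []
between-snoc n = trans (cong (map (2 ℕ.+_)) (sym (ListP.upTo-∷ʳ n))) (ListP.map-++ (2 ℕ.+_) (upTo n) (n ∷ []))

between-bounds : ∀ n j → j ∈ between 2 (suc n) → 1 ≤ j × j ≤ suc n
between-bounds n j j∈ with ∈P.∈-map⁻ (2 ℕ.+_) j∈
... | i , i∈ , refl = s≤s z≤n , s≤s (∈P.∈-upTo⁻ i∈)

EjV-blk : ∀ q j → j ≤ q → EV (suc q) j ≐ blk (EV q j)
EjV-blk q j j≤q N (a ∷ l) (b ∷ l′) _ _ rewrite ℕP.+-∸-assoc 1 j≤q = begin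
  (if ⌊ ListP.≡-dec ℕ._≟_ (a ∷ tl) (b ∷ tl′) ⌋ then x else 0ℚ)
    ≡⟨ if-ind (ListP.≡-dec ℕ._≟_ (a ∷ tl) (b ∷ tl′)) x ⟩
  ind (ListP.≡-dec ℕ._≟_ (a ∷ tl) (b ∷ tl′)) * x
    ≡⟨ cong (_* x) (ind-* (a ℕ.≟ b) (ListP.≡-dec ℕ._≟_ tl tl′) (ListP.≡-dec ℕ._≟_ (a ∷ tl) (b ∷ tl′))
         (λ h h′ → cong₂ _∷_ h h′) ListP.∷-injectiveˡ ListP.∷-injectiveʳ) ⟩
  ind (a ℕ.≟ b) * ind (ListP.≡-dec ℕ._≟_ tl tl′) * x
    ≡⟨ trans (ℚP.*-assoc (ind (a ℕ.≟ b)) (ind (ListP.≡-dec ℕ._≟_ tl tl′)) x) (cong (ind (a ℕ.≟ b) *_) (sym (if-ind (ListP.≡-dec ℕ._≟_ tl tl′) x))) ⟩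
  ind (a ℕ.≟ b) * (if ⌊ ListP.≡-dec ℕ._≟_ tl tl′ ⌋ then x else 0ℚ) ∎
  where
  open ≡-Reasoning
  tl  = List.take (q ∸ j) (Vec.toList l)
  tl′ = List.take (q ∸ j) (Vec.toList l′)
  x   = e (List.drop (q ∸ j) (Vec.toList l)) (List.drop (q ∸ j) (Vec.toList l′))

prodE-blk : ∀ q L → (∀ j → j ∈ L → j ≤ q) → (X : Graded q) → prodE (suc q) L (blk X) ≐ blk (prodE q L X)
prodE-blk q []      _ X N u v _ _ = refl
prodE-blk q (j ∷ L) h X = ≐-trans {B = blk (EV q j) ⊙ blk (prodE q L X)}
  (⊙-cong {A = EV (suc q) j} {blk (EV q j)} {prodE (suc q) L (blk X)} {blk (prodE q L X)} (EjV-blk q j (h j (here refl))) (prodE-blk q L (λ i i∈ → h i (there i∈)) X))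
  (blk-⊙ (EV q j) (prodE q L X))

EV-full : ∀ q → EV q q ≐ eV q
EV-full q N u v _ _ rewrite ℕP.n∸n≡0 q = refl

-- E⁽²⁾ ⋯ E⁽q⁾ in q + 1 variables, for q = n + 2
Φm : ∀ n → Graded (3 ℕ.+ n)
Φm n = prodE (3 ℕ.+ n) (between 2 (suc n)) (EV (3 ℕ.+ n) (2 ℕ.+ n))

-- In q + 1 variables the factors E⁽ʲ⁾ with j ≤ q keep n₁ fixed. On each block the last of them,
-- E⁽q⁾, is the full matrix E in q variables, which completes the product to C.
partial-blk : ∀ n → prodE (3 ℕ.+ n) (between 2 (suc n)) (EV (3 ℕ.+ n) (2 ℕ.+ n)) ≐ blk (CV (2 ℕ.+ n))
partial-blk n = ≐-trans {B = prodE (suc q) (between 2 (suc n)) (blk (eV q))}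
  (prodE-cong (suc q) (between 2 (suc n)) {EV (suc q) q} {blk (eV q)}
    (≐-trans {B = blk (EV q q)} (EjV-blk q q ℕP.≤-refl) (blk-cong {A = EV q q} {eV q} (EV-full q))))
  (prodE-blk q (between 2 (suc n)) (λ j j∈ → ℕP.≤-trans (proj₂ (between-bounds n j j∈)) (ℕP.n≤1+n (suc n))) (eV q))
  where q = 2 ℕ.+ n

CV-Φm : ∀ n → CV (3 ℕ.+ n) ≐ (Φm n ⊙ eV (3 ℕ.+ n))
CV-Φm n = ≐-trans {B = prodE r (between 2 (suc n)) (EV r (2 ℕ.+ n) ⊙ eV r)}
  (λ N u v _ _ → cong (λ A → A u v) (trans (cong (λ L → prodE r L (eV r) N) (between-snoc n)) (prodE-snoc r (between 2 (suc n)) (2 ℕ.+ n) (eV r) N)))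
  (prodE-⊙ r (between 2 (suc n)) (EV r (2 ℕ.+ n)) (eV r))
  where r = 3 ℕ.+ n

-- C in n + 1 variables, completed by the identity for one variable: this matches T₁ = 0.
CV⁺ : ∀ n → Graded (suc n)
CV⁺ zero    = δᴳ
CV⁺ (suc n) = CV (2 ℕ.+ n)

-- E⁽ʳ⁻¹⁾ is the only factor of Φ that moves x₂. Splitting it off leaves the identity on the first
-- two variables, tensored with C in the others; for r = 3 the product left over is empty.
Φm-factor : ∀ n → Σ (Graded (3 ℕ.+ n)) λ A → A ≐ tensor δᴳ (CV⁺ n) × Φm n ≐ (A ⊙ EV (3 ℕ.+ n) (2 ℕ.+ n))
Φm-factor zero = δᴳ , unit , ≐-sym {A = δᴳ ⊙ EV 3 2} {EV 3 2} (δᴳ-⊙ (EV 3 2))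
  where
  unit : δᴳ ≐ tensor δᴳ δᴳ
  unit = ≐-trans {B = blk (blk δᴳ)} (λ { N (a ∷ b ∷ c ∷ []) (a′ ∷ b′ ∷ c′ ∷ []) _ _ → trans
      (ind-* (a ℕ.≟ a′) (b ∷ c ∷ [] ≟V b′ ∷ c′ ∷ []) (a ∷ b ∷ c ∷ [] ≟V a′ ∷ b′ ∷ c′ ∷ []) (λ { refl refl → refl }) VecP.∷-injectiveˡ VecP.∷-injectiveʳ)
      (cong (ind (a ℕ.≟ a′) *_) (ind-* (b ℕ.≟ b′) (c ∷ [] ≟V c′ ∷ []) (b ∷ c ∷ [] ≟V b′ ∷ c′ ∷ []) (λ { refl refl → refl }) VecP.∷-injectiveˡ VecP.∷-injectiveʳ)) })
    (blk-blk δᴳ)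
Φm-factor (suc n) = A ,
  ≐-trans {B = blk (prodE (3 ℕ.+ n) L (EV (3 ℕ.+ n) p))} inner
    (≐-trans {B = blk (blk (CV p))} (blk-cong {A = prodE (3 ℕ.+ n) L (EV (3 ℕ.+ n) p)} {blk (CV p)} (partial-blk n)) (blk-blk (CV p))) ,
  ≐-trans {B = prodE r L (EV r p ⊙ EV r (3 ℕ.+ n))}
    (λ N u v _ _ → cong (λ B → B u v) (trans (cong (λ L → prodE r L (EV r (3 ℕ.+ n)) N) (between-snoc n)) (prodE-snoc r L p (EV r (3 ℕ.+ n)) N)))
    (prodE-⊙ r L (EV r p) (EV r (3 ℕ.+ n)))
  where
  r = 4 ℕ.+ n
  p = 2 ℕ.+ n
  L = between 2 (suc n)
  A = prodE r L (EV r p)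
  inner : A ≐ blk (prodE (3 ℕ.+ n) L (EV (3 ℕ.+ n) p))
  inner = ≐-trans {B = prodE r L (blk (EV (3 ℕ.+ n) p))}
    (prodE-cong r L {EV r p} {blk (EV (3 ℕ.+ n) p)} (EjV-blk (3 ℕ.+ n) p (ℕP.n≤1+n p)))
    (prodE-blk (3 ℕ.+ n) L (λ j j∈ → ℕP.≤-trans (proj₂ (between-bounds n j j∈)) (ℕP.m≤n+m (suc n) 2)) (EV (3 ℕ.+ n) p))

-- 1 - G A projects onto the right kernel of A. Its columns expand in the basis `b` with
-- coefficients `c`, and independence makes `c` dual to `b`. Hence the trace of the projector is
-- that of the identity of size d.
kernel-dimension : ∀ n (A G : Fin n → Fin n → ℚ) → IsGInv (allFin n) (allFin n) A G →
  ∀ d (b : Fin d → Fin n → ℚ) →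
  (∀ j i → ∑ (allFin n) (λ k → A i k * b j k) ≡ 0ℚ) →
  (∀ (c : Fin d → ℚ) → (∀ i → ∑ (allFin d) (λ j → c j * b j i) ≡ 0ℚ) → ∀ j → c j ≡ 0ℚ) →
  (∀ x → (∀ i → ∑ (allFin n) (λ k → A i k * x k) ≡ 0ℚ) → Σ (Fin d → ℚ) λ c → ∀ i → x i ≡ ∑ (allFin d) (λ j → c j * b j i)) →
  ∑ (allFin d) (λ _ → 1ℚ) ≡ ∑ (allFin n) (λ _ → 1ℚ) - ∑ (allFin n) (λ i → (A ⟨ allFin n ⟩ G) i i)
kernel-dimension n A G AGA d b bker indep span = begin
  ∑ Ld (λ _ → 1ℚ)                              ≡⟨ ∑-cong Ld (λ j → trans (sym (ind-refl (j Fin.≟ j))) (sym (dual j j))) ⟩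
  ∑ Ld (λ j → (c ⟨ Ln ⟩ bᵀ) j j)               ≡⟨ tr⟨⟩-comm Ld Ln c bᵀ ⟩
  ∑ Ln (λ i → (bᵀ ⟨ Ld ⟩ c) i i)               ≡⟨ ∑-cong Ln (λ i → trans (∑-cong Ld (λ j → ℚP.*-comm (b j i) (c j i))) (sym (coords i i))) ⟩
  ∑ Ln (λ i → Pr i i)                          ≡⟨ ∑-- Ln (λ i → ind (i Fin.≟ i)) (λ i → (G ⟨ Ln ⟩ A) i i) ⟩
  ∑ Ln (λ i → ind (i Fin.≟ i)) - ∑ Ln (λ i → (G ⟨ Ln ⟩ A) i i)
    ≡⟨ cong₂ _-_ (∑-cong Ln (λ i → ind-refl (i Fin.≟ i))) (tr⟨⟩-comm Ln Ln G A) ⟩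
  ∑ Ln (λ _ → 1ℚ) - ∑ Ln (λ i → (A ⟨ Ln ⟩ G) i i) ∎
  where
  open ≡-Reasoning
  Ln = allFin n
  Ld = allFin d
  bᵀ : Fin n → Fin d → ℚ
  bᵀ i j = b j i
  Pr : Fin n → Fin n → ℚ
  Pr i k = ind (i Fin.≟ k) - (G ⟨ Ln ⟩ A) i k
  Pr-kernel : ∀ k i → ∑ Ln (λ l → A i l * Pr l k) ≡ 0ℚ
  Pr-kernel k i = trans (∑-cong Ln (λ l → *-distribˡ-- (A i l) (ind (l Fin.≟ k)) ((G ⟨ Ln ⟩ A) l k)))
    (trans (∑-- Ln (λ l → A i l * ind (l Fin.≟ k)) (λ l → A i l * (G ⟨ Ln ⟩ A) l k))
      (trans (cong₂ _-_ (∑-δʳ Fin._≟_ (UniqueP.allFin⁺ n) (A i) (∈P.∈-allFin k)) (AGA i k (∈P.∈-allFin i) (∈P.∈-allFin k)))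
        (ℚP.+-inverseʳ (A i k))))
  c : Fin d → Fin n → ℚ
  c j k = proj₁ (span (λ i → Pr i k) (Pr-kernel k)) j
  coords : ∀ i k → Pr i k ≡ ∑ Ld (λ j → c j k * b j i)
  coords i k = proj₂ (span (λ i → Pr i k) (Pr-kernel k)) i
  Pr-fix : ∀ j i → ∑ Ln (λ k → Pr i k * b j k) ≡ b j i
  Pr-fix j i = trans (∑-cong Ln (λ k → *-distribʳ-- (ind (i Fin.≟ k)) ((G ⟨ Ln ⟩ A) i k) (b j k)))
    (trans (∑-- Ln (λ k → ind (i Fin.≟ k) * b j k) (λ k → (G ⟨ Ln ⟩ A) i k * b j k))
      (trans (cong₂ _-_ (∑-δ Fin._≟_ (UniqueP.allFin⁺ n) (b j) (∈P.∈-allFin i))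
        (trans (⟨⟩-assoc Ln Ln G A (λ k (_ : ℕ) → b j k) i 0) (∑-zero∈ Ln (λ l _ → trans (cong (G i l *_) (bker j l)) (ℚP.*-zeroʳ (G i l))))))
        (ℚP.+-identityʳ (b j i))))
  dual : ∀ j j′ → (c ⟨ Ln ⟩ bᵀ) j j′ ≡ ind (j Fin.≟ j′)
  dual j j′ = -‿zero _ _ (indep (λ j → (c ⟨ Ln ⟩ bᵀ) j j′ - ind (j Fin.≟ j′)) relation j)
    where
    relation : ∀ i → ∑ Ld (λ j → ((c ⟨ Ln ⟩ bᵀ) j j′ - ind (j Fin.≟ j′)) * b j i) ≡ 0ℚ
    relation i = begin
      ∑ Ld (λ j → ((c ⟨ Ln ⟩ bᵀ) j j′ - ind (j Fin.≟ j′)) * b j i)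
        ≡⟨ trans (∑-cong Ld (λ j → *-distribʳ-- ((c ⟨ Ln ⟩ bᵀ) j j′) (ind (j Fin.≟ j′)) (b j i))) (∑-- Ld (λ j → (c ⟨ Ln ⟩ bᵀ) j j′ * b j i) (λ j → ind (j Fin.≟ j′) * b j i)) ⟩
      ∑ Ld (λ j → (c ⟨ Ln ⟩ bᵀ) j j′ * b j i) - ∑ Ld (λ j → ind (j Fin.≟ j′) * b j i)
        ≡⟨ cong₂ _-_ (trans (∑-cong Ld (λ j → ℚP.*-comm ((c ⟨ Ln ⟩ bᵀ) j j′) (b j i))) (trans (sym (⟨⟩-assoc Ld Ln bᵀ c bᵀ i j′))
             (trans (∑-cong Ln (λ k → cong (_* b j′ k) (trans (∑-cong Ld (λ j → ℚP.*-comm (b j i) (c j k))) (sym (coords i k))))) (Pr-fix j′ i))))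
             (trans (∑-cong Ld (λ j → trans (ℚP.*-comm (ind (j Fin.≟ j′)) (b j i)) refl)) (∑-δʳ Fin._≟_ (UniqueP.allFin⁺ d) (λ j → b j i) (∈P.∈-allFin j′))) ⟩
      b j′ i - b j′ i
        ≡⟨ ℚP.+-inverseʳ (b j′ i) ⟩
      0ℚ ∎

KerDim-rank : ∀ N r d → KerDim N r (C N r) d → ∑ (allFin d) (λ _ → 1ℚ) ≡ num N r - rankᴳ (CV r) N
KerDim-rank N r d (b , bker , indep , span) = trans
  (kernel-dimension (size N r) (C N r) G law d b bker indep span)
  (cong₂ _-_ (∑-tup N r (λ _ → 1ℚ)) (trans (∑-cong Ls (λ i → trans (∑-cong Ls (λ k → cong (_* G k i) (C-tup N r i k))) (∑-tup N r (λ w → CV r N (tup N r i) w * Gᴳ w (tup N r i)))))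
    (∑-tup N r (λ u → (CV r N ⟨ S N r ⟩ Gᴳ) u u))))
  where
  Ls = allFin (size N r)
  Gᴳ = ginvᴳ (CV r) N
  G : Fin (size N r) → Fin (size N r) → ℚ
  G i k = Gᴳ (tup N r i) (tup N r k)
  law : IsGInv Ls Ls (C N r) G
  law i k _ _ = trans (∑-cong Ls (λ l → cong₂ _*_ (C-tup N r i l) (trans
      (∑-cong Ls (λ l′ → cong (G l l′ *_) (C-tup N r l′ k))) (∑-tup N r (λ w → Gᴳ (tup N r l) w * CV r N w (tup N r k))))))
    (trans (∑-tup N r (λ w → CV r N (tup N r i) w * (Gᴳ ⟨ S N r ⟩ CV r N) w (tup N r k)))
      (trans (ginvᴳ-law (CV r) N (tup N r i) (tup N r k) (tup∈S N r i) (tup∈S N r k)) (sym (C-tup N r i k))))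

-- The rank recursion

restrict : ∀ N r → (Vec ℕ r → ℚ) → Vect N r
restrict N r t = t ∘ tup N r

extend-restrict : ∀ N r t u → u ∈ S N r → extend N r (restrict N r t) u ≡ t u
extend-restrict N r t u u∈ with tup-surjective N r u∈
... | i , refl = extend-tup N r (restrict N r t) i

∑-extend : ∀ N r (v : Vect N r) (f : Vec ℕ r → ℚ) → ∑ (allFin (size N r)) (λ i → v i * f (tup N r i)) ≡ ∑ (S N r) (λ u → extend N r v u * f u)
∑-extend N r v f = trans (∑-cong (allFin (size N r)) (λ i → cong (_* f (tup N r i)) (sym (extend-tup N r v i))))
  (∑-tup N r (λ u → extend N r v u * f u))

-- Row vectors are multiplied from the right, so φ⁽²⁾, which is applied first, becomes the leftmost
-- factor.
foldl-φ : ∀ N r L → (∀ j → j ∈ L → 1 ≤ j × j ≤ r) → ∀ v i →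
  foldl (λ w j → φ N r j w) v L i ≡ ∑ (allFin (size N r)) (λ l → v l * prodE r L δᴳ N (tup N r l) (tup N r i))
foldl-φ N r [] h v i = sym (trans
  (∑-cong (allFin (size N r)) (λ l → cong (v l *_) (ind-⇔ (tup N r l ≟V tup N r i) (l Fin.≟ i) (lookup-injective (Unique-S N r) l i) (λ { refl → refl }))))
  (∑-δʳ Fin._≟_ (UniqueP.allFin⁺ (size N r)) v (∈P.∈-allFin i)))
foldl-φ N r (j ∷ L) h v i = begin
  foldl (λ w j → φ N r j w) (φ N r j v) L i
    ≡⟨ foldl-φ N r L (λ j j∈ → h j (there j∈)) (φ N r j v) i ⟩
  ∑ A (λ l → φ N r j v l * X (tup N r l))
    ≡⟨ ∑-cong A (λ l → cong (_* X (tup N r l)) (φ-vecMat N r j v l (proj₁ (h j (here refl))) (proj₂ (h j (here refl))))) ⟩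
  ∑ A (λ l → ∑ A (λ k → v k * Ej N r j k l) * X (tup N r l))
    ≡⟨ ⟨⟩-assoc A A (λ (_ : ℕ) → v) (Ej N r j) (λ l (_ : ℕ) → X (tup N r l)) 0 0 ⟩
  ∑ A (λ k → v k * ∑ A (λ l → Ej N r j k l * X (tup N r l)))
    ≡⟨ ∑-cong A (λ k → cong (v k *_) (∑-tup N r (λ w → EjV r j (tup N r k) w * X w))) ⟩
  ∑ A (λ k → v k * prodE r (j ∷ L) δᴳ N (tup N r k) (tup N r i)) ∎
  where
  open ≡-Reasoning
  A = allFin (size N r)
  X : Vec ℕ r → ℚ
  X w = prodE r L δᴳ N w (tup N r i)

module RankRecursion (hypA : HypA) (hypB : HypB) (n N : ℕ) (0<N : 0 < N) where
  private
    r q : ℕ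
    r = 3 ℕ.+ n
    q = 2 ℕ.+ n

  open MatricesOn N r
  open Slices N (suc n) using (𝐤; 𝐤-fix; 𝐤-into)

  private
    p E₀ A E′ : Carrier
    p  = Φm n N
    E₀ = eV r N
    A  = proj₁ (Φm-factor n) N
    E′ = EV r q N

  Φ-extend : ∀ v i → Φ N r v i ≡ ∑ (S N r) (λ u → extend N r v u * p u (tup N r i))
  Φ-extend v i = trans (foldl-φ N r (between 2 q) (λ j j∈ → proj₁ (between-bounds (suc n) j j∈) , ℕP.≤-trans (proj₂ (between-bounds (suc n) j j∈)) (ℕP.n≤1+n q)) v i)
    (trans (∑-cong (allFin (size N r)) (λ l → cong (v l *_) (last (tup N r l) (tup N r i) (tup∈S N r l) (tup∈S N r i))))
      (∑-extend N r v (λ u → p u (tup N r i))))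
    where
    last : ∀ u w → u ∈ S N r → w ∈ S N r → prodE r (between 2 q) δᴳ N u w ≡ p u w
    last u w u∈ w∈ = trans (cong (λ B → B u w) (trans (cong (λ L → prodE r L δᴳ N) (between-snoc n)) (prodE-snoc r (between 2 (suc n)) q δᴳ N)))
      (prodE-cong r (between 2 (suc n)) {EV r q ⊙ δᴳ} {EV r q} (⊙-δᴳ (EV r q)) N u w u∈ w∈)

  Φ-restrict : ∀ t i → Φ N r (restrict N r t) i ≡ ∑ (S N r) (λ u → t u * p u (tup N r i))
  Φ-restrict t i = trans (Φ-extend (restrict N r t) i)
    (∑-cong∈ (S N r) (λ u u∈ → cong (_* p u (tup N r i)) (extend-restrict N r t u u∈)))

  φ-Φ : ∀ (D : Carrier) u i → φ N r r (Φ N r (restrict N r (D u))) i ≡ ((D · p) · E₀) u (tup N r i)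
  φ-Φ D u i = trans (φ-vecMat N r r (Φ N r (restrict N r (D u))) i (s≤s z≤n) ℕP.≤-refl)
    (trans (∑-cong (allFin (size N r)) (λ l → cong₂ _*_ (Φ-restrict (D u) l) (EV-full r N (tup N r l) (tup N r i) (tup∈S N r l) (tup∈S N r i))))
      (∑-tup N r (λ w → (D · p) u w * E₀ w (tup N r i))))

  row-period : ∀ (D : Carrier) → D · 𝐤 ≈ D → ∀ u → u ∈ S N r → PeriodEq (fval N r (D u))
  row-period D Dk u u∈ = PeriodEq-cong (fval-cong N r (λ v v∈ → Dk u v u∈ v∈)) (𝐤-into (D u))

  restrict-InW : ∀ t → PeriodEq (fval N r t) → InW N r (restrict N r t)
  restrict-InW t eq = PeriodEq⇒InW N (suc n) (restrict N r t)
    (PeriodEq-cong (fval-cong N r (λ u u∈ → sym (extend-restrict N r t u u∈))) eq)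

  𝐤𝐤≈𝐤 : 𝐤 · 𝐤 ≈ 𝐤
  𝐤𝐤≈𝐤 = ≐-trans {B = tensor (𝐊 ⊙ 𝐊) (δᴳ ⊙ δᴳ)} (tensor-⊙ 𝐊 𝐊 δᴳ δᴳ)
    (tensor-cong {A = 𝐊 ⊙ 𝐊} {𝐊} {δᴳ ⊙ δᴳ} {δᴳ} 𝐊-idem (δᴳ-⊙ δᴳ)) N

  -- The inclusion from left to right in (b), applied to the rows of `𝐤`, which lie in W.
  𝐤pE≈0 : (𝐤 · p) · E₀ ≈ 0#
  𝐤pE≈0 u v u∈ v∈ with tup-surjective N r v∈
  ... | i , refl = trans (sym (φ-Φ 𝐤 u i)) (proj₁ (Equivalence.to (hypB r N (s≤s (s≤s (s≤s z≤n))) 0<N (Φ N r t))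
      (t , restrict-InW (𝐤 u) (row-period 𝐤 𝐤𝐤≈𝐤 u u∈) , λ _ → refl)) i)
    where t = restrict N r (𝐤 u)

  private
    b g c : Carrier
    b = p · E₀
    g = proj₁ (ginv² b)
    -- The rows span the left kernel of `b`, that is, the vectors whose image under Φ lies in ker
    -- φ⁽ʳ⁾.
    c = 1# ⊟ b · g

  cpE≈0 : (c · p) · E₀ ≈ 0#
  cpE≈0 = ≈-trans {(c · p) · E₀} {c · b} (*-assoc c p E₀) (≈-trans {c · b} {1# · b ⊟ b · g · b} (⊟-distribʳ 1# (b · g) b)
    (≈-trans {1# · b ⊟ b · g · b} {b ⊟ b} (⊟-cong {1# · b} {b} {b · g · b} {b} (*-identityˡ b) (≈-trans {b · g · b} {b · (g · b)} (*-assoc b g b) (proj₂ (ginv² b))))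
      (λ u v _ _ → ℚP.+-inverseʳ (b u v))))

  module Preimages
    (preimage : ∀ i → Σ (Vect N r) λ P → InW N r P × Eq N r (Φ N r P) (Φ N r (restrict N r (c (tup N r i))))) where

    -- Each row is an element of W with the same image under Φ as the corresponding row of `c`; its
    -- existence is the inclusion from right to left in (b).
    y : Carrier
    y u w = extend N r (λ i → extend N r (proj₁ (preimage i)) w) u

    y-tup : ∀ i w → y (tup N r i) w ≡ extend N r (proj₁ (preimage i)) w
    y-tup i w = extend-tup N r (λ i → extend N r (proj₁ (preimage i)) w) i

    y𝐤-tup : ∀ i v → v ∈ S N r → (y · 𝐤) (tup N r i) v ≡ y (tup N r i) v
    y𝐤-tup i v v∈ = trans (∑-cong (S N r) (λ w → cong (_* 𝐤 w v) (y-tup i w)))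
      (trans (𝐤-fix (extend N r (proj₁ (preimage i))) (InW⇒PeriodEq N (suc n) (proj₁ (preimage i)) (proj₁ (proj₂ (preimage i)))) v v∈)
        (sym (y-tup i v)))

    y𝐤≈y : y · 𝐤 ≈ y
    y𝐤≈y u v u∈ v∈ = ≡.subst (λ u → (y · 𝐤) u v ≡ y u v) (proj₂ (tup-surjective N r u∈)) (y𝐤-tup (proj₁ (tup-surjective N r u∈)) v v∈)

    yp-tup : ∀ i j → (y · p) (tup N r i) (tup N r j) ≡ (c · p) (tup N r i) (tup N r j)
    yp-tup i j = trans (∑-cong (S N r) (λ w → cong (_* p w (tup N r j)) (y-tup i w)))
      (trans (sym (Φ-extend (proj₁ (preimage i)) j)) (trans (proj₂ (proj₂ (preimage i)) j) (Φ-restrict (c (tup N r i)) j)))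

    yp≈cp : y · p ≈ c · p
    yp≈cp u v u∈ v∈ = ≡.subst₂ (λ u v → (y · p) u v ≡ (c · p) u v) (proj₂ (tup-surjective N r u∈)) (proj₂ (tup-surjective N r v∈))
      (yp-tup (proj₁ (tup-surjective N r u∈)) (proj₁ (tup-surjective N r v∈)))

  private
    preimage : ∀ i → Σ (Vect N r) λ P → InW N r P × Eq N r (Φ N r P) (Φ N r (restrict N r (c (tup N r i))))
    preimage i = Equivalence.from (hypB r N (s≤s (s≤s (s≤s z≤n))) 0<N (Φ N r t))
      ((λ j → trans (φ-Φ c (tup N r i) j) (cpE≈0 (tup N r i) (tup N r j) (tup∈S N r i) (tup∈S N r j))) , t , λ _ → refl)
      where t = restrict N r (c (tup N r i))

  open Preimages preimage

  E′-injective : ∀ d → d · 𝐤 ≈ d → d · E′ ≈ 0# → d ≈ 0#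
  E′-injective d dk dE u v u∈ v∈ = trans (cong (d u) (sym (proj₂ (tup-surjective N r v∈))))
    (Ej-injective-on-W hypA N (suc n) 0<N t (restrict-InW (d u) (row-period d dk u u∈)) kills (proj₁ (tup-surjective N r v∈)))
    where
    t : Vect N r
    t = restrict N r (d u)
    kills : Eq N r (vecMat N r t (Ej N r q)) (zeroV N r)
    kills k = trans (∑-tup N r (λ w → d u w * EjV r q w (tup N r k))) (dE u (tup N r k) u∈ (tup∈S N r k))

  private
    𝐤Aᴳ : Graded r
    𝐤Aᴳ = tensor 𝐊 δᴳ ⊙ proj₁ (Φm-factor n)

    𝐤A≐ : 𝐤Aᴳ ≐ tensor 𝐊 (CV⁺ n)
    𝐤A≐ = ≐-trans {B = tensor 𝐊 δᴳ ⊙ tensor δᴳ (CV⁺ n)}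
      (⊙-cong {A = tensor 𝐊 δᴳ} {tensor 𝐊 δᴳ} {proj₁ (Φm-factor n)} {tensor δᴳ (CV⁺ n)} ≐-refl (proj₁ (proj₂ (Φm-factor n))))
      (≐-trans {B = tensor (𝐊 ⊙ δᴳ) (δᴳ ⊙ CV⁺ n)} (tensor-⊙ 𝐊 δᴳ δᴳ (CV⁺ n))
        (tensor-cong {A = 𝐊 ⊙ δᴳ} {𝐊} {δᴳ ⊙ CV⁺ n} {CV⁺ n} (⊙-δᴳ 𝐊) (δᴳ-⊙ (CV⁺ n))))

  -- `A` is the identity on the first two variables and `𝐤` on the others, so W is stable under `A`.
  -- The injectivity of E⁽ʳ⁻¹⁾ on W, which rests on (a), can therefore be used on the rows of
  -- `𝐤 · A`.
  𝐤A𝐤≈𝐤A : (𝐤 · A) · 𝐤 ≈ 𝐤 · A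
  𝐤A𝐤≈𝐤A = ≐-trans {A = 𝐤Aᴳ ⊙ tensor 𝐊 δᴳ} {tensor 𝐊 (CV⁺ n) ⊙ tensor 𝐊 δᴳ} {𝐤Aᴳ}
    (⊙-cong {A = 𝐤Aᴳ} {tensor 𝐊 (CV⁺ n)} {tensor 𝐊 δᴳ} {tensor 𝐊 δᴳ} 𝐤A≐ ≐-refl)
    (≐-trans {B = tensor (𝐊 ⊙ 𝐊) (CV⁺ n ⊙ δᴳ)} (tensor-⊙ 𝐊 𝐊 (CV⁺ n) δᴳ)
      (≐-trans {B = tensor 𝐊 (CV⁺ n)} (tensor-cong {A = 𝐊 ⊙ 𝐊} {𝐊} {CV⁺ n ⊙ δᴳ} {CV⁺ n} 𝐊-idem (⊙-δᴳ (CV⁺ n))) (≐-sym {A = 𝐤Aᴳ} {tensor 𝐊 (CV⁺ n)} 𝐤A≐))) N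

  𝐤p≈𝐤AE′ : 𝐤 · p ≈ (𝐤 · A) · E′
  𝐤p≈𝐤AE′ = ≈-trans {𝐤 · p} {𝐤 · (A · E′)} (*-congˡ {𝐤} {p} {A · E′} (proj₂ (proj₂ (Φm-factor n)) N))
    (≈-sym {(𝐤 · A) · E′} {𝐤 · (A · E′)} (*-assoc 𝐤 A E′))

  rank-𝐤p : rank (𝐤 · p) ≡ rank (𝐤 · A)
  rank-𝐤p = rank-injective {𝐤} {𝐤 · A} {𝐤 · p} {E′} {proj₁ (ginv² (𝐤 · A))} {proj₁ (ginv² (𝐤 · p))} {proj₁ (ginv² (𝐤 · E′))}
    𝐤𝐤≈𝐤 𝐤A𝐤≈𝐤A 𝐤p≈𝐤AE′ E′-injective (proj₂ (ginv² (𝐤 · E′))) (proj₂ (ginv² (𝐤 · A))) (proj₂ (ginv² (𝐤 · p)))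

  rank-recursion⁺ : rankᴳ (CV r) N ≡ ∑ (oddsDown N) (λ a → rankᴳ (CV q) (N ∸ a)) - ∑ (upTo (suc N)) (λ M → ι (𝕊 M) * rankᴳ (CV⁺ n) (N ∸ M))
  rank-recursion⁺ = begin
    rank (CV r N)
      ≡⟨ rank-cong (CV r N) b (CV-Φm n N) ⟩
    rank b
      ≡⟨ lem (rank p) (rank b) ⟩
    rank p - (rank p - rank b)
      ≡⟨ cong (λ z → rank p - z) (rank-drop {p} {E₀} {𝐤} {y} {g} {proj₁ (ginv² p)} {proj₁ (ginv² (𝐤 · p))}
           (proj₂ (ginv² b)) (proj₂ (ginv² p)) (proj₂ (ginv² (𝐤 · p))) 𝐤pE≈0 y𝐤≈y yp≈cp) ⟨
    rank p - rank (𝐤 · p)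
      ≡⟨ cong₂ _-_ (trans (rank-cong p (blk (CV q) N) (partial-blk n N)) (rank-blk (CV q) N))
           (trans rank-𝐤p (trans (rank-cong (𝐤 · A) (tensor 𝐊 (CV⁺ n) N) (𝐤A≐ N)) (rank-tensor-𝐊 (CV⁺ n) N))) ⟩
    _ ∎
    where
    open ≡-Reasoning
    lem : ∀ x y → y ≡ x - (x - y)
    lem = solve-∀ ℚ-ring

rank-recursion : HypA → HypB → ∀ n N →
  rankᴳ (CV (3 ℕ.+ n)) N ≡ ∑ (upTo (suc N)) (λ a → o a * rankᴳ (CV (2 ℕ.+ n)) (N ∸ a)) - ∑ (upTo (suc N)) (λ M → ι (𝕊 M) * rankᴳ (CV⁺ n) (N ∸ M))
-- The hypotheses speak of N > 0. In weight 0 there are no tuples, and the constant terms of 𝕆 and 𝕊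
-- vanish.
rank-recursion hypA hypB n zero    = sym (lem (rankᴳ (CV (2 ℕ.+ n)) 0) (rankᴳ (CV⁺ n) 0))
  where
  lem : ∀ x y → (0ℚ * x + 0ℚ) - (0ℚ * y + 0ℚ) ≡ 0ℚ
  lem = solve-∀ ℚ-ring
rank-recursion hypA hypB n (suc N) = trans (RankRecursion.rank-recursion⁺ hypA hypB n (suc N) (s≤s z≤n))
  (cong (_- ∑ (upTo (suc (suc N))) (λ M → ι (𝕊 M) * rankᴳ (CV⁺ n) (suc N ∸ M))) (∑-oddsDown (suc N) (λ a → rankᴳ (CV (2 ℕ.+ n)) (suc N ∸ a))))

-- From ranks to generating series.

ι-nat : ∀ n → ι (ℤ.+ n) ≡ nat n
ι-nat zero    = refl
ι-nat (suc n) = trans (cong (ι ∘ ℤ.+_) (ℕP.+-comm 1 n)) (trans (ι-+ (ℤ.+ n) (ℤ.+ 1)) (cong (_+ 1ℚ) (ι-nat n)))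

∑-allFin-1 : ∀ d → ∑ (allFin d) (λ _ → 1ℚ) ≡ nat d
∑-allFin-1 d = trans (go (allFin d)) (cong nat (ListP.length-tabulate {n = d} id))
  where
  go : ∀ {I : Set} (xs : List I) → ∑ xs (λ _ → 1ℚ) ≡ nat (length xs)
  go []       = refl
  go (x ∷ xs) = trans (cong (1ℚ +_) (go xs)) (ℚP.+-comm 1ℚ (nat (length xs)))

∑-reverse : ∀ n (h : ℕ → ℚ) → ∑ (upTo (suc n)) (λ a → h (n ∸ a)) ≡ ∑ (upTo (suc n)) h
∑-reverse zero    h = refl
∑-reverse (suc n) h = trans (∑-upTo-0 (suc n) (λ a → h (suc n ∸ a)))
  (trans (cong (h (suc n) +_) (∑-reverse n h)) (trans (ℚP.+-comm (h (suc n)) _) (sym (∑-upTo-suc (suc n) h))))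

-- The index is one less than the number of variables; in one variable `CV⁺` is the identity and the
-- value 0 agrees with T₁.
nullity : ℕ → ℕ → ℚ
nullity n N = num N (suc n) - rankᴳ (CV⁺ n) N

rank-δᴳ : ∀ N → rankᴳ (δᴳ {1}) N ≡ num N 1
rank-δᴳ N = trans (MatricesOn.rank≡ N 1 (δᴳ N) (δᴳ N) (≐-trans {B = δᴳ ⊙ δᴳ} (δᴳ-⊙ (δᴳ ⊙ δᴳ)) (δᴳ-⊙ δᴳ) N))
  (trans (MatricesOn.tr-cong N 1 {(δᴳ ⊙ δᴳ) N} {δᴳ N} (δᴳ-⊙ δᴳ N)) (∑-cong (S N 1) (λ u → ind-refl (u ≟V u))))

ι-T : ∀ dim → (∀ (r N : ℕ) → 2 ≤ r → 0 < N → KerDim N r (C N r) (dim r N)) → ∀ n N → ι (T dim (suc n) N) ≡ nullity n N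
ι-T dim ker zero    N       = sym (trans (cong (λ z → num N 1 - z) (rank-δᴳ N)) (ℚP.+-inverseʳ (num N 1)))
ι-T dim ker (suc n) zero    = refl
ι-T dim ker (suc n) (suc N) = trans (ι-nat (dim (2 ℕ.+ n) (suc N))) (trans (sym (∑-allFin-1 (dim (2 ℕ.+ n) (suc N))))
  (KerDim-rank (suc N) (2 ℕ.+ n) (dim (2 ℕ.+ n) (suc N)) (ker (2 ℕ.+ n) (suc N) (s≤s (s≤s z≤n)) (s≤s z≤n))))

theorem5p3 : HypA → HypB →
    ∀ (dim : ℕ → ℕ → ℕ) →
    (∀ (r N : ℕ) → 2 ≤ r → 0 < N → KerDim N r (C N r) (dim r N)) →
    ∀ (r : ℕ) → 3 ≤ r → ∀ (n : ℕ) →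
    T dim r n ≡ (((𝕆 ⋆ T dim (r ∸ 1)) ⊖ (𝕊 ⋆ T dim (r ∸ 2))) ⊕ (powS 𝕆 (r ∸ 2) ⋆ 𝕊)) n
theorem5p3 hypA hypB dim ker (suc (suc (suc n))) (s≤s (s≤s (s≤s z≤n))) N = ι-injective (begin
  ι (T dim (3 ℕ.+ n) N)
    ≡⟨ ι-T dim ker (2 ℕ.+ n) N ⟩
  num N (3 ℕ.+ n) - rankᴳ (CV (3 ℕ.+ n)) N
    ≡⟨ cong₂ _-_ (num-suc N (2 ℕ.+ n)) (rank-recursion hypA hypB n N) ⟩
  X - (Y - Z)
    -- `V` is the coefficient of 𝕊 times the series 𝕆ʳ⁻² that counts tuples; replacing the ranks in
    -- `Z` by nullities costs exactly this term.
    ≡⟨ lem X Y Z V ⟩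
  ((X - Y) - (V - Z)) + V
    ≡⟨ cong₂ _+_ (cong₂ _-_ odd-part cusp-part) free-part ⟨
  (ι ((𝕆 ⋆ T dim (2 ℕ.+ n)) N) - ι ((𝕊 ⋆ T dim (suc n)) N)) + ι ((powS 𝕆 (suc n) ⋆ 𝕊) N)
    ≡⟨ trans (ι-+ (((𝕆 ⋆ T dim (2 ℕ.+ n)) N) ℤ.- ((𝕊 ⋆ T dim (suc n)) N)) ((powS 𝕆 (suc n) ⋆ 𝕊) N))
         (cong (_+ ι ((powS 𝕆 (suc n) ⋆ 𝕊) N)) (ι-- ((𝕆 ⋆ T dim (2 ℕ.+ n)) N) ((𝕊 ⋆ T dim (suc n)) N))) ⟨
  ι ((((𝕆 ⋆ T dim (2 ℕ.+ n)) ⊖ (𝕊 ⋆ T dim (suc n))) ⊕ (powS 𝕆 (suc n) ⋆ 𝕊)) N) ∎)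
  where
  open ≡-Reasoning
  L = upTo (suc N)
  X = ∑ L (λ a → o a * num (N ∸ a) (2 ℕ.+ n))
  Y = ∑ L (λ a → o a * rankᴳ (CV (2 ℕ.+ n)) (N ∸ a))
  Z = ∑ L (λ M → ι (𝕊 M) * rankᴳ (CV⁺ n) (N ∸ M))
  V = ∑ L (λ M → ι (𝕊 M) * num (N ∸ M) (suc n))
  lem : ∀ x y z v → x - (y - z) ≡ ((x - y) - (v - z)) + v
  lem = solve-∀ ℚ-ring
  odd-part : ι ((𝕆 ⋆ T dim (2 ℕ.+ n)) N) ≡ X - Y
  odd-part = trans (ι-⋆ 𝕆 (T dim (2 ℕ.+ n)) N) (trans
    (∑-cong L (λ a → trans (cong₂ _*_ (ι-𝕆 a) (ι-T dim ker (suc n) (N ∸ a))) (*-distribˡ-- (o a) (num (N ∸ a) (2 ℕ.+ n)) (rankᴳ (CV (2 ℕ.+ n)) (N ∸ a)))))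
    (∑-- L (λ a → o a * num (N ∸ a) (2 ℕ.+ n)) (λ a → o a * rankᴳ (CV (2 ℕ.+ n)) (N ∸ a))))
  cusp-part : ι ((𝕊 ⋆ T dim (suc n)) N) ≡ V - Z
  cusp-part = trans (ι-⋆ 𝕊 (T dim (suc n)) N) (trans
    (∑-cong L (λ M → trans (cong (λ z → ι (𝕊 M) * z) (ι-T dim ker n (N ∸ M))) (*-distribˡ-- (ι (𝕊 M)) (num (N ∸ M) (suc n)) (rankᴳ (CV⁺ n) (N ∸ M)))))
    (∑-- L (λ M → ι (𝕊 M) * num (N ∸ M) (suc n)) (λ M → ι (𝕊 M) * rankᴳ (CV⁺ n) (N ∸ M))))
  free-part : ι ((powS 𝕆 (suc n) ⋆ 𝕊) N) ≡ V
  free-part = trans (ι-⋆ (powS 𝕆 (suc n)) 𝕊 N) (trans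
    (∑-upTo-cong (suc N) (λ a a≤N → trans (cong (_* ι (𝕊 (N ∸ a))) (trans (ι-powS (suc n) a) (cong (λ k → num k (suc n)) (sym (ℕP.m∸[m∸n]≡n (ℕP.≤-pred a≤N))))))
      (ℚP.*-comm (num (N ∸ (N ∸ a)) (suc n)) (ι (𝕊 (N ∸ a))))))
    (∑-reverse N (λ M → ι (𝕊 M) * num (N ∸ M) (suc n))))
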